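{- Let $\Gamma=\mathrm{SL}_3(\mathbb{Z})$. For a prime $q$ let $P_q=P^2(\mathbb{F}_q)$ and let $\Phi_q:\mathrm{SL}_3(\mathbb{Z})\to\mathrm{Sym}(P_q)$ be the action obtained by reducing modulo $q$ and acting naturally on $P_q$. Then there exists a constant $C>0$ such that for every $\epsilon>0$ there is a constant $A_\epsilon$ such that for every prime $q$ and every $T\le Cq^2$, \[ \left|\left\{(\gamma,x)\in\mathrm{SL}_3(\mathbb{Z})\times P^2(\mathbb{F}_q):\|\gamma\|_\infty\|\gamma^{ -1}\|_\infty\le T,\ \Phi_q(\gamma)(x)=x\right\}\right|\le A_\epsilon\, q^{2+\epsilon}T. \]
   Context: $\|\gamma\|_\infty$ denotes the maximum absolute value of the entries of the matrix $\gamma$. $P^2(\mathbb{F}_q)$ is the set of nonzero vectors of $\mathbb{F}_q^3$ modulo scalars in $\mathbb{F}_q^\times$. -}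

module Defs where

open import Data.Nat as ℕ using (ℕ; zero; suc; _⊔_; _≤ᵇ_; _∸_)
open import Data.Nat.Divisibility using (_∣?_)
open import Data.Integer as ℤ using (ℤ; +_; -_; ∣_∣; _≟_)
open import Data.Fin using (Fin; zero; suc)
open import Data.List using (List; []; _∷_; map; concatMap; filter; length; upTo; _++_)
open import Data.Nat.ListAction using (sum)
open import Data.Bool.ListAction using (any)
open import Data.Bool using (Bool; true; false; if_then_else_; _∧_)
open import Relation.Nullary.Decidable using (⌊_⌋)

Mat3 : Set
Mat3 = Fin 3 → Fin 3 → ℤ

Vec3 : Set → Set
Vec3 A = Fin 3 → A

i0 i1 i2 : Fin 3
i0 = zero
i1 = suc zero
i2 = suc (suc zero)

det : Mat3 → ℤ
det g = g i0 i0 ℤ.* (g i1 i1 ℤ.* g i2 i2 ℤ.- g i1 i2 ℤ.* g i2 i1)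
      ℤ.- g i0 i1 ℤ.* (g i1 i0 ℤ.* g i2 i2 ℤ.- g i1 i2 ℤ.* g i2 i0)
      ℤ.+ g i0 i2 ℤ.* (g i1 i0 ℤ.* g i2 i1 ℤ.- g i1 i1 ℤ.* g i2 i0)

nx ny : Fin 3 → Fin 3
nx zero = i1
nx (suc zero) = i2
nx (suc (suc zero)) = i0
ny zero = i2
ny (suc zero) = i0
ny (suc (suc zero)) = i1

cof : Mat3 → Fin 3 → Fin 3 → ℤ
cof g i j = g (nx i) (nx j) ℤ.* g (ny i) (ny j) ℤ.- g (nx i) (ny j) ℤ.* g (ny i) (nx j)

-- adjugate; for det g = 1 this is the inverse matrix g⁻¹
inv : Mat3 → Mat3
inv g i j = cof g j i

normInf : Mat3 → ℕ
normInf g = (∣ g i0 i0 ∣ ⊔ ∣ g i0 i1 ∣ ⊔ ∣ g i0 i2 ∣)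
          ⊔ (∣ g i1 i0 ∣ ⊔ ∣ g i1 i1 ∣ ⊔ ∣ g i1 i2 ∣)
          ⊔ (∣ g i2 i0 ∣ ⊔ ∣ g i2 i1 ∣ ⊔ ∣ g i2 i2 ∣)

cube : {A : Set} → List A → List (Vec3 A)
cube L = concatMap (λ a → concatMap (λ b → map (λ c → mk a b c) L) L) L
  where
  mk : {A : Set} → A → A → A → Vec3 A
  mk a b c zero = a
  mk a b c (suc zero) = b
  mk a b c (suc (suc zero)) = c

range : ℕ → List ℤ
range T = map (λ n → + n) (upTo (suc T)) ++ map (λ n → - (+ suc n)) (upTo T)

box : ℕ → List Mat3
box T = cube (cube (range T))

-- P²(F_q): canonical representatives (first nonzero coordinate = 1)
P2 : ℕ → List (Vec3 ℕ)
P2 q = concatMap (λ a → map (λ b → v3 1 a b) (upTo q)) (upTo q)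
    ++ map (λ b → v3 0 1 b) (upTo q)
    ++ (v3 0 0 1 ∷ [])
  where
  v3 : ℕ → ℕ → ℕ → Vec3 ℕ
  v3 a b c zero = a
  v3 a b c (suc zero) = b
  v3 a b c (suc (suc zero)) = c

congB : ℕ → ℤ → ℤ → Bool
congB q x y = ⌊ q ∣? ∣ x ℤ.- y ∣ ⌋

act : Mat3 → Vec3 ℕ → Vec3 ℤ
act g v i = g i i0 ℤ.* + v i0 ℤ.+ g i i1 ℤ.* + v i1 ℤ.+ g i i2 ℤ.* + v i2

-- Φ_q(γ)(x) = x in P²(F_q):  γ v ≡ λ v (mod q) for some λ ∈ F_q^×
fixedB : ℕ → Mat3 → Vec3 ℕ → Bool
fixedB q g v = any (λ l → congB q (act g v i0) (+ (l ℕ.* v i0))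
                        ∧ congB q (act g v i1) (+ (l ℕ.* v i1))
                        ∧ congB q (act g v i2) (+ (l ℕ.* v i2)))
                   (map suc (upTo (q ∸ 1)))

goodB : ℕ → Mat3 → Bool
goodB T g = ⌊ det g ≟ + 1 ⌋ ∧ (normInf g ℕ.* normInf (inv g) ≤ᵇ T)

count : ℕ → ℕ → ℕ
count q T = sum (map (λ g → if goodB T g
                             then length (filter (λ v → fixedB q g v Data.Bool.≟ true) (P2 q))
                             else 0)
                     (box T))

-- Since γ and γ⁻¹ fix the same points, assume ‖γ‖ ≤ ‖γ⁻¹‖, and split dyadically: ‖γ‖ ≤ S, ‖γ⁻¹‖ ≤ R with S R = O(T)
-- and S smaller than q/4. A fixed point of γ is an eigenvector for one of at most three eigenvalues l mod q, so γ fixes O(1)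
-- points if every γ - l has rank at least 2, O(q) if some γ - l has rank 1, and O(q²) if γ is scalar mod q.
--   * There are O(S² R²) = O(q² S R) matrices in all. Pick two rows u, v whose cross product is the largest column of γ⁻¹: if s is the
--     largest entry of u, the bound on u × v puts v in a tube of about S (R/s)² integer points, and the third row has O(1) choices.
--   * There are O(q^{1+ε} S R) matrices for which γ - l has rank 1. Then l³ - γᵢᵢ l² - (γ⁻¹)ᵢᵢ l + 1 ≡ 0 for each i, so γ₁₁ and (γ⁻¹)₁₁
--     determine l up to three choices, and l, γ₂₂ determine (γ⁻¹)₂₂ mod q and γ₃₃. Now γ₂₃ γ₃₂ = γ₂₂ γ₃₃ - (γ⁻¹)₁₁ and the similar
--     product γ₁₃ γ₃₁ are known, the divisor bound counts the factorisations, and the rank condition gives γ₁₂ and γ₂₁.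
--     If one of these products vanishes, γ has a row or column ± that of the identity, and O(S³) matrices remain.
--   * Only O(1) matrices are scalar mod q, as S is smaller than q/4.
module Submission where

open import Defs
open import Data.Bool as Bool using (Bool; true; false; if_then_else_; _∧_; T)
open import Data.Bool.Properties using (T-∧)
open import Data.Empty using (⊥; ⊥-elim)
open import Data.Fin using (Fin; zero; suc)
import Data.Fin.Properties as Finₚ
open import Data.Integer as ℤ using (ℤ; +_; -[1+_]; ∣_∣; 0ℤ; 1ℤ) renaming (_+_ to _⊕_; _-_ to _⊖_; _*_ to _·_; -_ to ⊝_)
open import Data.Integer.DivMod using (_%ℕ_; _/ℕ_; n%ℕd<d; a≡a%ℕn+[a/ℕn]*n)
open import Data.Integer.Divisibility.Signed as ℤ∣ using (∣ᵤ⇒∣; ∣⇒∣ᵤ) renaming (_∣_ to _∣ᶻ_)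
import Data.Integer.Properties as ℤₚ
open import Data.Integer.Tactic.RingSolver using () renaming (solve-∀ to solveℤ)
open import Data.List using (List; []; _∷_; map; concatMap; filter; length; upTo)
open import Data.List.Membership.Propositional using (_∈_; find)
import Data.List.Membership.Propositional.Properties as ∈ₚ
import Data.List.Properties as Listₚ
open import Data.List.Relation.Binary.Sublist.Propositional using (_⊆_; []; _∷_; _∷ʳ_)
open import Data.List.Relation.Binary.Sublist.Propositional.Properties using (All-resp-⊆)
open import Data.List.Relation.Unary.All as All using (All; []; _∷_)
import Data.List.Relation.Unary.All.Properties as Allₚ
open import Data.List.Relation.Unary.AllPairs as AllPairs using (AllPairs; []; _∷_)
import Data.List.Relation.Unary.AllPairs.Properties as AllPairsₚ
open import Data.List.Relation.Unary.Any using (here; there)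
import Data.List.Relation.Unary.Any.Properties as Anyₚ
open import Data.List.Relation.Unary.Unique.Propositional using (Unique)
import Data.List.Relation.Unary.Unique.Propositional.Properties as Uniqueₚ
open import Data.Nat as ℕ using (ℕ; zero; suc; _+_; _*_; _^_; _∸_; _⊔_; _≤_; _<_; z≤n; s≤s; NonZero; _/_; _%_)
open import Data.Nat.Coprimality using (Coprime; coprime-divisor)
open import Data.Nat.DivMod using (m%n<n; m≡m%n+[m/n]*n; m/n*n≤m; m*n/n≡m; /-mono-≤)
open import Data.Nat.Divisibility as ℕ∣ using (divides) renaming (_∣_ to _∣ⁿ_)
open import Data.Nat.ListAction using (sum; product)
open import Data.Nat.Primality using (Prime; prime?; euclidsLemma; prime⇒nonZero; prime⇒nonTrivial; prime⇒irreducible)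
open import Data.Nat.Primality.Factorisation using (factorise)
import Data.Nat.Properties as ℕₚ
open import Data.Nat.Tactic.RingSolver using () renaming (solve-∀ to solveℕ)
open import Data.Product using (Σ; ∃; ∃₂; _×_; _,_; proj₁; proj₂)
open import Data.Product.Properties using (≡-dec)
open import Data.Sum using (_⊎_; inj₁; inj₂; [_,_]′)
open import Data.Unit using (⊤; tt)
open import Function using (_∘_; id; case_of_)
open import Function.Bundles using (Equivalence)
open import Relation.Binary.Definitions using (DecidableEquality)
open import Relation.Binary.PropositionalEquality
open import Relation.Nullary using (¬_; Dec; yes; no; contradiction)
open import Relation.Nullary.Decidable using (toWitness; ⌊_⌋)

-- When `γ - l` has rank one the fixed points fill a line, so the bound for all matrices would lose
-- a factor q: these matrices must be shown to be rarer by about q. The rank condition gives only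
-- congruences modulo q. They determine entries of γ, which are below q/4, but not entries of γ⁻¹,
-- which may exceed q. So (γ⁻¹)₁₁ is left free in a range of size R, (γ⁻¹)₂₂ costs 1 + R/q for its
-- residue class, and the two products are then known as exact integers, to which the divisor bound
-- applies. The cost is S² R (1 + R/q), which is O(q S R) because S ≤ q and S R ≤ q². The exponent ε
-- is a rational a/b and inequalities are raised to the power b. The only loss beyond constants is
-- (L + 1) E², where L + 1 counts dyadic scales and E bounds the number of divisors of every n ≤ q².

module Counting where

  -- Bound P n: the set { x ∣ P x } has at most n elements, with no decidability required of P.
  Bound : {X : Set} → (X → Set) → ℕ → Set
  Bound P n = ∀ xs → Unique xs → All P xs → length xs ≤ n

  private variable
    X Y : Set
    P Q : X → Set
    m n : ℕ

  bound-⊆ : (∀ {x} → P x → Q x) → Bound Q n → Bound P n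
  bound-⊆ P⊆Q bQ xs xs! Pxs = bQ xs xs! (All.map P⊆Q Pxs)

  bound-≤ : m ≤ n → Bound P m → Bound P n
  bound-≤ m≤n bP xs xs! Pxs = ℕₚ.≤-trans (bP xs xs! Pxs) m≤n

  -- A bound is trivial for the empty list, so a proof may fix one member of the set: as a base
  -- point from which differences are counted, or as a source of side conditions common to all
  -- members.
  bound-inhabited : (∀ x → P x → Bound P n) → Bound P n
  bound-inhabited bP []       _   _          = z≤n
  bound-inhabited bP (x ∷ xs) xs! (px ∷ pxs) = bP x px (x ∷ xs) xs! (px ∷ pxs)

  bound-empty : (∀ x → ¬ P x) → Bound P n
  bound-empty ¬P = bound-inhabited λ x px → contradiction px (¬P x)

  bound-subsingleton : (∀ {x y} → P x → P y → x ≡ y) → Bound P 1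
  bound-subsingleton P! []          _                  _             = z≤n
  bound-subsingleton P! (_ ∷ [])    _                  _             = s≤s z≤n
  bound-subsingleton P! (_ ∷ _ ∷ _) ((x≢y ∷ _) ∷ _) (px ∷ py ∷ _) = contradiction (P! px py) x≢y

  private
    unique-⊆ : {xs ys : List X} → ys ⊆ xs → Unique xs → Unique ys
    unique-⊆ []          []           = []
    unique-⊆ (_ ∷ʳ s)    (_ ∷ xs!)    = unique-⊆ s xs!
    unique-⊆ (refl ∷ s)  (x∉ ∷ xs!)   = All-resp-⊆ s x∉ ∷ unique-⊆ s xs!

    split : ∀ xs → All (λ x → P x ⊎ Q x) xs →
            ∃₂ λ ys zs → ys ⊆ xs × zs ⊆ xs × All P ys × All Q zs × length xs ≡ length ys + length zs
    split []       []       = [] , [] , [] , [] , [] , [] , refl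
    split (x ∷ xs) (px ∷ pxs) with split xs pxs | px
    ... | ys , zs , s , t , p , q , e | inj₁ p′ =
      x ∷ ys , zs , refl ∷ s , x ∷ʳ t , p′ ∷ p , q , cong suc e
    ... | ys , zs , s , t , p , q , e | inj₂ q′ =
      ys , x ∷ zs , x ∷ʳ s , refl ∷ t , p , q′ ∷ q , trans (cong suc e) (sym (ℕₚ.+-suc _ _))

  bound-⊎ : Bound P m → Bound Q n → Bound (λ x → P x ⊎ Q x) (m + n)
  bound-⊎ bP bQ xs xs! pq with split xs pq
  ... | ys , zs , s , t , p , q , e = subst (_≤ _) (sym e)
    (ℕₚ.+-mono-≤ (bP ys (unique-⊆ s xs!) p) (bQ zs (unique-⊆ t xs!) q))

  -- Induction on the size of the index set: an index y₀ is split off, its fibre costs n, and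
  -- prepending y₀ to a list of other indices shows that at most m of them remain. Fibres may
  -- overlap, and only equality of indices is decided.
  bound-∃ : DecidableEquality Y → {Q : Y → Set} {R : Y → X → Set} →
            Bound Q m → (∀ y → Q y → Bound (R y) n) → Bound (λ x → ∃ λ y → Q y × R y x) (m * n)
  bound-∃ {m = zero}  _≟_ bQ bR = bound-empty λ _ (y , qy , _) → ℕₚ.1+n≰n (bQ (y ∷ []) ([] ∷ []) (qy ∷ []))
  bound-∃ {Y = Y} {m = suc m} _≟_ {Q} {R} bQ bR = bound-inhabited λ _ (y₀ , qy₀ , _) →
    bound-⊆ (pick y₀) (bound-⊎ (bR y₀ qy₀) (bound-∃ _≟_ (rest y₀ qy₀) λ y (qy , _) → bR y qy))
    where
    pick : ∀ y₀ {x} → (∃ λ y → Q y × R y x) → R y₀ x ⊎ (∃ λ y → (Q y × y₀ ≢ y) × R y x)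
    pick y₀ (y , qy , r) with y₀ ≟ y
    ... | yes refl = inj₁ r
    ... | no y₀≢y  = inj₂ (y , (qy , y₀≢y) , r)
    rest : ∀ y₀ → Q y₀ → Bound (λ y → Q y × y₀ ≢ y) m
    rest y₀ qy₀ ys ys! q = ℕ.s≤s⁻¹ (bQ (y₀ ∷ ys) (All.map proj₂ q ∷ ys!) (qy₀ ∷ All.map proj₁ q))

  bound-fibres : DecidableEquality Y → (f : X → Y) {Q : Y → Set} → (∀ {x} → P x → Q (f x)) →
                 Bound Q m → (∀ y → Q y → Bound (λ x → P x × f x ≡ y) n) → Bound P (m * n)
  bound-fibres _≟_ f P⇒Q bQ bR = bound-⊆ (λ px → f _ , P⇒Q px , px , refl) (bound-∃ _≟_ bQ bR)

  bound-injective : (f : X → Y) {Q : Y → Set} → (∀ {x} → P x → Q (f x)) →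
                    (∀ {x y} → P x → P y → f x ≡ f y → x ≡ y) → Bound Q n → Bound P n
  bound-injective {P = P} f P⇒Q inj bQ xs xs! pxs =
    subst (_≤ _) (Listₚ.length-map f xs) (bQ (map f xs) (image! xs! pxs) (Allₚ.map⁺ (All.map P⇒Q pxs)))
    where
    image! : ∀ {xs} → Unique xs → All P xs → Unique (map f xs)
    image! []           []         = []
    image! (x∉ ∷ xs!) (px ∷ pxs) =
      Allₚ.map⁺ (All.zipWith (λ (x≢y , py) fx≡fy → x≢y (inj px py fx≡fy)) (x∉ , pxs)) ∷ image! xs! pxs

  bound-Σ : DecidableEquality X → {P : X → Set} {Q : X → Y → Set} →
            Bound P m → (∀ x → P x → Bound (Q x) n) → Bound {X × Y} (λ (x , y) → P x × Q x y) (m * n)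
  bound-Σ _≟_ bP bQ = bound-fibres _≟_ proj₁ proj₁ bP λ x px →
    bound-injective proj₂ (λ { ((_ , q) , refl) → q })
      (λ { {_ , _} {_ , _} (_ , refl) (_ , refl) refl → refl }) (bQ x px)

  bound-∈ : (xs : List X) → Bound (_∈ xs) (length xs)
  bound-∈ []       = bound-empty λ _ ()
  bound-∈ (y ∷ xs) = bound-⊆ (λ { (here e) → inj₁ e ; (there i) → inj₂ i })
    (bound-⊎ (bound-subsingleton (λ e e′ → trans e (sym e′))) (bound-∈ xs))

  bound-< : ∀ k → Bound (_< k) k
  bound-< k = subst (Bound _) (Listₚ.length-upTo k) (bound-⊆ ∈ₚ.∈-upTo⁺ (bound-∈ (upTo k)))

  bound-∣∣≤ : ∀ k → Bound (λ z → ∣ z ∣ ≤ k) (suc k + k)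
  bound-∣∣≤ k = bound-⊆ (λ {z} → sign z)
    (bound-⊎ (bound-injective ∣_∣ {_< suc k} (λ { (_ , s≤s h , refl) → s≤s h }) (λ { (_ , _ , refl) (_ , _ , refl) refl → refl }) (bound-< _))
             (bound-injective ∣_∣ {λ a → ∃ λ b → b < k × a ≡ suc b} (λ { (b , h , refl) → b , h , refl })
               (λ { (_ , _ , refl) (_ , _ , refl) refl → refl })
               (bound-injective ℕ.pred (λ { (_ , h , refl) → h }) (λ { (_ , _ , refl) (_ , _ , refl) refl → refl }) (bound-< k))))
    where
    sign : ∀ z → ∣ z ∣ ≤ k → (∃ λ a → a < suc k × z ≡ + a) ⊎ (∃ λ a → a < k × z ≡ -[1+ a ])
    sign (+ a)    h = inj₁ (a , s≤s h , refl)
    sign -[1+ a ] h = inj₂ (a , h , refl)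

open Counting

-- The divisor function

suc≤2^ : ∀ e → suc e ≤ 2 ^ e
suc≤2^ zero    = s≤s z≤n
suc≤2^ (suc e) = begin
  2 + e           ≤⟨ s≤s (ℕₚ.m≤n+m (suc e) e) ⟩
  suc e + suc e   ≤⟨ ℕₚ.+-mono-≤ (suc≤2^ e) (suc≤2^ e) ⟩
  2 ^ e + 2 ^ e   ≡⟨ cong (λ z → 2 ^ e + z) (ℕₚ.+-identityʳ (2 ^ e)) ⟨
  2 ^ suc e       ∎
  where open ℕₚ.≤-Reasoning

^-distribʳ-* : ∀ m n b → (m * n) ^ b ≡ m ^ b * n ^ b
^-distribʳ-* m n zero    = refl
^-distribʳ-* m n (suc b) = trans (cong (m * n *_) (^-distribʳ-* m n b)) (interchange m n (m ^ b) (n ^ b))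
  where
  interchange : ∀ m n k l → m * n * (k * l) ≡ m * k * (n * l)
  interchange = solveℕ

-- Writing e = f b + r with r < b gives e + 1 ≤ b (f + 1) ≤ b 2^f, and (2^f)^b ≤ 2^e. This controls
-- the contribution of a small prime power to the divisor function, and later the number of dyadic
-- scales.
suc^≤ : ∀ b .{{_ : NonZero b}} e → suc e ^ b ≤ b ^ b * 2 ^ e
suc^≤ b e = begin
  suc e ^ b             ≤⟨ ℕₚ.^-monoˡ-≤ b suc-e≤ ⟩
  (b * 2 ^ f) ^ b       ≡⟨ ^-distribʳ-* b (2 ^ f) b ⟩
  b ^ b * (2 ^ f) ^ b   ≡⟨ cong (b ^ b *_) (ℕₚ.^-*-assoc 2 f b) ⟩
  b ^ b * 2 ^ (f * b)   ≤⟨ ℕₚ.*-monoʳ-≤ (b ^ b) (ℕₚ.^-monoʳ-≤ 2 (m/n*n≤m e b)) ⟩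
  b ^ b * 2 ^ e         ∎
  where
  open ℕₚ.≤-Reasoning
  f = e / b
  suc-e≤ : suc e ≤ b * 2 ^ f
  suc-e≤ = begin
    suc e                ≡⟨ cong suc (m≡m%n+[m/n]*n e b) ⟩
    suc (e % b) + f * b  ≤⟨ ℕₚ.+-monoˡ-≤ (f * b) (m%n<n e b) ⟩
    suc f * b            ≤⟨ ℕₚ.*-monoˡ-≤ b (suc≤2^ f) ⟩
    2 ^ f * b            ≡⟨ ℕₚ.*-comm (2 ^ f) b ⟩
    b * 2 ^ f            ∎

private
  rotate : ∀ p k m → p * k * m ≡ k * m * p
  rotate = solveℕ

∤⇒coprime : ∀ {p d} → Prime p → ¬ (p ∣ⁿ d) → Coprime d p
∤⇒coprime p! p∤d (c∣d , c∣p) with prime⇒irreducible p! c∣p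
... | inj₁ c≡1  = c≡1
... | inj₂ refl = contradiction c∣d p∤d

divisor-prime-power : ∀ {p} → Prime p → ∀ e {m d} → d ∣ⁿ p ^ e * m →
                      ∃ λ i → i < suc e × ∃ λ d′ → d′ ∣ⁿ m × d ≡ p ^ i * d′
divisor-prime-power     p! zero    {m} {d} d∣ = 0 , s≤s z≤n , d , subst (d ∣ⁿ_) (ℕₚ.*-identityˡ m) d∣ , sym (ℕₚ.*-identityˡ d)
divisor-prime-power {p} p! (suc e) {m} {d} d∣ with p ℕ∣.∣? d
... | yes (divides c refl)
  with i , i<e , d′ , d′∣m , c≡ ← divisor-prime-power p! e {m} {c}
         (ℕ∣.*-cancelʳ-∣ p {{prime⇒nonZero p!}} (subst (c * p ∣ⁿ_) (rotate p (p ^ e) m) d∣))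
  = suc i , s≤s i<e , d′ , d′∣m , trans (cong (_* p) c≡) (sym (rotate p (p ^ i) d′))
... | no p∤d
  with i , i<e , rest ← divisor-prime-power p! e {m} {d}
         (coprime-divisor {d} {p} (∤⇒coprime p! p∤d) (subst (d ∣ⁿ_) (ℕₚ.*-assoc p (p ^ e) m) d∣))
  = i , ℕₚ.m<n⇒m<1+n i<e , rest

bound-divisors-step : ∀ {p} → Prime p → ∀ e {m t} → Bound (_∣ⁿ m) t → Bound (_∣ⁿ p ^ e * m) (suc e * t)
bound-divisors-step {p} p! e {m} {t} bm = bound-⊆ (λ d∣ → divisor-prime-power p! e d∣)
  (bound-∃ ℕₚ._≟_ (bound-< (suc e)) λ i _ → subst (Bound _) (ℕₚ.*-identityʳ t)
    (bound-∃ ℕₚ._≟_ bm λ d′ _ → bound-subsingleton λ e₁ e₂ → trans e₁ (sym e₂)))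

-- The bound τ(n)^b ≤ A n for n = product ps; primes p ≥ 2^b cost nothing, the smaller ones are reinstated one by one, lowering k to 0.
DivisorBound : ℕ → ℕ → Set
DivisorBound b k = Σ ℕ λ A → ∀ ps → All Prime ps → All (k ≤_) ps →
                   Σ ℕ λ t → Bound (_∣ⁿ product ps) t × t ^ b ≤ A * product ps

divisorBound-large : ∀ b → DivisorBound b (2 ^ b)
divisorBound-large b = 1 , go
  where
  open ℕₚ.≤-Reasoning
  go : ∀ ps → All Prime ps → All (2 ^ b ≤_) ps → Σ ℕ λ t → Bound (_∣ⁿ product ps) t × t ^ b ≤ 1 * product ps
  go []       []         []         =
    1 , bound-subsingleton (λ d d′ → trans (ℕ∣.∣1⇒≡1 d) (sym (ℕ∣.∣1⇒≡1 d′))) , ℕₚ.≤-reflexive (ℕₚ.^-zeroˡ b)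
  go (p ∷ ps) (p! ∷ ps!) (p≥ ∷ ps≥) with t , bt , t≤ ← go ps ps! ps≥ =
    -- Each occurrence of p, repeated or not, doubles the bound, and the factor 2^b in the power is
    -- paid for by p ≥ 2^b.
    2 * t , subst (λ z → Bound (_∣ⁿ z * product ps) (2 * t)) (ℕₚ.^-identityʳ p) (bound-divisors-step p! 1 bt) , (begin
      (2 * t) ^ b            ≡⟨ ^-distribʳ-* 2 t b ⟩
      2 ^ b * t ^ b          ≤⟨ ℕₚ.*-mono-≤ p≥ t≤ ⟩
      p * (1 * product ps)   ≡⟨ cong (p *_) (ℕₚ.*-identityˡ (product ps)) ⟩
      p * product ps         ≡⟨ ℕₚ.*-identityˡ _ ⟨
      1 * (p * product ps)   ∎)

extract : ∀ k ps → All Prime ps → All (k ≤_) ps →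
          ∃₂ λ e qs → All Prime qs × All (suc k ≤_) qs × product ps ≡ k ^ e * product qs
extract k []       []         []         = 0 , [] , [] , [] , refl
extract k (p ∷ ps) (p! ∷ ps!) (k≤p ∷ k≤ps) with extract k ps ps! k≤ps | k ℕₚ.≟ p
... | e , qs , qs! , k<qs , eq | yes refl = suc e , qs , qs! , k<qs , trans (cong (k *_) eq) (sym (ℕₚ.*-assoc k _ _))
... | e , qs , qs! , k<qs , eq | no k≢p   =
  e , p ∷ qs , p! ∷ qs! , ℕₚ.≤∧≢⇒< k≤p k≢p ∷ k<qs , trans (cong (p *_) eq) (swap p (k ^ e) (product qs))
  where
  swap : ∀ p k m → p * (k * m) ≡ k * (p * m)
  swap = solveℕ

divisorBound-step : ∀ b .{{_ : NonZero b}} k → DivisorBound b (suc k) → DivisorBound b k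
divisorBound-step b k (A , bound) with prime? k
... | no ¬p  = A , λ ps ps! k≤ps → bound ps ps! (All.zipWith (λ (p! , k≤p) → ℕₚ.≤∧≢⇒< k≤p λ { refl → ¬p p! }) (ps! , k≤ps))
... | yes k! = b ^ b * A , λ ps ps! k≤ps → go ps (extract k ps ps! k≤ps)
  where
  open ℕₚ.≤-Reasoning
  2≤k : 2 ≤ k
  2≤k = ℕ.nonTrivial⇒n>1 k {{prime⇒nonTrivial k!}}
  shuffle : ∀ b u A m → b * u * (A * m) ≡ b * A * (u * m)
  shuffle = solveℕ
  go : ∀ ps → (∃₂ λ e qs → All Prime qs × All (suc k ≤_) qs × product ps ≡ k ^ e * product qs) →
       Σ ℕ λ t → Bound (_∣ⁿ product ps) t × t ^ b ≤ b ^ b * A * product ps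
  go ps (e , qs , qs! , k<qs , eq) with t , bt , t≤ ← bound qs qs! k<qs =
    suc e * t , subst (λ z → Bound (_∣ⁿ z) (suc e * t)) (sym eq) (bound-divisors-step k! e bt) , (begin
      (suc e * t) ^ b                         ≡⟨ ^-distribʳ-* (suc e) t b ⟩
      suc e ^ b * t ^ b                       ≤⟨ ℕₚ.*-mono-≤ (suc^≤ b e) t≤ ⟩
      b ^ b * 2 ^ e * (A * product qs)        ≡⟨ shuffle (b ^ b) (2 ^ e) A (product qs) ⟩
      b ^ b * A * (2 ^ e * product qs)        ≤⟨ ℕₚ.*-monoʳ-≤ (b ^ b * A) (ℕₚ.*-monoˡ-≤ (product qs) (ℕₚ.^-monoˡ-≤ e 2≤k)) ⟩
      b ^ b * A * (k ^ e * product qs)        ≡⟨ cong (b ^ b * A *_) eq ⟨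
      b ^ b * A * product ps                  ∎)

divisorBound-all : ∀ b .{{_ : NonZero b}} → DivisorBound b 0
divisorBound-all b = descend (2 ^ b) (divisorBound-large b)
  where
  descend : ∀ k → DivisorBound b k → DivisorBound b 0
  descend zero    = id
  descend (suc k) = descend k ∘ divisorBound-step b k

-- The integers to be factored vary with the matrix, so one E must serve all n ≤ N. The maximum of
-- the individual bounds does, as its b-th power is one of theirs.
divisor-bound : ∀ b .{{_ : NonZero b}} → Σ ℕ λ A → ∀ N → Σ ℕ λ E →
                (∀ n → 1 ≤ n → n ≤ N → Bound (_∣ⁿ n) E) × E ^ b ≤ A * N
divisor-bound b@(suc _) with A , bound ← divisorBound-all b = A , uniform
  where
  ^-⊔-≤ : ∀ x y z → x ^ b ≤ z → y ^ b ≤ z → (x ⊔ y) ^ b ≤ z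
  ^-⊔-≤ x y z x≤ y≤ with ℕₚ.⊔-sel x y
  ... | inj₁ e = subst (λ w → w ^ b ≤ z) (sym e) x≤
  ... | inj₂ e = subst (λ w → w ^ b ≤ z) (sym e) y≤
  single : ∀ n .{{_ : NonZero n}} → Σ ℕ λ t → Bound (_∣ⁿ n) t × t ^ b ≤ A * n
  single n with record { factors = ps ; isFactorisation = refl ; factorsPrime = ps! } ← factorise n
    = bound ps ps! (All.tabulate (λ _ → z≤n))
  uniform : ∀ N → Σ ℕ λ E → (∀ n → 1 ≤ n → n ≤ N → Bound (_∣ⁿ n) E) × E ^ b ≤ A * N
  uniform zero    = 0 , (λ { (suc _) _ () }) , z≤n
  uniform (suc N) with E , bE , E≤ ← uniform N | t , bt , t≤ ← single (suc N) =
    E ⊔ t , bound′ , ^-⊔-≤ E t _ (ℕₚ.≤-trans E≤ (ℕₚ.*-monoʳ-≤ A (ℕₚ.n≤1+n N))) t≤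
    where
    bound′ : ∀ n → 1 ≤ n → n ≤ suc N → Bound (_∣ⁿ n) (E ⊔ t)
    bound′ n 1≤n n≤ with ℕₚ.m≤n⇒m<n∨m≡n n≤
    ... | inj₁ n<   = bound-≤ (ℕₚ.m≤m⊔n E t) (bE n 1≤n (ℕ.s≤s⁻¹ n<))
    ... | inj₂ refl = bound-≤ (ℕₚ.m≤n⊔m E t) bt

-- Matrices and cofactors

Row : Set
Row = ℤ × ℤ × ℤ

-- Nested tuples have decidable equality, which fibrewise counting needs; `⟦_⟧` leads back to
-- matrices as functions, where the cofactor identities live.
Mat : Set
Mat = Row × Row × Row

at : {A : Set} → A × A × A → Fin 3 → A
at (a , b , c) zero             = a
at (a , b , c) (suc zero)       = b
at (a , b , c) (suc (suc zero)) = c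

at-injective : {A : Set} {r s : A × A × A} → (∀ i → at r i ≡ at s i) → r ≡ s
at-injective e = cong₂ _,_ (e i0) (cong₂ _,_ (e i1) (e i2))

⟦_⟧ : Mat → Mat3
⟦ A ⟧ i = at (at A i)

⟦⟧-injective : ∀ {A B} → (∀ i j → ⟦ A ⟧ i j ≡ ⟦ B ⟧ i j) → A ≡ B
⟦⟧-injective e = at-injective λ i → at-injective (e i)

tuple : {A : Set} → (Fin 3 → A) → A × A × A
tuple f = f i0 , f i1 , f i2

fromMat3 : Mat3 → Mat
fromMat3 g = tuple λ i → tuple (g i)

at-tuple : {A : Set} (f : Fin 3 → A) → ∀ i → at (tuple f) i ≡ f i
at-tuple f zero             = refl
at-tuple f (suc zero)       = refl
at-tuple f (suc (suc zero)) = refl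

⟦⟧-fromMat3 : ∀ g i j → ⟦ fromMat3 g ⟧ i j ≡ g i j
⟦⟧-fromMat3 g i j = trans (cong (λ r → at r j) (at-tuple (λ i → tuple (g i)) i)) (at-tuple (g i) j)

nx-nx : ∀ i → nx (nx i) ≡ ny i
nx-nx zero             = refl
nx-nx (suc zero)       = refl
nx-nx (suc (suc zero)) = refl

nx-ny : ∀ i → nx (ny i) ≡ i
nx-ny zero             = refl
nx-ny (suc zero)       = refl
nx-ny (suc (suc zero)) = refl

ny-nx : ∀ i → ny (nx i) ≡ i
ny-nx zero             = refl
ny-nx (suc zero)       = refl
ny-nx (suc (suc zero)) = refl

ny-ny : ∀ i → ny (ny i) ≡ nx i
ny-ny zero             = refl
ny-ny (suc zero)       = refl
ny-ny (suc (suc zero)) = refl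

-- Lets an arbitrary index i play the part of the first one. Cofactors are written cyclically,
-- without signs, so formulas keep their form.
cyclic-cases : (P : Fin 3 → Set) → ∀ i → P i → P (nx i) → P (ny i) → ∀ j → P j
cyclic-cases P zero             p q r zero             = p
cyclic-cases P zero             p q r (suc zero)       = q
cyclic-cases P zero             p q r (suc (suc zero)) = r
cyclic-cases P (suc zero)       p q r zero             = r
cyclic-cases P (suc zero)       p q r (suc zero)       = p
cyclic-cases P (suc zero)       p q r (suc (suc zero)) = q
cyclic-cases P (suc (suc zero)) p q r zero             = q
cyclic-cases P (suc (suc zero)) p q r (suc zero)       = r
cyclic-cases P (suc (suc zero)) p q r (suc (suc zero)) = p

argmax : (f : Fin 3 → ℕ) → ∃ λ k → ∀ j → f j ≤ f k
argmax f with ℕₚ.≤-total (f i0) (f i1) | ℕₚ.≤-total (f i1) (f i2) | ℕₚ.≤-total (f i0) (f i2)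
... | inj₁ a | inj₁ b | _      = i2 , cyclic-cases _ i0 (ℕₚ.≤-trans a b) b ℕₚ.≤-refl
... | inj₁ a | inj₂ b | _      = i1 , cyclic-cases _ i0 a ℕₚ.≤-refl b
... | inj₂ a | _      | inj₁ c = i2 , cyclic-cases _ i0 c (ℕₚ.≤-trans a c) ℕₚ.≤-refl
... | inj₂ a | _      | inj₂ c = i0 , cyclic-cases _ i0 ℕₚ.≤-refl a c

argmax₂ : (f : Fin 3 → Fin 3 → ℕ) → ∃₂ λ i k → ∀ j l → f j l ≤ f i k
argmax₂ f with i , max ← argmax (λ i → f i (proj₁ (argmax (f i)))) =
  i , proj₁ (argmax (f i)) , λ j l → ℕₚ.≤-trans (proj₂ (argmax (f j)) l) (max j)

dot : Vec3 ℤ → Vec3 ℤ → ℤ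
dot u v = u i0 · v i0 ⊕ u i1 · v i1 ⊕ u i2 · v i2

cross : Vec3 ℤ → Vec3 ℤ → Vec3 ℤ
cross u v j = u (nx j) · v (ny j) ⊖ u (ny j) · v (nx j)

_ᵀ : Mat3 → Mat3
(g ᵀ) i j = g j i

det-expand : ∀ g i → det g ≡ dot (g i) (cof g i)
det-expand g = λ
  { zero             → expand₀ (g i0 i0) (g i0 i1) (g i0 i2) (g i1 i0) (g i1 i1) (g i1 i2) (g i2 i0) (g i2 i1) (g i2 i2)
  ; (suc zero)       → expand₁ (g i0 i0) (g i0 i1) (g i0 i2) (g i1 i0) (g i1 i1) (g i1 i2) (g i2 i0) (g i2 i1) (g i2 i2)
  ; (suc (suc zero)) → expand₂ (g i0 i0) (g i0 i1) (g i0 i2) (g i1 i0) (g i1 i1) (g i1 i2) (g i2 i0) (g i2 i1) (g i2 i2) }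
  where
  expand₀ : ∀ a b c d e f g h i → a · (e · i ⊖ f · h) ⊖ b · (d · i ⊖ f · g) ⊕ c · (d · h ⊖ e · g) ≡
            a · (e · i ⊖ f · h) ⊕ b · (f · g ⊖ d · i) ⊕ c · (d · h ⊖ e · g)
  expand₀ = solveℤ
  expand₁ : ∀ a b c d e f g h i → a · (e · i ⊖ f · h) ⊖ b · (d · i ⊖ f · g) ⊕ c · (d · h ⊖ e · g) ≡
            d · (h · c ⊖ i · b) ⊕ e · (i · a ⊖ g · c) ⊕ f · (g · b ⊖ h · a)
  expand₁ = solveℤ
  expand₂ : ∀ a b c d e f g h i → a · (e · i ⊖ f · h) ⊖ b · (d · i ⊖ f · g) ⊕ c · (d · h ⊖ e · g) ≡
            g · (b · f ⊖ c · e) ⊕ h · (c · d ⊖ a · f) ⊕ i · (a · e ⊖ b · d)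
  expand₂ = solveℤ

cof-ᵀ : ∀ g i j → cof (g ᵀ) i j ≡ cof g j i
cof-ᵀ g i j = cong (g (nx j) (nx i) · g (ny j) (ny i) ⊖_) (ℤₚ.*-comm (g (ny j) (nx i)) (g (nx j) (ny i)))

det-ᵀ : ∀ g → det (g ᵀ) ≡ det g
det-ᵀ g = transpose (g i0 i0) (g i0 i1) (g i0 i2) (g i1 i0) (g i1 i1) (g i1 i2) (g i2 i0) (g i2 i1) (g i2 i2)
  where
  transpose : ∀ a b c d e f g h i → a · (e · i ⊖ h · f) ⊖ d · (b · i ⊖ h · c) ⊕ g · (b · f ⊖ e · c) ≡
              a · (e · i ⊖ f · h) ⊖ b · (d · i ⊖ f · g) ⊕ c · (d · h ⊖ e · g)
  transpose = solveℤ

det-cong : ∀ {g h} → (∀ i j → g i j ≡ h i j) → det g ≡ det h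
det-cong e = cong₂ _⊕_ (cong₂ _⊖_ (cong₂ _·_ (e _ _) (minor i1 i1 i2 i2 i1 i2 i2 i1)) (cong₂ _·_ (e _ _) (minor i1 i0 i2 i2 i1 i2 i2 i0)))
                       (cong₂ _·_ (e _ _) (minor i1 i0 i2 i1 i1 i1 i2 i0))
  where
  minor : ∀ a b c d a′ b′ c′ d′ → _ ≡ _
  minor a b c d a′ b′ c′ d′ = cong₂ _⊖_ (cong₂ _·_ (e a b) (e c d)) (cong₂ _·_ (e a′ b′) (e c′ d′))

cof-cong : ∀ {g h} → (∀ i j → g i j ≡ h i j) → ∀ i j → cof g i j ≡ cof h i j
cof-cong e i j = cong₂ _⊖_ (cong₂ _·_ (e _ _) (e _ _)) (cong₂ _·_ (e _ _) (e _ _))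

-- The case n = 3 of adj(adj g) = det(g)^(n-2) g. For determinant 1 it makes `inv` an involution, so
-- γ and γ⁻¹ can be exchanged.
cof-cof : ∀ g i j → cof (cof g) i j ≡ det g · g i j
cof-cof g i j = trans (lemma (g i j) (g i (nx j)) (g i (ny j)) (g (nx i) j) (g (nx i) (nx j)) (g (nx i) (ny j)) (g (ny i) j) (g (ny i) (nx j)) (g (ny i) (ny j)) _ _ _ _
    (cong₂ _⊖_ (cong₂ _·_ (idx (nx-nx i) (nx-nx j)) (idx (ny-nx i) (ny-nx j))) (cong₂ _·_ (idx (nx-nx i) (ny-nx j)) (idx (ny-nx i) (nx-nx j))))
    (cong₂ _⊖_ (cong₂ _·_ (idx (nx-ny i) (nx-ny j)) (idx (ny-ny i) (ny-ny j))) (cong₂ _·_ (idx (nx-ny i) (ny-ny j)) (idx (ny-ny i) (nx-ny j))))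
    (cong₂ _⊖_ (cong₂ _·_ (idx (nx-nx i) (nx-ny j)) (idx (ny-nx i) (ny-ny j))) (cong₂ _·_ (idx (nx-nx i) (ny-ny j)) (idx (ny-nx i) (nx-ny j))))
    (cong₂ _⊖_ (cong₂ _·_ (idx (nx-ny i) (nx-nx j)) (idx (ny-ny i) (ny-nx j))) (cong₂ _·_ (idx (nx-ny i) (ny-nx j)) (idx (ny-ny i) (nx-nx j)))))
  (cong (_· g i j) (sym (trans (det-expand g i) (dot-cyclic j))))
  where
  idx : ∀ {a a′ b b′} → a ≡ a′ → b ≡ b′ → g a b ≡ g a′ b′
  idx refl refl = refl
  dot-cyclic : ∀ j → dot (g i) (cof g i) ≡ g i j · cof g i j ⊕ g i (nx j) · (g (nx i) (ny j) · g (ny i) j ⊖ g (nx i) j · g (ny i) (ny j)) ⊕ g i (ny j) · (g (nx i) j · g (ny i) (nx j) ⊖ g (nx i) (nx j) · g (ny i) j)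
  dot-cyclic zero             = refl
  dot-cyclic (suc zero)       = rotate₃ (g i i0 · _) _ _
    where
    rotate₃ : ∀ a b c → a ⊕ b ⊕ c ≡ b ⊕ c ⊕ a
    rotate₃ = solveℤ
  dot-cyclic (suc (suc zero)) = rotate₃ (g i i0 · _) _ _
    where
    rotate₃ : ∀ a b c → a ⊕ b ⊕ c ≡ c ⊕ a ⊕ b
    rotate₃ = solveℤ
  identity : ∀ a b c d e f g h i → (i · a ⊖ g · c) · (a · e ⊖ b · d) ⊖ (g · b ⊖ h · a) · (c · d ⊖ a · f) ≡
             (a · (e · i ⊖ f · h) ⊕ b · (f · g ⊖ d · i) ⊕ c · (d · h ⊖ e · g)) · a
  identity = solveℤ
  lemma : ∀ a b c d e f g h i w x y z → w ≡ i · a ⊖ g · c → x ≡ a · e ⊖ b · d → y ≡ g · b ⊖ h · a → z ≡ c · d ⊖ a · f →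
          w · x ⊖ y · z ≡ (a · (e · i ⊖ f · h) ⊕ b · (f · g ⊖ d · i) ⊕ c · (d · h ⊖ e · g)) · a
  lemma a b c d e f g h i _ _ _ _ refl refl refl refl = identity a b c d e f g h i

det-cof : ∀ g → det g ≡ 1ℤ → det (cof g) ≡ 1ℤ
det-cof g d≡1 = trans (det-expand (cof g) i0) (trans (cong₂ _⊕_ (cong₂ _⊕_ (term i0) (term i1)) (term i2)) (trans (sym (det-expand g i0)) d≡1))
  where
  term : ∀ j → cof g i0 j · cof (cof g) i0 j ≡ g i0 j · cof g i0 j
  term j = trans (cong (cof g i0 j ·_) (trans (cof-cof g i0 j) (trans (cong (_· g i0 j) d≡1) (ℤₚ.*-identityˡ (g i0 j))))) (ℤₚ.*-comm (cof g i0 j) (g i0 j))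

-- Counting matrices of bounded size

∣⊖∣-rearrange : ∀ a x y c → ∣ a · (x ⊖ y) ∣ ≤ ∣ a · x ⊖ c ∣ + ∣ a · y ⊖ c ∣
∣⊖∣-rearrange a x y c = subst (λ z → ∣ z ∣ ≤ ∣ a · x ⊖ c ∣ + ∣ a · y ⊖ c ∣) (identity a x y c) (ℤₚ.∣i-j∣≤∣i∣+∣j∣ (a · x ⊖ c) (a · y ⊖ c))
  where
  identity : ∀ a x y c → (a · x ⊖ c) ⊖ (a · y ⊖ c) ≡ a · (x ⊖ y)
  identity = solveℤ

*≤⇒≤/ : ∀ s .{{_ : NonZero s}} {m n} → s * m ≤ n → m ≤ n / s
*≤⇒≤/ s {m} {n} sm≤n = subst (_≤ n / s) (m*n/n≡m m s) (/-mono-≤ (subst (_≤ n) (ℕₚ.*-comm s m) sm≤n) ℕₚ.≤-refl)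

m≤n⇒m+m≤2*n : ∀ {m n R} → m ≤ R → n ≤ R → m + n ≤ 2 * R
m≤n⇒m+m≤2*n {R = R} m≤ n≤ = ℕₚ.≤-trans (ℕₚ.+-mono-≤ m≤ n≤) (ℕₚ.≤-reflexive (cong (λ z → R + z) (sym (ℕₚ.+-identityʳ R))))

⊖-cancelʳ : ∀ {x y} z → x ⊖ z ≡ y ⊖ z → x ≡ y
⊖-cancelʳ {x} {y} z e = trans (restore x z) (trans (cong (_⊕ z) e) (sym (restore y z)))
  where
  restore : ∀ x z → x ≡ x ⊖ z ⊕ z
  restore = solveℤ

-- Differences from one fixed solution y satisfy s |x - y| ≤ 2R, whatever the centre c is.
bound-interval : ∀ s .{{_ : NonZero s}} a c R → ∣ a ∣ ≡ s → Bound (λ x → ∣ a · x ⊖ c ∣ ≤ R) (suc (2 * R / s) + 2 * R / s)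
bound-interval s a c R refl = bound-inhabited λ y ay≤ →
  bound-injective (_⊖ y) (λ {x} ax≤ → *≤⇒≤/ s (ℕₚ.≤-trans (ℕₚ.≤-reflexive (sym (ℤₚ.abs-* a (x ⊖ y))))
                                    (ℕₚ.≤-trans (∣⊖∣-rearrange a x y c) (m≤n⇒m+m≤2*n ax≤ ay≤))))
    (λ _ _ → ⊖-cancelʳ y) (bound-∣∣≤ (2 * R / s))

∣∣≡⇒± : ∀ {x : ℤ} {s} → ∣ x ∣ ≡ s → x ≡ + s ⊎ x ≡ ⊝ (+ s)
∣∣≡⇒± {+ n}      refl = inj₁ refl
∣∣≡⇒± { -[1+ n ]} refl = inj₂ refl

bound-∣∣≡ : ∀ s → Bound (λ x → ∣ x ∣ ≡ s) 2
bound-∣∣≡ s = bound-⊆ ∣∣≡⇒± (bound-⊎ (bound-subsingleton λ p q → trans p (sym q)) (bound-subsingleton λ p q → trans p (sym q)))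

bound-Fin3 : Bound {Fin 3} (λ _ → ⊤) 3
bound-Fin3 = bound-⊆ (λ {i} _ → listed i) (bound-∈ (i0 ∷ i1 ∷ i2 ∷ []))
  where
  listed : ∀ i → i ∈ i0 ∷ i1 ∷ i2 ∷ []
  listed zero             = here refl
  listed (suc zero)       = there (here refl)
  listed (suc (suc zero)) = there (there (here refl))

module RowPairs (S R : ℕ) (S≤2R : S ≤ 2 * R) where

  Pair : Row × Row → Set
  Pair (u , v) = (∀ j → ∣ at u j ∣ ≤ S) × (∀ j → ∣ at v j ∣ ≤ S) × (∀ j → ∣ cross (at u) (at v) j ∣ ≤ R) ×
                 (∃ λ k → at u k ≢ 0ℤ)

  private
    Dominated : Fin 3 → ℕ → Row × Row → Set
    Dominated k s (u , v) = Pair (u , v) × ∣ at u k ∣ ≡ suc s × (∀ j → ∣ at u j ∣ ≤ suc s)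

    -- `uₖ` is a largest entry of u, of absolute value s + 1. Given u and `vₖ`, the two entries of u
    -- × v that involve `uₖ` confine v′ and v″ to intervals of length about R / (s + 1).
    Code : ℕ → ℤ × ℤ × ℤ × ℤ × ℤ × ℤ → Set
    Code s (uₖ , vₖ , u′ , v′ , u″ , v″) =
      ∣ uₖ ∣ ≡ suc s × ∣ vₖ ∣ ≤ S × ∣ u′ ∣ ≤ suc s × ∣ uₖ · v′ ⊖ u′ · vₖ ∣ ≤ R × ∣ u″ ∣ ≤ suc s × ∣ uₖ · v″ ⊖ u″ · vₖ ∣ ≤ R

    codeBound : ℕ → ℕ
    codeBound s = 2 * ((suc S + S) * ((suc (suc s) + suc s) * ((suc (2 * R / suc s) + 2 * R / suc s) *
                  ((suc (suc s) + suc s) * (suc (2 * R / suc s) + 2 * R / suc s)))))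

    bound-Code : ∀ s → Bound (Code s) (codeBound s)
    bound-Code s =
      bound-Σ ℤ._≟_ (bound-∣∣≡ (suc s)) λ uₖ ∣uₖ∣ →
      bound-Σ ℤ._≟_ (bound-∣∣≤ S) λ vₖ _ →
      bound-Σ ℤ._≟_ (bound-∣∣≤ (suc s)) λ u′ _ →
      bound-Σ ℤ._≟_ (bound-interval (suc s) uₖ (u′ · vₖ) R ∣uₖ∣) λ v′ _ →
      bound-Σ ℤ._≟_ (bound-∣∣≤ (suc s)) λ u″ _ →
      bound-interval (suc s) uₖ (u″ · vₖ) R ∣uₖ∣

    code : Fin 3 → Row × Row → ℤ × ℤ × ℤ × ℤ × ℤ × ℤ
    code k (u , v) = at u k , at v k , at u (nx k) , at v (nx k) , at u (ny k) , at v (ny k)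

    cross-nx : ∀ u v k → cross u v (nx k) ≡ u (ny k) · v k ⊖ u k · v (ny k)
    cross-nx u v k = cong₂ (λ a b → u a · v b ⊖ u b · v a) (nx-nx k) (ny-nx k)

    cross-ny : ∀ u v k → cross u v (ny k) ≡ u k · v (nx k) ⊖ u (nx k) · v k
    cross-ny u v k = cong₂ (λ a b → u a · v b ⊖ u b · v a) (nx-ny k) (ny-ny k)

    code-valid : ∀ {k s p} → Dominated k s p → Code s (code k p)
    code-valid {k} {s} {u , v} ((_ , v≤S , uv≤R , _) , uₖ≡s , u≤s) =
      uₖ≡s , v≤S k , u≤s (nx k) , subst (λ z → ∣ z ∣ ≤ R) (cross-ny (at u) (at v) k) (uv≤R (ny k)) , u≤s (ny k) ,
      subst (_≤ R) (trans (cong ∣_∣ (cross-nx (at u) (at v) k)) (ℤₚ.∣i-j∣≡∣j-i∣ (at u (ny k) · at v k) (at u k · at v (ny k)))) (uv≤R (nx k))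

    code-injective : ∀ k {p q} → code k p ≡ code k q → p ≡ q
    code-injective k {u , v} {u′ , v′} e = cong₂ _,_
      (at-injective (cyclic-cases (λ j → at u j ≡ at u′ j) k (cong proj₁ e) (cong (proj₁ ∘ proj₂ ∘ proj₂) e) (cong (proj₁ ∘ proj₂ ∘ proj₂ ∘ proj₂ ∘ proj₂) e)))
      (at-injective (cyclic-cases (λ j → at v j ≡ at v′ j) k (cong (proj₁ ∘ proj₂) e) (cong (proj₁ ∘ proj₂ ∘ proj₂ ∘ proj₂) e) (cong (proj₂ ∘ proj₂ ∘ proj₂ ∘ proj₂ ∘ proj₂) e)))

    -- About s choices for an entry of u times about R / s for the matching entry of v make O(R),
    -- whatever s is. The additive 1 in the interval count costs a further s ≤ S ≤ 2R.
    radius≤ : ∀ s → suc s ≤ S → (suc (suc s) + suc s) * (suc (2 * R / suc s) + 2 * R / suc s) ≤ 18 * R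
    radius≤ s s<S = begin
      (suc (suc s) + suc s) * (suc D + D)              ≤⟨ ℕₚ.*-monoˡ-≤ (suc D + D) (ℕₚ.+-monoˡ-≤ (suc s) (s≤s (ℕₚ.m≤n+m (suc s) s))) ⟩
      (suc s + suc s + suc s) * (suc D + D)            ≡⟨ expand (suc s) D ⟩
      3 * (suc s + 2 * (D * suc s))                    ≤⟨ ℕₚ.*-monoʳ-≤ 3 (ℕₚ.+-mono-≤ (ℕₚ.≤-trans s<S S≤2R) (ℕₚ.*-monoʳ-≤ 2 (m/n*n≤m (2 * R) (suc s)))) ⟩
      3 * (2 * R + 2 * (2 * R))                        ≡⟨ collect R ⟩
      18 * R                                           ∎
      where
      open ℕₚ.≤-Reasoning
      D = 2 * R / suc s
      expand : ∀ s D → (s + s + s) * (suc D + D) ≡ 3 * (s + 2 * (D * s))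
      expand = solveℕ
      collect : ∀ R → 3 * (2 * R + 2 * (2 * R)) ≡ 18 * R
      collect = solveℕ

    codeBound≤ : ∀ s → suc s ≤ S → codeBound s ≤ 6 * S * (18 * R * (18 * R))
    codeBound≤ s s<S = begin
      codeBound s                                                     ≡⟨ regroup (suc S + S) (suc (suc s) + suc s) (suc D + D) ⟩
      2 * (suc S + S) * (radius * radius)                             ≤⟨ ℕₚ.*-mono-≤ (ℕₚ.*-monoʳ-≤ 2 (ℕₚ.+-monoˡ-≤ S (s≤s (ℕₚ.m≤n+m S S′)))) (ℕₚ.*-mono-≤ (radius≤ s s<S) (radius≤ s s<S)) ⟩
      2 * (suc S′ + S + S) * (18 * R * (18 * R))                      ≡⟨ cong (λ z → 2 * (z + S + S) * (18 * R * (18 * R))) suc-S′ ⟩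
      2 * (S + S + S) * (18 * R * (18 * R))                           ≡⟨ cong (_* (18 * R * (18 * R))) (triple S) ⟩
      6 * S * (18 * R * (18 * R))                                     ∎
      where
      open ℕₚ.≤-Reasoning
      D = 2 * R / suc s
      S′ = ℕ.pred S
      suc-S′ : suc S′ ≡ S
      suc-S′ = ℕₚ.suc-pred S {{ℕ.>-nonZero (ℕₚ.≤-trans (s≤s z≤n) s<S)}}
      radius = (suc (suc s) + suc s) * (suc D + D)
      regroup : ∀ a b c → 2 * (a * (b * (c * (b * c)))) ≡ 2 * a * (b * c * (b * c))
      regroup = solveℕ
      triple : ∀ S → 2 * (S + S + S) ≡ 6 * S
      triple = solveℕ

    dominated : ∀ {p} → Pair p → ∃ λ k → ⊤ × (∃ λ s → s < S × Dominated k s p)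
    dominated {u , v} pair@(u≤S , _ , _ , j , uⱼ≢0) with k , max ← argmax (λ j → ∣ at u j ∣) = k , tt , go ∣ at u k ∣ refl
      where
      go : ∀ n → ∣ at u k ∣ ≡ n → ∃ λ s → s < S × Dominated k s (u , v)
      go zero    eq = contradiction (ℤₚ.∣i∣≡0⇒i≡0 (ℕₚ.n≤0⇒n≡0 (subst (∣ at u j ∣ ≤_) eq (max j)))) uⱼ≢0
      go (suc s) eq = s , subst (_≤ S) eq (u≤S k) , pair , eq , λ j → subst (∣ at u j ∣ ≤_) eq (max j)

  bound-Pair : Bound Pair (3 * (S * (6 * S * (18 * R * (18 * R)))))
  bound-Pair = bound-⊆ dominated (bound-∃ Finₚ._≟_ bound-Fin3 λ k _ → bound-∃ ℕₚ._≟_ (bound-< S) λ s s<S →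
    bound-≤ (codeBound≤ s s<S) (bound-injective (code k) (code-valid {k}) (λ _ _ → code-injective k) (bound-Code s)))

-- A row z with z · (u × v) = 1 is unique up to adding m u + n v; the bounds on z × u and v × z keep m and n in [-2, 2].
module ThirdRow (u v : Row) where

  private
    w : Vec3 ℤ
    w = cross (at u) (at v)

    mᵤ mᵥ : Vec3 ℤ → Vec3 ℤ → ℤ
    mᵤ z z₀ = dot (λ j → z j ⊖ z₀ j) (cross (at v) z₀)
    mᵥ z z₀ = dot (λ j → z j ⊖ z₀ j) (cross z₀ (at u))

    cramer₀ : ∀ u0 u1 u2 v0 v1 v2 z0 z1 z2 d0 d1 d2 →
      (z0 · (u1 · v2 ⊖ u2 · v1) ⊕ z1 · (u2 · v0 ⊖ u0 · v2) ⊕ z2 · (u0 · v1 ⊖ u1 · v0)) · d0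
      ≡ (d0 · (v1 · z2 ⊖ v2 · z1) ⊕ d1 · (v2 · z0 ⊖ v0 · z2) ⊕ d2 · (v0 · z1 ⊖ v1 · z0)) · u0
      ⊕ (d0 · (z1 · u2 ⊖ z2 · u1) ⊕ d1 · (z2 · u0 ⊖ z0 · u2) ⊕ d2 · (z0 · u1 ⊖ z1 · u0)) · v0
      ⊕ (d0 · (u1 · v2 ⊖ u2 · v1) ⊕ d1 · (u2 · v0 ⊖ u0 · v2) ⊕ d2 · (u0 · v1 ⊖ u1 · v0)) · z0
    cramer₀ = solveℤ

    cramer₁ : ∀ u0 u1 u2 v0 v1 v2 z0 z1 z2 d0 d1 d2 →
      (z0 · (u1 · v2 ⊖ u2 · v1) ⊕ z1 · (u2 · v0 ⊖ u0 · v2) ⊕ z2 · (u0 · v1 ⊖ u1 · v0)) · d1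
      ≡ (d0 · (v1 · z2 ⊖ v2 · z1) ⊕ d1 · (v2 · z0 ⊖ v0 · z2) ⊕ d2 · (v0 · z1 ⊖ v1 · z0)) · u1
      ⊕ (d0 · (z1 · u2 ⊖ z2 · u1) ⊕ d1 · (z2 · u0 ⊖ z0 · u2) ⊕ d2 · (z0 · u1 ⊖ z1 · u0)) · v1
      ⊕ (d0 · (u1 · v2 ⊖ u2 · v1) ⊕ d1 · (u2 · v0 ⊖ u0 · v2) ⊕ d2 · (u0 · v1 ⊖ u1 · v0)) · z1
    cramer₁ = solveℤ

    cramer₂ : ∀ u0 u1 u2 v0 v1 v2 z0 z1 z2 d0 d1 d2 →
      (z0 · (u1 · v2 ⊖ u2 · v1) ⊕ z1 · (u2 · v0 ⊖ u0 · v2) ⊕ z2 · (u0 · v1 ⊖ u1 · v0)) · d2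
      ≡ (d0 · (v1 · z2 ⊖ v2 · z1) ⊕ d1 · (v2 · z0 ⊖ v0 · z2) ⊕ d2 · (v0 · z1 ⊖ v1 · z0)) · u2
      ⊕ (d0 · (z1 · u2 ⊖ z2 · u1) ⊕ d1 · (z2 · u0 ⊖ z0 · u2) ⊕ d2 · (z0 · u1 ⊖ z1 · u0)) · v2
      ⊕ (d0 · (u1 · v2 ⊖ u2 · v1) ⊕ d1 · (u2 · v0 ⊖ u0 · v2) ⊕ d2 · (u0 · v1 ⊖ u1 · v0)) · z2
    cramer₂ = solveℤ

    cramer : ∀ (u v z d : Vec3 ℤ) j → dot z (cross u v) · d j ≡
             dot d (cross v z) · u j ⊕ dot d (cross z u) · v j ⊕ dot d (cross u v) · z j
    cramer u v z d zero             = cramer₀ (u i0) (u i1) (u i2) (v i0) (v i1) (v i2) (z i0) (z i1) (z i2) (d i0) (d i1) (d i2)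
    cramer u v z d (suc zero)       = cramer₁ (u i0) (u i1) (u i2) (v i0) (v i1) (v i2) (z i0) (z i1) (z i2) (d i0) (d i1) (d i2)
    cramer u v z d (suc (suc zero)) = cramer₂ (u i0) (u i1) (u i2) (v i0) (v i1) (v i2) (z i0) (z i1) (z i2) (d i0) (d i1) (d i2)

    dot-⊖ : ∀ (x y c : Vec3 ℤ) → dot (λ j → x j ⊖ y j) c ≡ dot x c ⊖ dot y c
    dot-⊖ x y c = identity (x i0) (x i1) (x i2) (y i0) (y i1) (y i2) (c i0) (c i1) (c i2)
      where
      identity : ∀ x0 x1 x2 y0 y1 y2 c0 c1 c2 → (x0 ⊖ y0) · c0 ⊕ (x1 ⊖ y1) · c1 ⊕ (x2 ⊖ y2) · c2 ≡
                 (x0 · c0 ⊕ x1 · c1 ⊕ x2 · c2) ⊖ (y0 · c0 ⊕ y1 · c1 ⊕ y2 · c2)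
      identity = solveℤ

    -- The difference of two solutions is orthogonal to w, so its expansion by Cramer's rule along
    -- u, v, z₀ has no z₀ term; the denominator is z₀ · w = 1, which makes the coefficients
    -- integers.
    decompose : ∀ z z₀ → dot z w ≡ 1ℤ → dot z₀ w ≡ 1ℤ → ∀ j →
                z j ≡ z₀ j ⊕ (mᵤ z z₀ · at u j ⊕ mᵥ z z₀ · at v j)
    decompose z z₀ zw z₀w j = begin
      z j                                                   ≡⟨ restore (z j) (z₀ j) ⟩
      z₀ j ⊕ 1ℤ · δ j                                       ≡⟨ cong (λ d → z₀ j ⊕ d · δ j) (sym z₀w) ⟩
      z₀ j ⊕ dot z₀ w · δ j                                 ≡⟨ cong (z₀ j ⊕_) (cramer (at u) (at v) z₀ δ j) ⟩
      z₀ j ⊕ (m · at u j ⊕ n · at v j ⊕ dot δ w · z₀ j)     ≡⟨ cong (λ d → z₀ j ⊕ (m · at u j ⊕ n · at v j ⊕ d · z₀ j)) (trans (dot-⊖ z z₀ w) (cong₂ _⊖_ zw z₀w)) ⟩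
      z₀ j ⊕ (m · at u j ⊕ n · at v j ⊕ 0ℤ · z₀ j)          ≡⟨ cong (z₀ j ⊕_) (ℤₚ.+-identityʳ _) ⟩
      z₀ j ⊕ (m · at u j ⊕ n · at v j)                      ∎
      where
      open ≡-Reasoning
      δ : Vec3 ℤ
      δ j = z j ⊖ z₀ j
      m n : ℤ
      m = dot δ (cross (at v) z₀)
      n = dot δ (cross z₀ (at u))
      restore : ∀ x y → x ≡ y ⊕ 1ℤ · (x ⊖ y)
      restore = solveℤ

    ∣·∣≤⇒≤2 : ∀ m c x y → c ≢ 0ℤ → m · c ≡ x ⊖ y → ∣ x ∣ ≤ ∣ c ∣ → ∣ y ∣ ≤ ∣ c ∣ → ∣ m ∣ ≤ 2
    ∣·∣≤⇒≤2 m c x y c≢0 mc≡ x≤ y≤ = ℕₚ.*-cancelʳ-≤ (∣ m ∣) 2 (∣ c ∣) {{ℕ.≢-nonZero (c≢0 ∘ ℤₚ.∣i∣≡0⇒i≡0)}} (begin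
      ∣ m ∣ * ∣ c ∣      ≡⟨ ℤₚ.abs-* m c ⟨
      ∣ m · c ∣          ≡⟨ cong ∣_∣ mc≡ ⟩
      ∣ x ⊖ y ∣          ≤⟨ ℤₚ.∣i-j∣≤∣i∣+∣j∣ x y ⟩
      ∣ x ∣ + ∣ y ∣      ≤⟨ m≤n⇒m+m≤2*n x≤ y≤ ⟩
      2 * ∣ c ∣          ∎)
      where open ℕₚ.≤-Reasoning

  ThirdRow : Fin 3 → Row → Set
  ThirdRow k z = dot (at z) w ≡ 1ℤ × ∣ cross (at z) (at u) k ∣ ≤ ∣ w k ∣ × ∣ cross (at v) (at z) k ∣ ≤ ∣ w k ∣

  -- The cross product of z - z₀ = m u + n v with v, or with u, isolates m w or n w up to sign. At
  -- the index k each is a difference of two numbers of size at most |wₖ|, so |m| and |n| are at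
  -- most 2; hence 25 = 5 · 5.
  bound-ThirdRow : ∀ k → w k ≢ 0ℤ → Bound (ThirdRow k) 25
  bound-ThirdRow k wₖ≢0 = bound-inhabited λ z₀ (z₀w , z₀u≤ , vz₀≤) →
    bound-injective (λ z → mᵤ (at z) (at z₀) , mᵥ (at z) (at z₀))
      (λ {z} (zw , zu≤ , vz≤) → let z≡ = decompose (at z) (at z₀) zw z₀w in
        ∣·∣≤⇒≤2 (mᵤ (at z) (at z₀)) (w k) (cross (at v) (at z₀) k) (cross (at v) (at z) k) wₖ≢0 (first (mᵤ (at z) (at z₀)) (mᵥ (at z) (at z₀)) (at z₀) (at z) k z≡) vz₀≤ vz≤ ,
        ∣·∣≤⇒≤2 (mᵥ (at z) (at z₀)) (w k) (cross (at z₀) (at u) k) (cross (at z) (at u) k) wₖ≢0 (second (mᵤ (at z) (at z₀)) (mᵥ (at z) (at z₀)) (at z₀) (at z) k z≡) z₀u≤ zu≤)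
      (λ {z} {z′} (zw , _) (z′w , _) e → at-injective λ j → trans (decompose (at z) (at z₀) zw z₀w j)
        (trans (cong₂ (λ m n → at z₀ j ⊕ (m · at u j ⊕ n · at v j)) (cong proj₁ e) (cong proj₂ e)) (sym (decompose (at z′) (at z₀) z′w z₀w j))))
      (bound-Σ ℤ._≟_ (bound-∣∣≤ 2) λ _ _ → bound-∣∣≤ 2)
    where
    first : ∀ m n (z₀ z : Vec3 ℤ) k → (∀ j → z j ≡ z₀ j ⊕ (m · at u j ⊕ n · at v j)) → m · w k ≡ cross (at v) z₀ k ⊖ cross (at v) z k
    first m n z₀ z k z≡ = trans (identity m n (at u (nx k)) (at u (ny k)) (at v (nx k)) (at v (ny k)) (z₀ (nx k)) (z₀ (ny k)))
      (cong₂ (λ a b → cross (at v) z₀ k ⊖ (at v (nx k) · a ⊖ at v (ny k) · b)) (sym (z≡ (ny k))) (sym (z≡ (nx k))))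
      where
      identity : ∀ m n u1 u2 v1 v2 z1 z2 → m · (u1 · v2 ⊖ u2 · v1) ≡
                 (v1 · z2 ⊖ v2 · z1) ⊖ (v1 · (z2 ⊕ (m · u2 ⊕ n · v2)) ⊖ v2 · (z1 ⊕ (m · u1 ⊕ n · v1)))
      identity = solveℤ
    second : ∀ m n (z₀ z : Vec3 ℤ) k → (∀ j → z j ≡ z₀ j ⊕ (m · at u j ⊕ n · at v j)) → n · w k ≡ cross z₀ (at u) k ⊖ cross z (at u) k
    second m n z₀ z k z≡ = trans (identity m n (at u (nx k)) (at u (ny k)) (at v (nx k)) (at v (ny k)) (z₀ (nx k)) (z₀ (ny k)))
      (cong₂ (λ a b → cross z₀ (at u) k ⊖ (b · at u (ny k) ⊖ a · at u (nx k))) (sym (z≡ (ny k))) (sym (z≡ (nx k))))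
      where
      identity : ∀ m n u1 u2 v1 v2 z1 z2 → n · (u1 · v2 ⊖ u2 · v1) ≡
                 (z1 · u2 ⊖ z2 · u1) ⊖ ((z1 ⊕ (m · u1 ⊕ n · v1)) · u2 ⊖ (z2 ⊕ (m · u2 ⊕ n · v2)) · u1)
      identity = solveℤ

Small : ℕ → ℕ → Mat → Set
Small S R A = (∀ i j → ∣ ⟦ A ⟧ i j ∣ ≤ S) × (∀ i j → ∣ cof ⟦ A ⟧ i j ∣ ≤ R) × det ⟦ A ⟧ ≡ 1ℤ

dot-zero : ∀ u v → (∀ j → v j ≡ 0ℤ) → dot u v ≡ 0ℤ
dot-zero u v v≡0 = cong₂ _⊕_ (cong₂ _⊕_ (term i0) (term i1)) (term i2)
  where
  term : ∀ j → u j · v j ≡ 0ℤ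
  term j = trans (cong (u j ·_) (v≡0 j)) (ℤₚ.*-zeroʳ (u j))

cross≢0⇒ : ∀ u v k → cross u v k ≢ 0ℤ → ∃ λ j → u j ≢ 0ℤ
cross≢0⇒ u v k uv≢0 with u (nx k) ℤ.≟ 0ℤ | u (ny k) ℤ.≟ 0ℤ
... | no u≢0 | _      = nx k , u≢0
... | yes _  | no u≢0 = ny k , u≢0
... | yes p  | yes q  = contradiction (cong₂ (λ a b → a · v (ny k) ⊖ b · v (nx k)) p q) uv≢0

bound-Small : ∀ S R → S ≤ 2 * R → Bound (Small S R) (3 * (3 * (3 * (S * (6 * S * (18 * R * (18 * R)))) * 25)))
bound-Small S R S≤2R = bound-⊆ choose (bound-∃ Finₚ._≟_ bound-Fin3 λ i _ → bound-∃ Finₚ._≟_ bound-Fin3 λ k _ →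
  bound-∃ (≡-dec _≟ʳ_ _≟ʳ_) bound-Pair λ (u , v) _ → third i k u v)
  where
  open RowPairs S R S≤2R
  _≟ʳ_ : DecidableEquality Row
  _≟ʳ_ = ≡-dec ℤ._≟_ (≡-dec ℤ._≟_ ℤ._≟_)

  -- With rows read cyclically from i, the other cofactors of column k are entries of z × u and v ×
  -- z for the third row z. As (i, k) is the place of a largest cofactor, they are bounded by the
  -- nonzero entry of u × v at k, which is what `ThirdRow` asks for.
  Max : Fin 3 → Fin 3 → Row → Row → Mat → Set
  Max i k u v A = Small S R A × (∀ i′ → ∣ cof ⟦ A ⟧ i′ k ∣ ≤ ∣ cof ⟦ A ⟧ i k ∣) × cof ⟦ A ⟧ i k ≢ 0ℤ × at A (nx i) ≡ u × at A (ny i) ≡ v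

  choose : ∀ {A} → Small S R A → ∃ λ i → ⊤ × (∃ λ k → ⊤ × ∃ λ (u , v) → Pair (u , v) × Max i k u v A)
  choose {A} small@(≤S , ≤R , det≡1) = go (argmax₂ (λ i k → ∣ cof ⟦ A ⟧ i k ∣))
    where
    go : (∃₂ λ i k → ∀ j l → ∣ cof ⟦ A ⟧ j l ∣ ≤ ∣ cof ⟦ A ⟧ i k ∣) → ∃ λ i → ⊤ × (∃ λ k → ⊤ × ∃ λ (u , v) → Pair (u , v) × Max i k u v A)
    go (i , k , max) = i , tt , k , tt , (at A (nx i) , at A (ny i)) ,
      (≤S (nx i) , ≤S (ny i) , ≤R i , cross≢0⇒ (⟦ A ⟧ (nx i)) (⟦ A ⟧ (ny i)) k cof≢0) , small , (λ i′ → max i′ k) , cof≢0 , refl , refl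
      where
      cof≢0 : cof ⟦ A ⟧ i k ≢ 0ℤ
      cof≢0 cof≡0 = case trans (sym det≡1) (trans (det-expand ⟦ A ⟧ i0) (dot-zero (⟦ A ⟧ i0) (cof ⟦ A ⟧ i0) λ j →
        ℤₚ.∣i∣≡0⇒i≡0 (ℕₚ.n≤0⇒n≡0 (subst (λ c → ∣ cof ⟦ A ⟧ i0 j ∣ ≤ ∣ c ∣) cof≡0 (max i0 j))))) of λ ()

  third : ∀ i k u v → Bound (Max i k u v) 25
  third i k u v = bound-inhabited λ A max →
    bound-injective (λ B → at B i) (λ {B} → valid B) injective (ThirdRow.bound-ThirdRow u v k (nonzero A max))
    where
    nonzero : ∀ A → Max i k u v A → cross (at u) (at v) k ≢ 0ℤ
    nonzero _ (_ , _ , cof≢0 , refl , refl) = cof≢0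
    valid : ∀ B → Max i k u v B → ThirdRow.ThirdRow u v k (at B i)
    valid B ((_ , _ , det≡1) , max , _ , refl , refl) =
      trans (sym (det-expand ⟦ B ⟧ i)) det≡1 ,
      subst (_≤ ∣ cof ⟦ B ⟧ i k ∣) (cong₂ (λ a b → ∣ cross (⟦ B ⟧ a) (⟦ B ⟧ b) k ∣) (nx-ny i) (ny-ny i)) (max (ny i)) ,
      subst (_≤ ∣ cof ⟦ B ⟧ i k ∣) (cong₂ (λ a b → ∣ cross (⟦ B ⟧ a) (⟦ B ⟧ b) k ∣) (nx-nx i) (ny-nx i)) (max (nx i))
    injective : ∀ {B C} → Max i k u v B → Max i k u v C → at B i ≡ at C i → B ≡ C
    injective {B} {C} (_ , _ , _ , p , q) (_ , _ , _ , p′ , q′) e =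
      at-injective (cyclic-cases (λ j → at B j ≡ at C j) i e (trans p (sym p′)) (trans q (sym q′)))

-- Linear algebra modulo q

module Modular (q : ℕ) (q! : Prime q) where

  Z : ℤ → Set
  Z x = + q ∣ᶻ x

  Z? : ∀ x → Dec (Z x)
  Z? x = (+ q) ℤ∣.∣? x

  Z-0 : Z 0ℤ
  Z-0 = ∣ᵤ⇒∣ (q ℕ∣.∣0)

  -- Congruences are proved throughout by exhibiting the claim as an integer combination of known
  -- multiples of q, so that only an identity over the integers remains.
  Z₁ : ∀ {x y} c → Z y → x ≡ c · y → Z x
  Z₁ {y = y} c zy refl = ℤ∣.∣n⇒∣m*n c {y} zy

  Z₂ : ∀ {x y₁ y₂} c₁ c₂ → Z y₁ → Z y₂ → x ≡ c₁ · y₁ ⊕ c₂ · y₂ → Z x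
  Z₂ c₁ c₂ z₁ z₂ refl = ℤ∣.∣m∣n⇒∣m+n (Z₁ c₁ z₁ refl) (Z₁ c₂ z₂ refl)

  Z₃ : ∀ {x y₁ y₂ y₃} c₁ c₂ c₃ → Z y₁ → Z y₂ → Z y₃ → x ≡ c₁ · y₁ ⊕ c₂ · y₂ ⊕ c₃ · y₃ → Z x
  Z₃ c₁ c₂ c₃ z₁ z₂ z₃ refl = ℤ∣.∣m∣n⇒∣m+n (Z₂ c₁ c₂ z₁ z₂ refl) (Z₁ c₃ z₃ refl)

  Z₄ : ∀ {x y₁ y₂ y₃ y₄} c₁ c₂ c₃ c₄ → Z y₁ → Z y₂ → Z y₃ → Z y₄ → x ≡ c₁ · y₁ ⊕ c₂ · y₂ ⊕ c₃ · y₃ ⊕ c₄ · y₄ → Z x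
  Z₄ c₁ c₂ c₃ c₄ z₁ z₂ z₃ z₄ refl = ℤ∣.∣m∣n⇒∣m+n (Z₃ c₁ c₂ c₃ z₁ z₂ z₃ refl) (Z₁ c₄ z₄ refl)

  Z-euclid : ∀ x y → Z (x · y) → Z x ⊎ Z y
  Z-euclid x y zxy with euclidsLemma ∣ x ∣ ∣ y ∣ q! (subst (q ∣ⁿ_) (ℤₚ.abs-* x y) (∣⇒∣ᵤ zxy))
  ... | inj₁ zx = inj₁ (∣ᵤ⇒∣ zx)
  ... | inj₂ zy = inj₂ (∣ᵤ⇒∣ zy)

  Z-cancelˡ : ∀ x y → ¬ Z x → Z (x · y) → Z y
  Z-cancelˡ x y ¬zx zxy with Z-euclid x y zxy
  ... | inj₁ zx = contradiction zx ¬zx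
  ... | inj₂ zy = zy

  Z-small : ∀ {x} → Z x → ∣ x ∣ < q → x ≡ 0ℤ
  Z-small {x} zx x<q = ℤₚ.∣i∣≡0⇒i≡0 (go ∣ x ∣ (∣⇒∣ᵤ zx) x<q)
    where
    go : ∀ n → q ∣ⁿ n → n < q → n ≡ 0
    go zero    _   _   = refl
    go (suc n) q∣n n<q = contradiction (ℕ∣.∣⇒≤ q∣n) (ℕₚ.<⇒≱ n<q)

  1<q : 1 < q
  1<q = ℕ.nonTrivial⇒n>1 q {{prime⇒nonTrivial q!}}

  ¬Z-1 : ¬ Z 1ℤ
  ¬Z-1 z = case Z-small z 1<q of λ ()

  Z-⊖⇒≡ : ∀ {x y} → Z (x ⊖ y) → ∣ x ∣ + ∣ y ∣ < q → x ≡ y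
  Z-⊖⇒≡ {x} {y} z x+y<q = ℤₚ.i-j≡0⇒i≡j x y (Z-small z (ℕₚ.≤-<-trans (ℤₚ.∣i-j∣≤∣i∣+∣j∣ x y) x+y<q))

  Z-residue : ∀ {m n} → m < q → n < q → Z (+ m ⊖ + n) → m ≡ n
  Z-residue {m} {n} m<q n<q z = ℤₚ.+-injective (ℤₚ.i-j≡0⇒i≡j (+ m) (+ n) (Z-small z
    (subst (λ z → ∣ z ∣ < q) (sym (ℤₚ.m-n≡m⊖n m n)) (ℕₚ.≤-<-trans (ℤₚ.∣m⊝n∣≤m⊔n m n) (ℕₚ.⊔-pres-<m m<q n<q)))))

  -- Successive divided differences of a monic cubic: a fourth root would make the constant 1 vanish.
  bound-cubic : ∀ a b c → Bound (λ l → l < q × Z (+ l · + l · + l ⊕ a · + l · + l ⊕ b · + l ⊕ c)) 3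
  bound-cubic a b c = go
    where
    Root : ℕ → Set
    Root l = l < q × Z (+ l · + l · + l ⊕ a · + l · + l ⊕ b · + l ⊕ c)
    G : ℤ → ℤ → ℤ
    G x y = x · x ⊕ x · y ⊕ y · y ⊕ a · (x ⊕ y) ⊕ b
    root-difference : ∀ {x y} → Root x → Root y → x ≢ y → Z (G (+ x) (+ y))
    root-difference {x} {y} (x<q , zx) (y<q , zy) x≢y = Z-cancelˡ (+ x ⊖ + y) _ (λ z → x≢y (Z-residue x<q y<q z))
      (Z₂ (+ 1) (ℤ.-1ℤ) zx zy (identity (+ x) (+ y) a b c))
      where
      identity : ∀ x y a b c → (x ⊖ y) · (x · x ⊕ x · y ⊕ y · y ⊕ a · (x ⊕ y) ⊕ b) ≡
                 + 1 · (x · x · x ⊕ a · x · x ⊕ b · x ⊕ c) ⊕ ℤ.-1ℤ · (y · y · y ⊕ a · y · y ⊕ b · y ⊕ c)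
      identity = solveℤ
    G-difference : ∀ {x y z} → y < q → z < q → y ≢ z → Z (G (+ x) (+ y)) → Z (G (+ x) (+ z)) → Z (+ x ⊕ + y ⊕ + z ⊕ a)
    G-difference {x} {y} {z} y<q z<q y≢z zy zz = Z-cancelˡ (+ y ⊖ + z) _ (λ w → y≢z (Z-residue y<q z<q w))
      (Z₂ (+ 1) (ℤ.-1ℤ) zy zz (identity (+ x) (+ y) (+ z) a b))
      where
      identity : ∀ x y z a b → (y ⊖ z) · (x ⊕ y ⊕ z ⊕ a) ≡
                 + 1 · (x · x ⊕ x · y ⊕ y · y ⊕ a · (x ⊕ y) ⊕ b) ⊕ ℤ.-1ℤ · (x · x ⊕ x · z ⊕ z · z ⊕ a · (x ⊕ z) ⊕ b)
      identity = solveℤ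
    four : ∀ {x y z w} → Root x → Root y → Root z → Root w → x ≢ y → x ≢ z → x ≢ w → y ≢ z → y ≢ w → z ≢ w → ⊥
    four {x} {y} {z} {w} rx ry rz rw x≢y x≢z x≢w y≢z y≢w z≢w = z≢w (Z-residue (proj₁ rz) (proj₁ rw)
      (Z₂ (+ 1) (ℤ.-1ℤ)
        (G-difference (proj₁ ry) (proj₁ rz) y≢z (root-difference rx ry x≢y) (root-difference rx rz x≢z))
        (G-difference (proj₁ ry) (proj₁ rw) y≢w (root-difference rx ry x≢y) (root-difference rx rw x≢w))
        (identity (+ x) (+ y) (+ z) (+ w) a)))
      where
      identity : ∀ x y z w a → z ⊖ w ≡ + 1 · (x ⊕ y ⊕ z ⊕ a) ⊕ ℤ.-1ℤ · (x ⊕ y ⊕ w ⊕ a)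
      identity = solveℤ
    go : Bound Root 3
    go []                  _ _ = z≤n
    go (_ ∷ [])            _ _ = s≤s z≤n
    go (_ ∷ _ ∷ [])        _ _ = s≤s (s≤s z≤n)
    go (_ ∷ _ ∷ _ ∷ [])    _ _ = s≤s (s≤s (s≤s z≤n))
    go (_ ∷ _ ∷ _ ∷ _ ∷ _) ((x≢y ∷ x≢z ∷ x≢w ∷ _) ∷ (y≢z ∷ y≢w ∷ _) ∷ (z≢w ∷ _) ∷ _) (rx ∷ ry ∷ rz ∷ rw ∷ _) =
      ⊥-elim (four rx ry rz rw x≢y x≢z x≢w y≢z y≢w z≢w)

  -- Points and lines of the projective plane over F_q

  Point : Set
  Point = ℕ × ℕ × ℕ

  coords : Point → Vec3 ℤ
  coords x i = + at x i

  Affine Line : Point → Set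
  Affine x = ∃₂ λ a b → a < q × b < q × x ≡ (1 , a , b)
  Line x = ∃ λ b → b < q × x ≡ (0 , 1 , b)

  Projective : Point → Set
  Projective x = Affine x ⊎ Line x ⊎ x ≡ (0 , 0 , 1)

  Killed : Vec3 ℤ → Point → Set
  Killed n x = Z (dot n (coords x))

  bound-Line : Bound (λ x → Line x ⊎ x ≡ (0 , 0 , 1)) (q + 1)
  bound-Line = bound-⊎
    (bound-injective (proj₂ ∘ proj₂) (λ { (_ , b<q , refl) → b<q }) (λ { (_ , _ , refl) (_ , _ , refl) refl → refl }) (bound-< q))
    (bound-subsingleton λ p p′ → trans p (sym p′))

  private
    1≤q : 1 ≤ q
    1≤q = ℕₚ.<⇒≤ 1<q

    q+1≤2*q : q + 1 ≤ 2 * q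
    q+1≤2*q = ℕₚ.+-monoʳ-≤ q (ℕₚ.≤-trans 1≤q (ℕₚ.≤-reflexive (sym (ℕₚ.+-identityʳ q))))

  bound-Projective : Bound Projective (3 * (q * q))
  bound-Projective = bound-≤ (ℕₚ.+-monoʳ-≤ (q * q) (ℕₚ.≤-trans q+1≤2*q (ℕₚ.*-monoʳ-≤ 2 (ℕₚ.m≤m*n q q {{ℕ.>-nonZero 1≤q}}))))
    (bound-⊎ (bound-injective proj₂ {λ (a , b) → a < q × b < q} (λ { (_ , _ , a<q , b<q , refl) → a<q , b<q })
               (λ { (_ , _ , _ , _ , refl) (_ , _ , _ , _ , refl) refl → refl })
               (bound-Σ ℕₚ._≟_ (bound-< q) λ _ _ → bound-< q))
             bound-Line)

  bound-Killed : ∀ n k → ¬ Z (n k) → Bound (λ x → Projective x × Killed n x) (3 * q)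
  bound-Killed n k ¬znₖ = bound-⊆ forms (bound-⊎ affine (bound-≤ q+1≤2*q bound-Line))
    where
    forms : ∀ {x} → Projective x × Killed n x → (Affine x × Killed n x) ⊎ (Line x ⊎ x ≡ (0 , 0 , 1))
    forms (inj₁ p , z) = inj₁ (p , z)
    forms (inj₂ p , _) = inj₂ p
    by-b : ∀ n0 n1 n2 a b b′ → n2 · (b ⊖ b′) ≡ + 1 · (n0 · + 1 ⊕ n1 · a ⊕ n2 · b) ⊕ ℤ.-1ℤ · (n0 · + 1 ⊕ n1 · a ⊕ n2 · b′)
    by-b = solveℤ
    by-a : ∀ n0 n1 n2 a a′ b → n1 · (a ⊖ a′) ≡ + 1 · (n0 · + 1 ⊕ n1 · a ⊕ n2 · b) ⊕ ℤ.-1ℤ · (n0 · + 1 ⊕ n1 · a′ ⊕ n2 · b)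
    by-a = solveℤ
    by-1 : ∀ n0 n1 n2 a b → n0 ≡ + 1 · (n0 · + 1 ⊕ n1 · a ⊕ n2 · b) ⊕ (⊝ a) · n1 ⊕ (⊝ b) · n2
    by-1 = solveℤ
    affine : Bound (λ x → Affine x × Killed n x) q
    affine with Z? (n i2) | Z? (n i1)
    ... | no ¬z₂ | _      = bound-injective (proj₁ ∘ proj₂) (λ { ((_ , _ , a<q , _ , refl) , _) → a<q })
      (λ { ((a , b , _ , b<q , refl) , z) ((_ , b′ , _ , b′<q , refl) , z′) refl → cong (λ b → 1 , a , b)
        (Z-residue b<q b′<q (Z-cancelˡ (n i2) _ ¬z₂ (Z₂ (+ 1) ℤ.-1ℤ z z′ (by-b (n i0) (n i1) (n i2) (+ a) (+ b) (+ b′))))) }) (bound-< q)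
    ... | yes _  | no ¬z₁ = bound-injective (proj₂ ∘ proj₂) (λ { ((_ , _ , _ , b<q , refl) , _) → b<q })
      (λ { ((a , b , a<q , _ , refl) , z) ((a′ , _ , a′<q , _ , refl) , z′) refl → cong (λ a → 1 , a , b)
        (Z-residue a<q a′<q (Z-cancelˡ (n i1) _ ¬z₁ (Z₂ (+ 1) ℤ.-1ℤ z z′ (by-a (n i0) (n i1) (n i2) (+ a) (+ a′) (+ b))))) }) (bound-< q)
    ... | yes z₂ | yes z₁ = bound-empty λ { _ ((a , b , _ , _ , refl) , z) → ¬znₖ
      (cyclic-cases (Z ∘ n) i0 (Z₃ (+ 1) (⊝ + a) (⊝ + b) z z₁ z₂ (by-1 (n i0) (n i1) (n i2) (+ a) (+ b))) z₁ z₂ k) }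

  Proportional : Vec3 ℤ → Vec3 ℤ → Set
  Proportional x y = ∀ a b → Z (x a · y b ⊖ x b · y a)

  -- The leading coordinate of a representative is 1, so a single minor compares each remaining
  -- coordinate, and for representatives of different shapes some minor is 1 or -1.
  proportional-points : ∀ {x y} → Projective x → Projective y → Proportional (coords x) (coords y) → x ≡ y
  proportional-points (inj₁ (a , b , a<q , b<q , refl)) (inj₁ (a′ , b′ , a′<q , b′<q , refl)) p =
    cong₂ (λ a b → 1 , a , b) (Z-residue a<q a′<q (Z₁ ℤ.-1ℤ (p i0 i1) (identity (+ a) (+ a′)))) (Z-residue b<q b′<q (Z₁ ℤ.-1ℤ (p i0 i2) (identity (+ b) (+ b′))))
    where
    identity : ∀ a a′ → a ⊖ a′ ≡ ℤ.-1ℤ · (+ 1 · a′ ⊖ a · + 1)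
    identity = solveℤ
  proportional-points (inj₁ (a , _ , _ , _ , refl)) (inj₂ (inj₁ (_ , _ , refl))) p = contradiction (Z₁ (+ 1) (p i0 i1) (identity (+ a))) ¬Z-1
    where
    identity : ∀ a → + 1 ≡ + 1 · (+ 1 · + 1 ⊖ a · + 0)
    identity = solveℤ
  proportional-points (inj₁ (_ , b , _ , _ , refl)) (inj₂ (inj₂ refl)) p = contradiction (Z₁ (+ 1) (p i0 i2) (identity (+ b))) ¬Z-1
    where
    identity : ∀ a → + 1 ≡ + 1 · (+ 1 · + 1 ⊖ a · + 0)
    identity = solveℤ
  proportional-points (inj₂ (inj₁ (b , b<q , refl))) (inj₂ (inj₁ (b′ , b′<q , refl))) p =
    cong (λ b → 0 , 1 , b) (Z-residue b<q b′<q (Z₁ ℤ.-1ℤ (p i1 i2) (identity (+ b) (+ b′))))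
    where
    identity : ∀ a a′ → a ⊖ a′ ≡ ℤ.-1ℤ · (+ 1 · a′ ⊖ a · + 1)
    identity = solveℤ
  proportional-points (inj₂ (inj₁ (b , _ , refl))) (inj₂ (inj₂ refl)) p = contradiction (Z₁ (+ 1) (p i1 i2) (identity (+ b))) ¬Z-1
    where
    identity : ∀ a → + 1 ≡ + 1 · (+ 1 · + 1 ⊖ a · + 0)
    identity = solveℤ
  proportional-points (inj₂ (inj₁ (_ , _ , refl))) (inj₁ (a , _ , _ , _ , refl)) p = contradiction (Z₁ ℤ.-1ℤ (p i0 i1) (identity (+ a))) ¬Z-1
    where
    identity : ∀ a → + 1 ≡ ℤ.-1ℤ · (+ 0 · a ⊖ + 1 · + 1)
    identity = solveℤ
  proportional-points (inj₂ (inj₂ refl)) (inj₁ (_ , b , _ , _ , refl)) p = contradiction (Z₁ ℤ.-1ℤ (p i0 i2) (identity (+ b))) ¬Z-1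
    where
    identity : ∀ a → + 1 ≡ ℤ.-1ℤ · (+ 0 · a ⊖ + 1 · + 1)
    identity = solveℤ
  proportional-points (inj₂ (inj₂ refl)) (inj₂ (inj₁ (b , _ , refl))) p = contradiction (Z₁ ℤ.-1ℤ (p i1 i2) (identity (+ b))) ¬Z-1
    where
    identity : ∀ a → + 1 ≡ ℤ.-1ℤ · (+ 0 · a ⊖ + 1 · + 1)
    identity = solveℤ
  proportional-points (inj₂ (inj₂ refl)) (inj₂ (inj₂ refl)) p = refl

  cross⇒proportional : ∀ {x y} → (∀ j → Z (cross x y j)) → Proportional x y
  cross⇒proportional {x} {y} z a b = cyclic-cases (λ b → Z (x a · y b ⊖ x b · y a)) a
    (subst Z (sym (ℤₚ.i≡j⇒i-j≡0 {x a · y a} refl)) Z-0)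
    (subst Z (cong₂ (λ c d → x c · y d ⊖ x d · y c) (nx-ny a) (ny-ny a)) (z (ny a)))
    (Z₁ ℤ.-1ℤ (subst Z (cong₂ (λ c d → x c · y d ⊖ x d · y c) (nx-nx a) (ny-nx a)) (z (nx a))) (identity (x a · y (ny a)) (x (ny a) · y a)))
    b
    where
    identity : ∀ s t → s ⊖ t ≡ ℤ.-1ℤ · (t ⊖ s)
    identity = solveℤ

  -- The vector triple product: a point killed by both n and m has zero cross product with n × m,
  -- hence is proportional to it.
  cross-cross : ∀ n m x j → cross (cross n m) x j ≡ m j · dot n x ⊕ (⊝ n j) · dot m x
  cross-cross n m x = λ
    { zero             → identity₀ (n i0) (n i1) (n i2) (m i0) (m i1) (m i2) (x i0) (x i1) (x i2)
    ; (suc zero)       → identity₁ (n i0) (n i1) (n i2) (m i0) (m i1) (m i2) (x i0) (x i1) (x i2)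
    ; (suc (suc zero)) → identity₂ (n i0) (n i1) (n i2) (m i0) (m i1) (m i2) (x i0) (x i1) (x i2) }
    where
    identity₀ : ∀ n0 n1 n2 m0 m1 m2 x0 x1 x2 → (n2 · m0 ⊖ n0 · m2) · x2 ⊖ (n0 · m1 ⊖ n1 · m0) · x1 ≡
                m0 · (n0 · x0 ⊕ n1 · x1 ⊕ n2 · x2) ⊕ (⊝ n0) · (m0 · x0 ⊕ m1 · x1 ⊕ m2 · x2)
    identity₀ = solveℤ
    identity₁ : ∀ n0 n1 n2 m0 m1 m2 x0 x1 x2 → (n0 · m1 ⊖ n1 · m0) · x0 ⊖ (n1 · m2 ⊖ n2 · m1) · x2 ≡
                m1 · (n0 · x0 ⊕ n1 · x1 ⊕ n2 · x2) ⊕ (⊝ n1) · (m0 · x0 ⊕ m1 · x1 ⊕ m2 · x2)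
    identity₁ = solveℤ
    identity₂ : ∀ n0 n1 n2 m0 m1 m2 x0 x1 x2 → (n1 · m2 ⊖ n2 · m1) · x1 ⊖ (n2 · m0 ⊖ n0 · m2) · x0 ≡
                m2 · (n0 · x0 ⊕ n1 · x1 ⊕ n2 · x2) ⊕ (⊝ n2) · (m0 · x0 ⊕ m1 · x1 ⊕ m2 · x2)
    identity₂ = solveℤ

  proportional-trans : ∀ {c x y} k → ¬ Z (c k) → Proportional c x → Proportional c y → Proportional x y
  proportional-trans {c} {x} {y} k ¬zc cx cy a b = Z-cancelˡ (c k) _ ¬zc
    (Z₃ (y b) (⊝ y a) (x k) (cx k a) (cx k b) (cy a b) (identity (c k) (c a) (c b) (x k) (x a) (x b) (y a) (y b)))
    where
    identity : ∀ ck ca cb xk xa xb ya yb → ck · (xa · yb ⊖ xb · ya) ≡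
               yb · (ck · xa ⊖ ca · xk) ⊕ (⊝ ya) · (ck · xb ⊖ cb · xk) ⊕ xk · (ca · yb ⊖ cb · ya)
    identity = solveℤ

  bound-Killed₂ : ∀ n m k → ¬ Z (cross n m k) → Bound (λ x → Projective x × Killed n x × Killed m x) 1
  bound-Killed₂ n m k ¬zc = bound-subsingleton λ {x} {y} (px , nx≡0 , mx≡0) (py , ny≡0 , my≡0) →
    proportional-points px py (proportional-trans {cross n m} k ¬zc (multiple x nx≡0 mx≡0) (multiple y ny≡0 my≡0))
    where
    multiple : ∀ x → Killed n x → Killed m x → Proportional (cross n m) (coords x)
    multiple x zn zm = cross⇒proportional {cross n m} {coords x} λ j → Z₂ (m j) (⊝ n j) zn zm (cross-cross n m (coords x) j)

-- Eigenvalues modulo q and the number of fixed points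

shift : Mat3 → ℤ → Mat3
shift g l zero             zero             = g i0 i0 ⊖ l
shift g l zero             (suc zero)       = g i0 i1
shift g l zero             (suc (suc zero)) = g i0 i2
shift g l (suc zero)       zero             = g i1 i0
shift g l (suc zero)       (suc zero)       = g i1 i1 ⊖ l
shift g l (suc zero)       (suc (suc zero)) = g i1 i2
shift g l (suc (suc zero)) zero             = g i2 i0
shift g l (suc (suc zero)) (suc zero)       = g i2 i1
shift g l (suc (suc zero)) (suc (suc zero)) = g i2 i2 ⊖ l

shift-diagonal : ∀ g l i → shift g l i i ≡ g i i ⊖ l
shift-diagonal g l zero             = refl
shift-diagonal g l (suc zero)       = refl
shift-diagonal g l (suc (suc zero)) = refl

shift-nx : ∀ g l i → shift g l i (nx i) ≡ g i (nx i)
shift-nx g l zero             = refl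
shift-nx g l (suc zero)       = refl
shift-nx g l (suc (suc zero)) = refl

shift-ny : ∀ g l i → shift g l i (ny i) ≡ g i (ny i)
shift-ny g l zero             = refl
shift-ny g l (suc zero)       = refl
shift-ny g l (suc (suc zero)) = refl

shift-ᵀ : ∀ g l i j → shift (g ᵀ) l i j ≡ shift g l j i
shift-ᵀ g l zero             zero             = refl
shift-ᵀ g l zero             (suc zero)       = refl
shift-ᵀ g l zero             (suc (suc zero)) = refl
shift-ᵀ g l (suc zero)       zero             = refl
shift-ᵀ g l (suc zero)       (suc zero)       = refl
shift-ᵀ g l (suc zero)       (suc (suc zero)) = refl
shift-ᵀ g l (suc (suc zero)) zero             = refl
shift-ᵀ g l (suc (suc zero)) (suc zero)       = refl
shift-ᵀ g l (suc (suc zero)) (suc (suc zero)) = refl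

-- Column k of the identity adj(g) g = det(g) I, applied to x.
det-solve : ∀ g x k → x k · det g ≡ cof g i0 k · dot (g i0) x ⊕ cof g i1 k · dot (g i1) x ⊕ cof g i2 k · dot (g i2) x
det-solve g x = λ
  { zero             → identity₀ (g i0 i0) (g i0 i1) (g i0 i2) (g i1 i0) (g i1 i1) (g i1 i2) (g i2 i0) (g i2 i1) (g i2 i2) (x i0) (x i1) (x i2)
  ; (suc zero)       → identity₁ (g i0 i0) (g i0 i1) (g i0 i2) (g i1 i0) (g i1 i1) (g i1 i2) (g i2 i0) (g i2 i1) (g i2 i2) (x i0) (x i1) (x i2)
  ; (suc (suc zero)) → identity₂ (g i0 i0) (g i0 i1) (g i0 i2) (g i1 i0) (g i1 i1) (g i1 i2) (g i2 i0) (g i2 i1) (g i2 i2) (x i0) (x i1) (x i2) }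
  where
  identity₀ : ∀ a b c d e f g h k x y z → x · (a · (e · k ⊖ f · h) ⊖ b · (d · k ⊖ f · g) ⊕ c · (d · h ⊖ e · g)) ≡
    (e · k ⊖ f · h) · (a · x ⊕ b · y ⊕ c · z) ⊕ (h · c ⊖ k · b) · (d · x ⊕ e · y ⊕ f · z) ⊕ (b · f ⊖ c · e) · (g · x ⊕ h · y ⊕ k · z)
  identity₀ = solveℤ
  identity₁ : ∀ a b c d e f g h k x y z → y · (a · (e · k ⊖ f · h) ⊖ b · (d · k ⊖ f · g) ⊕ c · (d · h ⊖ e · g)) ≡
    (f · g ⊖ d · k) · (a · x ⊕ b · y ⊕ c · z) ⊕ (k · a ⊖ g · c) · (d · x ⊕ e · y ⊕ f · z) ⊕ (c · d ⊖ a · f) · (g · x ⊕ h · y ⊕ k · z)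
  identity₁ = solveℤ
  identity₂ : ∀ a b c d e f g h k x y z → z · (a · (e · k ⊖ f · h) ⊖ b · (d · k ⊖ f · g) ⊕ c · (d · h ⊖ e · g)) ≡
    (d · h ⊖ e · g) · (a · x ⊕ b · y ⊕ c · z) ⊕ (g · b ⊖ h · a) · (d · x ⊕ e · y ⊕ f · z) ⊕ (a · e ⊖ b · d) · (g · x ⊕ h · y ⊕ k · z)
  identity₂ = solveℤ

tr : Mat3 → ℤ
tr g = g i0 i0 ⊕ g i1 i1 ⊕ g i2 i2

-- The characteristic polynomial, with `tr (cof g)` the trace of the adjugate. It limits the
-- eigenvalues modulo q to three and, for determinant 1, provides their inverses.
det-shift : ∀ g l → l · l · l ⊕ (⊝ tr g) · l · l ⊕ tr (cof g) · l ⊕ (⊝ det g) ≡ ℤ.-1ℤ · det (shift g l)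
det-shift g l = identity l (g i0 i0) (g i0 i1) (g i0 i2) (g i1 i0) (g i1 i1) (g i1 i2) (g i2 i0) (g i2 i1) (g i2 i2)
  where
  identity : ∀ l a b c d e f g h k → l · l · l ⊕ (⊝ (a ⊕ e ⊕ k)) · l · l ⊕ ((e · k ⊖ f · h) ⊕ (k · a ⊖ g · c) ⊕ (a · e ⊖ b · d)) · l ⊕
    (⊝ (a · (e · k ⊖ f · h) ⊖ b · (d · k ⊖ f · g) ⊕ c · (d · h ⊖ e · g))) ≡
    ℤ.-1ℤ · ((a ⊖ l) · ((e ⊖ l) · (k ⊖ l) ⊖ f · h) ⊖ b · (d · (k ⊖ l) ⊖ f · g) ⊕ c · (d · h ⊖ (e ⊖ l) · g))
  identity = solveℤ

module FixedPoints (q : ℕ) (q! : Prime q) where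
  open Modular q q! public

  Fixed : Mat3 → ℤ → Point → Set
  Fixed g l x = Projective x × (∀ i → Killed (shift g l i) x)

  -- Vanishing of all 2 by 2 minors means rank at most one, so `RankOne` includes `Scalar`.
  RankOne Scalar : Mat3 → ℤ → Set
  RankOne g l = ∀ i k → Z (cof (shift g l) i k)
  Scalar g l = ∀ i k → Z (shift g l i k)

  bound-eigenvalues : ∀ g → Bound (λ l → l < q × Z (det (shift g (+ l)))) 3
  bound-eigenvalues g = bound-⊆ (λ { {l} (l<q , z) → l<q , Z₁ ℤ.-1ℤ z (det-shift g (+ l)) }) (bound-cubic (⊝ tr g) (tr (cof g)) (⊝ det g))

  private
    unit-coordinate : ∀ {x} → Projective x → ∃ λ k → coords x k ≡ 1ℤ
    unit-coordinate (inj₁ (_ , _ , _ , _ , refl)) = i0 , refl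
    unit-coordinate (inj₂ (inj₁ (_ , _ , refl)))  = i1 , refl
    unit-coordinate (inj₂ (inj₂ refl))            = i2 , refl

  -- A normalised point has a coordinate equal to 1, and there `det-solve` writes the determinant as
  -- a combination of the vanishing products of rows with the point.
  fixed⇒eigenvalue : ∀ g l x → Fixed g l x → Z (det (shift g l))
  fixed⇒eigenvalue g l x (px , killed) = go (unit-coordinate px)
    where
    N = shift g l
    go : (∃ λ k → coords x k ≡ 1ℤ) → Z (det N)
    go (k , xₖ≡1) = Z₃ (cof N i0 k) (cof N i1 k) (cof N i2 k) (killed i0) (killed i1) (killed i2)
      (trans (trans (sym (ℤₚ.*-identityˡ (det N))) (cong (_· det N) (sym xₖ≡1))) (det-solve N (coords x) k))

  all₂? : (h : Fin 3 → Fin 3 → ℤ) → (∀ i k → Z (h i k)) ⊎ (∃₂ λ i k → ¬ Z (h i k))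
  all₂? h with Finₚ.all? (λ i → Finₚ.all? (λ k → Z? (h i k)))
  ... | yes z = inj₁ z
  ... | no ¬z with i , ¬zᵢ ← Finₚ.¬∀⟶∃¬ 3 _ (λ i → Finₚ.all? (λ k → Z? (h i k))) ¬z
    = inj₂ (i , Finₚ.¬∀⟶∃¬ 3 _ (λ k → Z? (h i k)) ¬zᵢ)

  module _ (G : Mat → Set) {N₀ N₁ N₂ : ℕ}
           (bound-all : Bound G N₀)
           (bound-rankOne : Bound (λ ((A , l) : Mat × ℕ) → G A × l < q × RankOne ⟦ A ⟧ (+ l)) N₁)
           (bound-scalar : Bound (λ A → G A × (∃ λ l → l < q × Scalar ⟦ A ⟧ (+ l))) N₂) where

    private
      FixedPair Generic Reflection Homothety : Mat × Point → Set
      FixedPair (A , x) = G A × (∃ λ l → l < q × Fixed ⟦ A ⟧ (+ l) x)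
      Generic (A , x) = ∃ λ B → G B × (∃ λ l → (l < q × Z (det (shift ⟦ B ⟧ (+ l)))) ×
        ((∃₂ λ i k → ¬ Z (cof (shift ⟦ B ⟧ (+ l)) i k)) × Fixed ⟦ B ⟧ (+ l) x × A ≡ B))
      Reflection (A , x) = ∃ λ ((B , l) : Mat × ℕ) → (G B × l < q × RankOne ⟦ B ⟧ (+ l)) ×
        ((∃₂ λ i k → ¬ Z (shift ⟦ B ⟧ (+ l) i k)) × Fixed ⟦ B ⟧ (+ l) x × A ≡ B)
      Homothety (A , x) = ∃ λ B → (G B × (∃ λ l → l < q × Scalar ⟦ B ⟧ (+ l))) × (Projective x × A ≡ B)

      -- The rank is that of `γ - l` for the eigenvalue of the point at hand, so one matrix may
      -- occur as `Generic` for one l and as `Reflection` for another.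
      classify : ∀ {p} → FixedPair p → Generic p ⊎ Reflection p ⊎ Homothety p
      classify {A , x} (gA , l , l<q , fixed) = go (all₂? (cof (shift ⟦ A ⟧ (+ l)))) (all₂? (shift ⟦ A ⟧ (+ l)))
        where
        go : (∀ i k → Z (cof (shift ⟦ A ⟧ (+ l)) i k)) ⊎ (∃₂ λ i k → ¬ Z (cof (shift ⟦ A ⟧ (+ l)) i k)) →
             (∀ i k → Z (shift ⟦ A ⟧ (+ l) i k)) ⊎ (∃₂ λ i k → ¬ Z (shift ⟦ A ⟧ (+ l) i k)) → Generic (A , x) ⊎ Reflection (A , x) ⊎ Homothety (A , x)
        go (inj₂ minor)   _              = inj₁ (A , gA , l , (l<q , fixed⇒eigenvalue ⟦ A ⟧ (+ l) x fixed) , minor , fixed , refl)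
        go (inj₁ rankOne) (inj₂ entry)   = inj₂ (inj₁ ((A , l) , (gA , l<q , rankOne) , entry , fixed , refl))
        go (inj₁ _)       (inj₁ scalar)  = inj₂ (inj₂ (A , (gA , l , l<q , scalar) , proj₁ fixed , refl))

      _≟ᵐ_ : DecidableEquality Mat
      _≟ᵐ_ = ≡-dec _≟ʳ_ (≡-dec _≟ʳ_ _≟ʳ_)
        where
        _≟ʳ_ : DecidableEquality Row
        _≟ʳ_ = ≡-dec ℤ._≟_ (≡-dec ℤ._≟_ ℤ._≟_)

      bound-Generic : Bound Generic (N₀ * (3 * 1))
      bound-Generic = bound-∃ _≟ᵐ_ bound-all λ B _ → bound-∃ ℕₚ._≟_ (bound-eigenvalues ⟦ B ⟧) λ l _ →
        bound-inhabited λ _ ((i , k , ¬z) , _) → bound-injective proj₂ (λ { (_ , (px , killed) , _) → px , killed (nx i) , killed (ny i) })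
          (λ { (_ , _ , refl) (_ , _ , refl) refl → refl }) (bound-Killed₂ (shift ⟦ B ⟧ (+ l) (nx i)) (shift ⟦ B ⟧ (+ l) (ny i)) k ¬z)

      bound-Reflection : Bound Reflection (N₁ * (3 * q))
      bound-Reflection = bound-∃ (≡-dec _≟ᵐ_ ℕₚ._≟_) bound-rankOne λ (B , l) _ →
        bound-inhabited λ _ ((i , k , ¬z) , _) → bound-injective proj₂ (λ { (_ , (px , killed) , _) → px , killed i })
          (λ { (_ , _ , refl) (_ , _ , refl) refl → refl }) (bound-Killed (shift ⟦ B ⟧ (+ l) i) k ¬z)

      bound-Homothety : Bound Homothety (N₂ * (3 * (q * q)))
      bound-Homothety = bound-∃ _≟ᵐ_ bound-scalar λ B _ →
        bound-injective proj₂ proj₁ (λ { (_ , refl) (_ , refl) refl → refl }) bound-Projective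

    bound-FixedPair : Bound FixedPair (N₀ * (3 * 1) + (N₁ * (3 * q) + N₂ * (3 * (q * q))))
    bound-FixedPair = bound-⊆ classify (bound-⊎ bound-Generic (bound-⊎ bound-Reflection bound-Homothety))

-- Matrices congruent to a scalar plus a matrix of rank one

shift-cong : ∀ {g h} l → (∀ i j → g i j ≡ h i j) → ∀ i j → shift g l i j ≡ shift h l i j
shift-cong l e zero             zero             = cong (_⊖ l) (e i0 i0)
shift-cong l e zero             (suc zero)       = e i0 i1
shift-cong l e zero             (suc (suc zero)) = e i0 i2
shift-cong l e (suc zero)       zero             = e i1 i0
shift-cong l e (suc zero)       (suc zero)       = cong (_⊖ l) (e i1 i1)
shift-cong l e (suc zero)       (suc (suc zero)) = e i1 i2
shift-cong l e (suc (suc zero)) zero             = e i2 i0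
shift-cong l e (suc (suc zero)) (suc zero)       = e i2 i1
shift-cong l e (suc (suc zero)) (suc (suc zero)) = cong (_⊖ l) (e i2 i2)

dot-cyclic : ∀ u v i → dot u v ≡ u i · v i ⊕ u (nx i) · v (nx i) ⊕ u (ny i) · v (ny i)
dot-cyclic u v zero             = refl
dot-cyclic u v (suc zero)       = rotation (u i0 · v i0) (u i1 · v i1) (u i2 · v i2)
  where
  rotation : ∀ a b c → a ⊕ b ⊕ c ≡ b ⊕ c ⊕ a
  rotation = solveℤ
dot-cyclic u v (suc (suc zero)) = rotation (u i0 · v i0) (u i1 · v i1) (u i2 · v i2)
  where
  rotation : ∀ a b c → a ⊕ b ⊕ c ≡ c ⊕ a ⊕ b
  rotation = solveℤ

det-diagonal-row : ∀ g i → g i (nx i) ≡ 0ℤ → g i (ny i) ≡ 0ℤ → g i i · cof g i i ≡ det g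
det-diagonal-row g i nx≡0 ny≡0 = begin
  g i i · cof g i i                                                                ≡⟨ pad (g i i · cof g i i) (cof g i (nx i)) (cof g i (ny i)) ⟩
  g i i · cof g i i ⊕ 0ℤ · cof g i (nx i) ⊕ 0ℤ · cof g i (ny i)                   ≡⟨ cong₂ (λ s t → g i i · cof g i i ⊕ s · cof g i (nx i) ⊕ t · cof g i (ny i)) nx≡0 ny≡0 ⟨
  g i i · cof g i i ⊕ g i (nx i) · cof g i (nx i) ⊕ g i (ny i) · cof g i (ny i)    ≡⟨ dot-cyclic (g i) (cof g i) i ⟨
  dot (g i) (cof g i)                                                              ≡⟨ det-expand g i ⟨
  det g                                                                            ∎
  where
  open ≡-Reasoning
  pad : ∀ a b c → a ≡ a ⊕ 0ℤ · b ⊕ 0ℤ · c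
  pad = solveℤ

module RankOneCount (q : ℕ) (q! : Prime q) where
  open FixedPoints q q! public

  -- Cofactors involve pairs of rows in cyclic order only; equal rows and the reversed order are
  -- supplied here.
  minors : ∀ N → (∀ i k → Z (cof N i k)) → ∀ i r → Proportional (N i) (N r)
  minors N z i r = cyclic-cases (λ r → Proportional (N i) (N r)) i self next prev r
    where
    self : Proportional (N i) (N i)
    self a b = Z₁ 0ℤ Z-0 (identity (N i a) (N i b))
      where
      identity : ∀ s t → s · t ⊖ t · s ≡ 0ℤ · 0ℤ
      identity = solveℤ
    next : Proportional (N i) (N (nx i))
    next = cross⇒proportional {N i} {N (nx i)} λ j → subst Z (cong₂ (λ c d → cross (N c) (N d) j) (nx-ny i) (ny-ny i)) (z (ny i) j)
    prev : Proportional (N i) (N (ny i))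
    prev a b = Z₁ ℤ.-1ℤ (cross⇒proportional {N (ny i)} {N i} (λ j → subst Z (cong₂ (λ c d → cross (N c) (N d) j) (nx-nx i) (ny-nx i)) (z (nx i) j)) a b)
      (identity (N i a) (N i b) (N (ny i) a) (N (ny i) b))
      where
      identity : ∀ s t u v → s · v ⊖ t · u ≡ ℤ.-1ℤ · (u · t ⊖ v · s)
      identity = solveℤ

  -- In rank at most one, `N i m · N r j ≡ N i j · N r m`. If `N i j` vanishes while some `N i m` in
  -- its row does not, every `N r j` must vanish.
  zero-row-or-column : ∀ N → (∀ i k → Z (cof N i k)) → ∀ i j → Z (N i j) → (∀ m → Z (N i m)) ⊎ (∀ r → Z (N r j))
  zero-row-or-column N z i j zij with Finₚ.all? (λ m → Z? (N i m))
  ... | yes zᵢ = inj₁ zᵢ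
  ... | no ¬zᵢ with m , ¬z ← Finₚ.¬∀⟶∃¬ 3 _ (λ m → Z? (N i m)) ¬zᵢ
    = inj₂ λ r → Z-cancelˡ (N i m) (N r j) ¬z (Z₂ (+ 1) (N r m) (minors N z i r m j) zij (identity (N i m) (N r j) (N i j) (N r m)))
    where
    identity : ∀ a b c d → a · b ≡ + 1 · (a · b ⊖ c · d) ⊕ d · c
    identity = solveℤ

  Entries : ℕ → Mat3 → Set
  Entries S g = ∀ i j → ∣ g i j ∣ ≤ S

  module _ (S : ℕ) (4S<q : 4 * S < q) where

    private
      2S<q : S + S < q
      2S<q = ℕₚ.≤-<-trans (subst (S + S ≤_) (double S) (ℕₚ.m≤m+n (S + S) (S + S))) 4S<q
        where
        double : ∀ S → S + S + (S + S) ≡ 4 * S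
        double = solveℕ

    entries-equal : ∀ {x y} → ∣ x ∣ ≤ S → ∣ y ∣ ≤ S → Z (x ⊖ y) → x ≡ y
    entries-equal x≤ y≤ z = Z-⊖⇒≡ z (ℕₚ.≤-<-trans (ℕₚ.+-mono-≤ x≤ y≤) 2S<q)

    entry-zero : ∀ {x} → ∣ x ∣ ≤ S → Z x → x ≡ 0ℤ
    entry-zero x≤ z = Z-small z (ℕₚ.≤-<-trans (ℕₚ.≤-trans x≤ (ℕₚ.m≤m+n S S)) 2S<q)

    -- p = ±1 is the diagonal entry of a row which is otherwise zero, (x y ; z w) the complementary block,
    -- and c, d the remaining entries of the column of p.
    Corner : ℤ × ℤ × ℤ × ℤ × ℤ × ℤ × ℤ → Set
    Corner (p , x , y , z , w , c , d) =
      ∣ p ∣ ≡ 1 × 1 ≤ S × (∣ x ∣ ≤ S × ∣ y ∣ ≤ S × ∣ z ∣ ≤ S × ∣ w ∣ ≤ S × ∣ c ∣ ≤ S × ∣ d ∣ ≤ S) ×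
      p · (x · w ⊖ y · z) ≡ 1ℤ × Z ((x ⊖ p) · (w ⊖ p) ⊖ y · z) × Z (y · d ⊖ (w ⊖ p) · c) × Z ((x ⊖ p) · d ⊖ z · c)

    private
      square : ∀ {p} → ∣ p ∣ ≡ 1 → p · p ≡ 1ℤ
      square {p} p≡ with ∣∣≡⇒± {p} p≡
      ... | inj₁ refl = refl
      ... | inj₂ refl = refl

      -- Multiplying the minor condition on the block by p and using p² = 1 gives 1 + p - x - w ≡ 0.
      -- The left side is at most 4S in absolute value, so 4S < q turns this into an equality.
      trace : ∀ t → Corner t → let (p , x , _ , _ , w , _) = t in w ≡ 1ℤ ⊕ p ⊖ x
      trace (p , x , y , z , w , _) (p≡ , 1≤S , (x≤ , _ , _ , w≤ , _) , det≡ , z₁ , _) = sym (ℤₚ.i-j≡0⇒i≡j (1ℤ ⊕ p ⊖ x) w (Z-small (subst Z (rearrange p x w)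
          (Z₁ p z₁ (trans (cong₂ (λ s t → s ⊕ t · (p ⊖ (x ⊕ w))) (sym det≡) (sym (square {p} p≡))) (identity p x y z w)))) bound))
        where
        identity : ∀ p x y z w → p · (x · w ⊖ y · z) ⊕ p · p · (p ⊖ (x ⊕ w)) ≡ p · ((x ⊖ p) · (w ⊖ p) ⊖ y · z)
        identity = solveℤ
        rearrange : ∀ p x w → 1ℤ ⊕ 1ℤ · (p ⊖ (x ⊕ w)) ≡ 1ℤ ⊕ p ⊖ x ⊖ w
        rearrange = solveℤ
        open ℕₚ.≤-Reasoning
        bound : ∣ 1ℤ ⊕ p ⊖ x ⊖ w ∣ < q
        bound = begin-strict
          ∣ 1ℤ ⊕ p ⊖ x ⊖ w ∣                 ≤⟨ ℤₚ.∣i-j∣≤∣i∣+∣j∣ (1ℤ ⊕ p ⊖ x) w ⟩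
          ∣ 1ℤ ⊕ p ⊖ x ∣ + ∣ w ∣             ≤⟨ ℕₚ.+-mono-≤ (ℤₚ.∣i-j∣≤∣i∣+∣j∣ (1ℤ ⊕ p) x) w≤ ⟩
          ∣ 1ℤ ⊕ p ∣ + ∣ x ∣ + S             ≤⟨ ℕₚ.+-monoˡ-≤ S (ℕₚ.+-mono-≤ (ℤₚ.∣i+j∣≤∣i∣+∣j∣ 1ℤ p) x≤) ⟩
          1 + ∣ p ∣ + S + S                  ≤⟨ ℕₚ.+-monoˡ-≤ S (ℕₚ.+-monoˡ-≤ S (ℕₚ.+-mono-≤ 1≤S (subst (_≤ S) (sym p≡) 1≤S))) ⟩
          S + S + S + S                      ≡⟨ quadruple S ⟩
          4 * S                              <⟨ 4S<q ⟩
          q                                  ∎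
          where
          quadruple : ∀ S → S + S + S + S ≡ 4 * S
          quadruple = solveℕ

      block : ∀ t → Corner t → let (p , x , y , z , w , _) = t in y · z ≡ x · w ⊖ p
      block (p , x , y , z , w , _) (p≡ , _ , _ , det≡ , _) = trans (identity p x y z w)
        (trans (cong₂ (λ s t → x · w ⊖ p · s ⊖ (1ℤ ⊖ t) · (x · w ⊖ y · z)) det≡ (square {p} p≡)) (simplify p x y z w))
        where
        identity : ∀ p x y z w → y · z ≡ x · w ⊖ p · (p · (x · w ⊖ y · z)) ⊖ (1ℤ ⊖ p · p) · (x · w ⊖ y · z)
        identity = solveℤ
        simplify : ∀ p x y z w → x · w ⊖ p · 1ℤ ⊖ (1ℤ ⊖ 1ℤ) · (x · w ⊖ y · z) ≡ x · w ⊖ p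
        simplify = solveℤ

      Code : ℤ × ℤ × ℤ × ℤ → Set
      Code (p , x , y , c) = ∣ p ∣ ≡ 1 × ∣ x ∣ ≤ S × ∣ y ∣ ≤ S × ∣ c ∣ ≤ S

    cornerBound : ℕ
    cornerBound = 2 * ((suc S + S) * ((suc S + S) * (suc S + S)))

    private
      bound-Code : Bound Code cornerBound
      bound-Code = bound-Σ ℤ._≟_ (bound-∣∣≡ 1) λ _ _ → bound-Σ ℤ._≟_ (bound-∣∣≤ S) λ _ _ → bound-Σ ℤ._≟_ (bound-∣∣≤ S) λ _ _ → bound-∣∣≤ S

      cancel-Z : ∀ y d d′ e → y ≢ 0ℤ → ∣ y ∣ ≤ S → ∣ d ∣ ≤ S → ∣ d′ ∣ ≤ S → Z (y · d ⊖ e) → Z (y · d′ ⊖ e) → d ≡ d′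
      cancel-Z y d d′ e y≢0 y≤ d≤ d′≤ z z′ = entries-equal d≤ d′≤
        (Z-cancelˡ y (d ⊖ d′) (λ zy → y≢0 (entry-zero y≤ zy)) (Z₂ (+ 1) ℤ.-1ℤ z z′ (identity y d d′ e)))
        where
        identity : ∀ y d d′ e → y · (d ⊖ d′) ≡ + 1 · (y · d ⊖ e) ⊕ ℤ.-1ℤ · (y · d′ ⊖ e)
        identity = solveℤ

      flip-Z : ∀ a b → Z (a ⊖ b) → Z (b ⊖ a)
      flip-Z a b z = Z₁ ℤ.-1ℤ z (identity a b)
        where
        identity : ∀ a b → b ⊖ a ≡ ℤ.-1ℤ · (a ⊖ b)
        identity = solveℤ

      cancel-≡ : ∀ y z z′ → y ≢ 0ℤ → y · z ≡ y · z′ → z ≡ z′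
      cancel-≡ y z z′ y≢0 e = ℤₚ.*-cancelˡ-≡ y z z′ {{ℤ.≢-nonZero y≢0}} e

      upper : ∀ p x y c z z′ w w′ d d′ → y ≢ 0ℤ → Corner (p , x , y , z , w , c , d) → Corner (p , x , y , z′ , w′ , c , d′) →
              (z , w , d) ≡ (z′ , w′ , d′)
      upper p x y c z z′ w w′ d d′ y≢0 k@(_ , _ , (_ , y≤ , _ , _ , _ , d≤) , _ , _ , e , _) k′@(_ , _ , (_ , _ , _ , _ , _ , d′≤) , _ , _ , e′ , _) =
        cong₂ _,_ z≡ (cong₂ _,_ w≡ (cancel-Z y d d′ ((w ⊖ p) · c) y≢0 y≤ d≤ d′≤ e (subst (λ w → Z (y · d′ ⊖ (w ⊖ p) · c)) (sym w≡) e′)))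
        where
        w≡ : w ≡ w′
        w≡ = trans (trace (p , x , y , z , w , c , d) k) (sym (trace (p , x , y , z′ , w′ , c , d′) k′))
        z≡ : z ≡ z′
        z≡ = cancel-≡ y z z′ y≢0 (trans (block (p , x , y , z , w , c , d) k) (trans (cong (λ w → x · w ⊖ p) w≡) (sym (block (p , x , y , z′ , w′ , c , d′) k′))))

      lower : ∀ p x z d y y′ w w′ c c′ → z ≢ 0ℤ → Corner (p , x , y , z , w , c , d) → Corner (p , x , y′ , z , w′ , c′ , d) →
              (y , w , c) ≡ (y′ , w′ , c′)
      lower p x z d y y′ w w′ c c′ z≢0 k@(_ , _ , (_ , _ , z≤ , _ , c≤ , _) , _ , _ , _ , e) k′@(_ , _ , (_ , _ , _ , _ , c′≤ , _) , _ , _ , _ , e′) =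
        cong₂ _,_ y≡ (cong₂ _,_ w≡ (cancel-Z z c c′ ((x ⊖ p) · d) z≢0 z≤ c≤ c′≤ (flip-Z ((x ⊖ p) · d) (z · c) e) (flip-Z ((x ⊖ p) · d) (z · c′) e′)))
        where
        w≡ : w ≡ w′
        w≡ = trans (trace (p , x , y , z , w , c , d) k) (sym (trace (p , x , y′ , z , w′ , c′ , d) k′))
        y≡ : y ≡ y′
        y≡ = cancel-≡ z y y′ z≢0 (trans (ℤₚ.*-comm z y) (trans (block (p , x , y , z , w , c , d) k) (trans (cong (λ w → x · w ⊖ p) w≡) (trans (sym (block (p , x , y′ , z , w′ , c′ , d) k′)) (ℤₚ.*-comm y′ z)))))

      -- The trace gives w in every case. If y ≠ 0, the block determinant gives z and a minor gives
      -- d; if z ≠ 0, they give y and c in the same way; if y = z = 0, then c and d stay free. Each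
      -- case leaves a sign and three free entries.
      Upper Lower Diagonal : ℤ × ℤ × ℤ × ℤ × ℤ × ℤ × ℤ → Set
      Upper    t@(_ , _ , y , _)     = Corner t × y ≢ 0ℤ
      Lower    t@(_ , _ , _ , z , _) = Corner t × z ≢ 0ℤ
      Diagonal t@(_ , _ , y , z , _) = Corner t × y ≡ 0ℤ × z ≡ 0ℤ

      bound-Upper : Bound Upper cornerBound
      bound-Upper = bound-injective (λ (p , x , y , z , w , c , d) → p , x , y , c)
        (λ ((p≡ , _ , (x≤ , y≤ , _ , _ , c≤ , _) , _) , _) → p≡ , x≤ , y≤ , c≤)
        (λ { {p , x , y , z , w , c , d} {_ , _ , _ , z′ , w′ , _ , d′} (k , y≢0) (k′ , _) refl →
          cong (λ (z , w , d) → p , x , y , z , w , c , d) (upper p x y c z z′ w w′ d d′ y≢0 k k′) }) bound-Code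

      bound-Lower : Bound Lower cornerBound
      bound-Lower = bound-injective (λ (p , x , y , z , w , c , d) → p , x , z , d)
        (λ ((p≡ , _ , (x≤ , _ , z≤ , _ , _ , d≤) , _) , _) → p≡ , x≤ , z≤ , d≤)
        (λ { {p , x , y , z , w , c , d} {_ , _ , y′ , _ , w′ , c′ , _} (k , z≢0) (k′ , _) refl →
          cong (λ (y , w , c) → p , x , y , z , w , c , d) (lower p x z d y y′ w w′ c c′ z≢0 k k′) }) bound-Code

      bound-Diagonal : Bound Diagonal cornerBound
      bound-Diagonal = bound-injective (λ (p , x , y , z , w , c , d) → p , x , c , d)
        (λ ((p≡ , _ , (x≤ , _ , _ , _ , c≤ , d≤) , _) , _) → p≡ , x≤ , c≤ , d≤)
        (λ { {t@(p , x , y , z , w , c , d)} {t′} (k , y≡0 , z≡0) (k′ , y′≡0 , z′≡0) refl →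
          cong₂ (λ (y , z) w → p , x , y , z , w , c , d) (cong₂ _,_ (trans y≡0 (sym y′≡0)) (trans z≡0 (sym z′≡0)))
            (trans (trace t k) (sym (trace t′ k′))) }) bound-Code

      cases : ∀ t → Corner t → Upper t ⊎ Lower t ⊎ Diagonal t
      cases t@(_ , _ , y , z , _) k = go (y ℤ.≟ 0ℤ) (z ℤ.≟ 0ℤ)
        where
        go : Dec (y ≡ 0ℤ) → Dec (z ≡ 0ℤ) → Upper t ⊎ Lower t ⊎ Diagonal t
        go (no y≢0)  _         = inj₁ (k , y≢0)
        go (yes _)   (no z≢0)  = inj₂ (inj₁ (k , z≢0))
        go (yes y≡0) (yes z≡0) = inj₂ (inj₂ (k , y≡0 , z≡0))

    bound-Corner : Bound Corner (cornerBound + (cornerBound + cornerBound))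
    bound-Corner = bound-⊆ (λ {t} → cases t) (bound-⊎ bound-Upper (bound-⊎ bound-Lower bound-Diagonal))

    ZeroRow : Fin 3 → Mat3 → ℕ → Set
    ZeroRow i g l = Entries S g × det g ≡ 1ℤ × l < q × RankOne g (+ l) × (∀ m → Z (shift g (+ l) i m))

    corner : Fin 3 → Mat3 → ℤ × ℤ × ℤ × ℤ × ℤ × ℤ × ℤ
    corner i g = g i i , g j j , g j k , g k j , g k k , g j i , g k i
      where
      j = nx i
      k = ny i

    private
      zeros : ∀ i g l → ZeroRow i g l → g i (nx i) ≡ 0ℤ × g i (ny i) ≡ 0ℤ
      zeros i g l (g≤ , _ , _ , _ , z) =
        entry-zero (g≤ i (nx i)) (subst Z (shift-nx g (+ l) i) (z (nx i))) , entry-zero (g≤ i (ny i)) (subst Z (shift-ny g (+ l) i) (z (ny i)))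

      corner-det : ∀ i g l → ZeroRow i g l → g i i · cof g i i ≡ 1ℤ
      corner-det i g l zr@(_ , det≡1 , _) = trans (det-diagonal-row g i (proj₁ (zeros i g l zr)) (proj₂ (zeros i g l zr))) det≡1

      Z-diagonal : ∀ i g l → ZeroRow i g l → Z (g i i ⊖ + l)
      Z-diagonal i g l (_ , _ , _ , _ , z) = subst Z (shift-diagonal g (+ l) i) (z i)

      -- A row of `γ - l` that vanishes modulo q forces l ≡ p, so l can be replaced by the integer p
      -- in the minors; p divides the determinant 1, hence is 1 or -1.
      corner-valid : ∀ i g l → ZeroRow i g l → Corner (corner i g)
      corner-valid i g l zr@(g≤ , _ , _ , rank1 , _) =
        p≡ , subst (_≤ S) p≡ (g≤ i i) , (g≤ j j , g≤ j k , g≤ k j , g≤ k k , g≤ j i , g≤ k i) , corner-det i g l zr ,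
        Z₂ (+ 1) (⊝ (x ⊖ p ⊕ w ⊖ + l)) minor-jk zp (identity₁ p (+ l) x y z w) ,
        Z₂ (+ 1) c minor-ki zp (identity₂ p (+ l) y w c d) ,
        Z₂ (+ 1) (⊝ d) minor-ji zp (identity₃ p (+ l) x z c d)
        where
        j k : Fin 3
        j = nx i
        k = ny i
        p x y z w c d : ℤ
        p = g i i
        x = g j j
        y = g j k
        z = g k j
        w = g k k
        c = g j i
        d = g k i
        N : Mat3
        N = shift g (+ l)
        zp : Z (p ⊖ + l)
        zp = Z-diagonal i g l zr
        p≡ : ∣ p ∣ ≡ 1
        p≡ = ℕₚ.m*n≡1⇒m≡1 (∣ p ∣) (∣ cof g i i ∣) (trans (sym (ℤₚ.abs-* p (cof g i i))) (cong ∣_∣ (corner-det i g l zr)))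
        N-jk : N j k ≡ y
        N-jk = subst (λ m → N j m ≡ g j m) (nx-nx i) (shift-nx g (+ l) j)
        N-kj : N k j ≡ z
        N-kj = subst (λ m → N k m ≡ g k m) (ny-ny i) (shift-ny g (+ l) k)
        N-ji : N j i ≡ c
        N-ji = subst (λ m → N j m ≡ g j m) (ny-nx i) (shift-ny g (+ l) j)
        N-ki : N k i ≡ d
        N-ki = subst (λ m → N k m ≡ g k m) (nx-ny i) (shift-nx g (+ l) k)
        N-jj : N j j ≡ x ⊖ + l
        N-jj = shift-diagonal g (+ l) j
        N-kk : N k k ≡ w ⊖ + l
        N-kk = shift-diagonal g (+ l) k
        transport : ∀ {a b c d a′ b′ c′ d′ : ℤ} → a ≡ a′ → b ≡ b′ → c ≡ c′ → d ≡ d′ → Z (a · b ⊖ c · d) → Z (a′ · b′ ⊖ c′ · d′)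
        transport refl refl refl refl z = z
        minor-jk : Z ((x ⊖ + l) · (w ⊖ + l) ⊖ y · z)
        minor-jk = transport N-jj N-kk N-jk N-kj (minors N rank1 j k j k)
        minor-ki : Z (y · d ⊖ c · (w ⊖ + l))
        minor-ki = transport N-jk N-ki N-ji N-kk (minors N rank1 j k k i)
        minor-ji : Z ((x ⊖ + l) · d ⊖ c · z)
        minor-ji = transport N-jj N-ki N-ji N-kj (minors N rank1 j k j i)
        identity₁ : ∀ p l x y z w → (x ⊖ p) · (w ⊖ p) ⊖ y · z ≡ + 1 · ((x ⊖ l) · (w ⊖ l) ⊖ y · z) ⊕ (⊝ (x ⊖ p ⊕ w ⊖ l)) · (p ⊖ l)
        identity₁ = solveℤ
        identity₂ : ∀ p l y w c d → y · d ⊖ (w ⊖ p) · c ≡ + 1 · (y · d ⊖ c · (w ⊖ l)) ⊕ c · (p ⊖ l)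
        identity₂ = solveℤ
        identity₃ : ∀ p l x z c d → (x ⊖ p) · d ⊖ z · c ≡ + 1 · ((x ⊖ l) · d ⊖ c · z) ⊕ (⊝ d) · (p ⊖ l)
        identity₃ = solveℤ

      corner-injective : ∀ i g l g′ l′ → ZeroRow i g l → ZeroRow i g′ l′ → corner i g ≡ corner i g′ → (∀ a b → g a b ≡ g′ a b) × l ≡ l′
      corner-injective i g l g′ l′ zr zr′ e =
        (λ a → cyclic-cases (λ a → ∀ b → g a b ≡ g′ a b) i
          (cyclic-cases (λ b → g i b ≡ g′ i b) i p≡ (trans (proj₁ (zeros i g l zr)) (sym (proj₁ (zeros i g′ l′ zr′)))) (trans (proj₂ (zeros i g l zr)) (sym (proj₂ (zeros i g′ l′ zr′)))))
          (cyclic-cases (λ b → g (nx i) b ≡ g′ (nx i) b) i (cong (λ (_ , _ , _ , _ , _ , c , _) → c) e) (cong (λ (_ , x , _) → x) e) (cong (λ (_ , _ , y , _) → y) e))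
          (cyclic-cases (λ b → g (ny i) b ≡ g′ (ny i) b) i (cong (λ (_ , _ , _ , _ , _ , _ , d) → d) e) (cong (λ (_ , _ , _ , z , _) → z) e) (cong (λ (_ , _ , _ , _ , w , _) → w) e))
          a) ,
        Z-residue (proj₁ (proj₂ (proj₂ zr))) (proj₁ (proj₂ (proj₂ zr′)))
          (Z₂ (+ 1) ℤ.-1ℤ (Z-diagonal i g′ l′ zr′) (subst (λ p → Z (p ⊖ + l)) p≡ (Z-diagonal i g l zr)) (identity (g′ i i) (+ l) (+ l′)))
        where
        p≡ : g i i ≡ g′ i i
        p≡ = cong proj₁ e
        identity : ∀ p l l′ → l ⊖ l′ ≡ + 1 · (p ⊖ l′) ⊕ ℤ.-1ℤ · (p ⊖ l)
        identity = solveℤ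

    -- Taking h to be `⟦_⟧` or its transpose covers zero rows and zero columns by one count.
    bound-ZeroRow : ∀ i (h : Mat → Mat3) → (∀ {A B} → (∀ a b → h A a b ≡ h B a b) → A ≡ B) →
                    Bound (λ ((A , l) : Mat × ℕ) → ZeroRow i (h A) l) (cornerBound + (cornerBound + cornerBound))
    bound-ZeroRow i h h-inj = bound-injective (λ (A , l) → corner i (h A)) (λ { {A , l} zr → corner-valid i (h A) l zr })
      (λ { {A , l} {B , l′} zr zr′ e → let (h≡ , l≡) = corner-injective i (h A) l (h B) l′ zr zr′ e in cong₂ _,_ (h-inj h≡) l≡ }) bound-Corner

-- Rank one without zero rows or columns, and scalar matrices

module RankOneBound (q : ℕ) (q! : Prime q) (S R E : ℕ) (4S<q : 4 * S < q)
                    (divisors : ∀ n → 1 ≤ n → n ≤ S * S → Bound (_∣ⁿ n) E) where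
  open RankOneCount q q!

  private instance
    q-nonZero : NonZero q
    q-nonZero = prime⇒nonZero q!

  Reflection : Mat × ℕ → Set
  Reflection (A , l) = Small S R A × l < q × RankOne ⟦ A ⟧ (+ l)

  -- These are the factors of the two products f h and g c, which must be nonzero to have few
  -- divisors.
  Nondegenerate : Mat → Set
  Nondegenerate ((_ , _ , c) , (_ , _ , f) , (g , h , _)) = c ≢ 0ℤ × f ≢ 0ℤ × g ≢ 0ℤ × h ≢ 0ℤ

  lineBound : ℕ
  lineBound = cornerBound S 4S<q + (cornerBound S 4S<q + cornerBound S 4S<q)

  private
    cubic : ℤ → ℤ → ℤ → ℤ
    cubic l a b = l · l · l ⊕ (⊝ a) · l · l ⊕ (⊝ b) · l ⊕ 1ℤ

    -- The constant term 1 makes every root a unit modulo q.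
    cubic⇒¬Z : ∀ l a b → Z (cubic l a b) → ¬ Z l
    cubic⇒¬Z l a b z zl = ¬Z-1 (Z₂ (+ 1) (⊝ (l · l ⊕ (⊝ a) · l ⊕ (⊝ b))) z zl (identity l a b))
      where
      identity : ∀ l a b → 1ℤ ≡ + 1 · (l · l · l ⊕ (⊝ a) · l · l ⊕ (⊝ b) · l ⊕ 1ℤ) ⊕ (⊝ (l · l ⊕ (⊝ a) · l ⊕ (⊝ b))) · l
      identity = solveℤ

    -- For diagonal entries a, e, k the eigenvalues modulo q are l, l and a + e + k - 2l; vanishing
    -- says that their product is 1.
    traceRelation : ℤ → ℤ → ℤ → ℤ → ℤ
    traceRelation l a e k = l · l · (a ⊕ e ⊕ k ⊖ + 2 · l) ⊖ 1ℤ

    Factor : ℤ → ℤ → Set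
    Factor n f = n ≢ 0ℤ × ∣ n ∣ ≤ S * S × ∣ f ∣ ∣ⁿ ∣ n ∣

    bound-Factor : ∀ n → Bound (Factor n) (E * 2)
    bound-Factor n = bound-inhabited λ _ (n≢0 , n≤ , _) →
      bound-⊆ (λ {f} (_ , _ , f∣n) → ∣ f ∣ , f∣n , refl)
        (bound-∃ ℕₚ._≟_ (divisors ∣ n ∣ (ℕₚ.n≢0⇒n>0 (n≢0 ∘ ℤₚ.∣i∣≡0⇒i≡0)) n≤) λ d _ → bound-∣∣≡ d)

    D : ℕ
    D = 2 * R / q

    residueBound : ℕ
    residueBound = (suc D + D) * 1

    -- As l is invertible, the cubic fixes b modulo q but not as an integer, since R may exceed q.
    -- Differences from one solution are multiples m q with |m| ≤ 2R/q.
    bound-residue : ∀ l e → Bound (λ b → ∣ b ∣ ≤ R × Z (cubic l e b)) residueBound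
    bound-residue l e = bound-inhabited λ b₀ (b₀≤ , z₀) → bound-⊆ (λ {b} (b≤ , z) → multiple b₀ b b₀≤ z₀ b≤ z)
      (bound-∃ ℤ._≟_ (bound-∣∣≤ D) λ _ _ → bound-subsingleton λ p p′ → trans p (sym p′))
      where
      identity : ∀ l e b b₀ → l · (b ⊖ b₀) ≡ ℤ.-1ℤ · (l · l · l ⊕ (⊝ e) · l · l ⊕ (⊝ b) · l ⊕ 1ℤ) ⊕ + 1 · (l · l · l ⊕ (⊝ e) · l · l ⊕ (⊝ b₀) · l ⊕ 1ℤ)
      identity = solveℤ
      restore : ∀ b b₀ → b ≡ b₀ ⊕ (b ⊖ b₀)
      restore = solveℤ
      multiple : ∀ b₀ b → ∣ b₀ ∣ ≤ R → Z (cubic l e b₀) → ∣ b ∣ ≤ R → Z (cubic l e b) → ∃ λ m → ∣ m ∣ ≤ D × b ≡ b₀ ⊕ m · + q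
      multiple b₀ b b₀≤ z₀ b≤ z = go (Z-cancelˡ l (b ⊖ b₀) (cubic⇒¬Z l e b z) (Z₂ ℤ.-1ℤ (+ 1) z z₀ (identity l e b b₀)))
        where
        go : Z (b ⊖ b₀) → ∃ λ m → ∣ m ∣ ≤ D × b ≡ b₀ ⊕ m · + q
        go (ℤ∣.divides m eq) = m , *≤⇒≤/ q (ℕₚ.≤-trans (ℕₚ.≤-reflexive size) (ℕₚ.≤-trans (ℤₚ.∣i-j∣≤∣i∣+∣j∣ b b₀) (m≤n⇒m+m≤2*n b≤ b₀≤))) ,
          trans (restore b b₀) (cong (b₀ ⊕_) eq)
          where
          size : q * ∣ m ∣ ≡ ∣ b ⊖ b₀ ∣
          size = trans (ℕₚ.*-comm q ∣ m ∣) (trans (sym (ℤₚ.abs-* m (+ q))) (cong ∣_∣ (sym eq)))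

    bound-trace : ∀ l a e → ¬ Z l → Bound (λ k → ∣ k ∣ ≤ S × Z (traceRelation l a e k)) 1
    bound-trace l a e ¬zl = bound-subsingleton λ {k} {k′} (k≤ , z) (k′≤ , z′) → entries-equal S 4S<q k≤ k′≤
      (Z-cancelˡ l _ ¬zl (Z-cancelˡ l _ ¬zl (Z₂ (+ 1) ℤ.-1ℤ z z′ (identity l a e k k′))))
      where
      identity : ∀ l a e k k′ → l · (l · (k ⊖ k′)) ≡ + 1 · (l · l · (a ⊕ e ⊕ k ⊖ + 2 · l) ⊖ 1ℤ) ⊕ ℤ.-1ℤ · (l · l · (a ⊕ e ⊕ k′ ⊖ + 2 · l) ⊖ 1ℤ)
      identity = solveℤ

    -- b₁ and b₂ are the first two diagonal cofactors. The trace condition leaves one k, and the two factorisations are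
    -- f h = e k - b₁ and g c = k a - b₂; the entries b and d then follow from minors modulo q.
    Code : ℤ × ℤ × ℕ × ℤ × ℤ × ℤ × ℤ × ℤ → Set
    Code (a , b₁ , l , e , b₂ , k , f , c) =
      ∣ a ∣ ≤ S × ∣ b₁ ∣ ≤ R × (l < q × Z (cubic (+ l) a b₁)) × ∣ e ∣ ≤ S × (∣ b₂ ∣ ≤ R × Z (cubic (+ l) e b₂)) ×
      (∣ k ∣ ≤ S × Z (traceRelation (+ l) a e k)) × Factor (e · k ⊖ b₁) f × Factor (k · a ⊖ b₂) c

  codeBound : ℕ
  codeBound = (suc S + S) * ((suc R + R) * (3 * ((suc S + S) * ((suc (2 * R / q) + 2 * R / q) * 1 * (1 * (E * 2 * (E * 2)))))))

  private
    bound-Code : Bound Code codeBound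
    bound-Code =
      bound-Σ ℤ._≟_ (bound-∣∣≤ S) λ a _ →
      bound-Σ ℤ._≟_ (bound-∣∣≤ R) λ b₁ _ →
      bound-Σ ℕₚ._≟_ (bound-cubic (⊝ a) (⊝ b₁) 1ℤ) λ l (_ , z) →
      bound-Σ ℤ._≟_ (bound-∣∣≤ S) λ e _ →
      bound-Σ ℤ._≟_ (bound-residue (+ l) e) λ b₂ _ →
      bound-Σ ℤ._≟_ (bound-trace (+ l) a e (cubic⇒¬Z (+ l) a b₁ z)) λ k _ →
      bound-Σ ℤ._≟_ (bound-Factor (e · k ⊖ b₁)) λ f _ →
      bound-Factor (k · a ⊖ b₂)

    code : Mat × ℕ → ℤ × ℤ × ℕ × ℤ × ℤ × ℤ × ℤ × ℤ
    code (((a , b , c) , (d , e , f) , (g , h , k)) , l) = a , e · k ⊖ f · h , l , e , k · a ⊖ g · c , k , f , c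

    subtract : ∀ x u → x ⊖ (x ⊖ u) ≡ u
    subtract = solveℤ

    Z-det : ∀ A l → RankOne ⟦ A ⟧ l → Z (det (shift ⟦ A ⟧ l))
    Z-det A l rank1 = Z₃ (N i0 i0) (N i0 i1) (N i0 i2) (rank1 i0 i0) (rank1 i0 i1) (rank1 i0 i2) (det-expand N i0)
      where
      N : Mat3
      N = shift ⟦ A ⟧ l

    -- With eigenvalues l, l, m modulo q and l² m ≡ 1, the diagonal cofactor at i is l m + l² - l
    -- γᵢᵢ; multiplying by l gives the cubic. As an integer identity the cubic is the determinant of
    -- `γ - l` plus l times the two principal minors of `γ - l` at the other indices.
    cubic₀ : ∀ A l → det ⟦ A ⟧ ≡ 1ℤ → RankOne ⟦ A ⟧ l → Z (cubic l (⟦ A ⟧ i0 i0) (cof ⟦ A ⟧ i0 i0))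
    cubic₀ A@((a , b , c) , (d , e , f) , (g , h , k)) l det≡1 rank1 =
      subst (λ D → Z (l · l · l ⊕ (⊝ a) · l · l ⊕ (⊝ (e · k ⊖ f · h)) · l ⊕ D)) det≡1
        (Z₃ (+ 1) l l (Z-det A l rank1) (rank1 i1 i1) (rank1 i2 i2) (identity l a b c d e f g h k))
      where
      identity : ∀ l a b c d e f g h k →
        l · l · l ⊕ (⊝ a) · l · l ⊕ (⊝ (e · k ⊖ f · h)) · l ⊕ (a · (e · k ⊖ f · h) ⊖ b · (d · k ⊖ f · g) ⊕ c · (d · h ⊖ e · g)) ≡
        + 1 · ((a ⊖ l) · ((e ⊖ l) · (k ⊖ l) ⊖ f · h) ⊖ b · (d · (k ⊖ l) ⊖ f · g) ⊕ c · (d · h ⊖ (e ⊖ l) · g)) ⊕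
        l · ((k ⊖ l) · (a ⊖ l) ⊖ g · c) ⊕ l · ((a ⊖ l) · (e ⊖ l) ⊖ b · d)
      identity = solveℤ

    cubic₁ : ∀ A l → det ⟦ A ⟧ ≡ 1ℤ → RankOne ⟦ A ⟧ l → Z (cubic l (⟦ A ⟧ i1 i1) (cof ⟦ A ⟧ i1 i1))
    cubic₁ A@((a , b , c) , (d , e , f) , (g , h , k)) l det≡1 rank1 =
      subst (λ D → Z (l · l · l ⊕ (⊝ e) · l · l ⊕ (⊝ (k · a ⊖ g · c)) · l ⊕ D)) det≡1
        (Z₃ (+ 1) l l (Z-det A l rank1) (rank1 i0 i0) (rank1 i2 i2) (identity l a b c d e f g h k))
      where
      identity : ∀ l a b c d e f g h k →
        l · l · l ⊕ (⊝ e) · l · l ⊕ (⊝ (k · a ⊖ g · c)) · l ⊕ (a · (e · k ⊖ f · h) ⊖ b · (d · k ⊖ f · g) ⊕ c · (d · h ⊖ e · g)) ≡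
        + 1 · ((a ⊖ l) · ((e ⊖ l) · (k ⊖ l) ⊖ f · h) ⊖ b · (d · (k ⊖ l) ⊖ f · g) ⊕ c · (d · h ⊖ (e ⊖ l) · g)) ⊕
        l · ((e ⊖ l) · (k ⊖ l) ⊖ f · h) ⊕ l · ((a ⊖ l) · (e ⊖ l) ⊖ b · d)
      identity = solveℤ

    trace-relation : ∀ A l → det ⟦ A ⟧ ≡ 1ℤ → RankOne ⟦ A ⟧ l → Z (traceRelation l (⟦ A ⟧ i0 i0) (⟦ A ⟧ i1 i1) (⟦ A ⟧ i2 i2))
    trace-relation A@((a , b , c) , (d , e , f) , (g , h , k)) l det≡1 rank1 =
      subst (λ D → Z (l · l · (a ⊕ e ⊕ k ⊖ + 2 · l) ⊖ D)) det≡1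
        (Z₄ ℤ.-1ℤ (⊝ l) (⊝ l) (⊝ l) (Z-det A l rank1) (rank1 i0 i0) (rank1 i1 i1) (rank1 i2 i2) (identity l a b c d e f g h k))
      where
      identity : ∀ l a b c d e f g h k →
        l · l · (a ⊕ e ⊕ k ⊖ + 2 · l) ⊖ (a · (e · k ⊖ f · h) ⊖ b · (d · k ⊖ f · g) ⊕ c · (d · h ⊖ e · g)) ≡
        ℤ.-1ℤ · ((a ⊖ l) · ((e ⊖ l) · (k ⊖ l) ⊖ f · h) ⊖ b · (d · (k ⊖ l) ⊖ f · g) ⊕ c · (d · h ⊖ (e ⊖ l) · g)) ⊕
        (⊝ l) · ((e ⊖ l) · (k ⊖ l) ⊖ f · h) ⊕ (⊝ l) · ((k ⊖ l) · (a ⊖ l) ⊖ g · c) ⊕ (⊝ l) · ((a ⊖ l) · (e ⊖ l) ⊖ b · d)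
      identity = solveℤ

    factor : ∀ n f g h → n ≡ g · h → f ≡ g ⊎ f ≡ h → g ≢ 0ℤ → h ≢ 0ℤ → ∣ g ∣ ≤ S → ∣ h ∣ ≤ S → Factor n f
    factor _ f g h refl f≡ g≢0 h≢0 g≤ h≤ =
      (λ gh≡0 → [ g≢0 , h≢0 ]′ (ℤₚ.i*j≡0⇒i≡0∨j≡0 g gh≡0)) ,
      subst (_≤ S * S) (sym (ℤₚ.abs-* g h)) (ℕₚ.*-mono-≤ g≤ h≤) ,
      subst (∣ f ∣ ∣ⁿ_) (sym (ℤₚ.abs-* g h)) (side f≡)
      where
      side : f ≡ g ⊎ f ≡ h → ∣ f ∣ ∣ⁿ ∣ g ∣ * ∣ h ∣
      side (inj₁ refl) = ℕ∣.m∣m*n ∣ h ∣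
      side (inj₂ refl) = ℕ∣.n∣m*n ∣ g ∣

    code-valid : ∀ A l → Reflection (A , l) → Nondegenerate A → Code (code (A , l))
    code-valid A@((a , b , c) , (d , e , f) , (g , h , k)) l ((≤S , ≤R , det≡1) , l<q , rank1) (c≢0 , f≢0 , g≢0 , h≢0) =
      ≤S i0 i0 , ≤R i0 i0 , (l<q , cubic₀ A (+ l) det≡1 rank1) , ≤S i1 i1 , (≤R i1 i1 , cubic₁ A (+ l) det≡1 rank1) ,
      (≤S i2 i2 , trace-relation A (+ l) det≡1 rank1) ,
      factor (e · k ⊖ (e · k ⊖ f · h)) f f h (subtract (e · k) (f · h)) (inj₁ refl) f≢0 h≢0 (≤S i1 i2) (≤S i2 i1) ,
      factor (k · a ⊖ (k · a ⊖ g · c)) c g c (subtract (k · a) (g · c)) (inj₂ refl) g≢0 c≢0 (≤S i2 i0) (≤S i0 i2)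

    -- k - l is the pivot for recovering b and d. Were it 0 modulo q, the minor would give f h ≡ 0,
    -- which is impossible for nonzero f and h below q in size.
    ¬Z-corner : ∀ e f h k l → f ≢ 0ℤ → h ≢ 0ℤ → ∣ f ∣ ≤ S → ∣ h ∣ ≤ S → Z ((e ⊖ l) · (k ⊖ l) ⊖ f · h) → ¬ Z (k ⊖ l)
    ¬Z-corner e f h k l f≢0 h≢0 f≤ h≤ z zk =
      [ (λ zf → f≢0 (entry-zero S 4S<q f≤ zf)) , (λ zh → h≢0 (entry-zero S 4S<q h≤ zh)) ]′ (Z-euclid f h (Z₂ (e ⊖ l) ℤ.-1ℤ zk z (identity e f h k l)))
      where
      identity : ∀ e f h k l → f · h ≡ (e ⊖ l) · (k ⊖ l) ⊕ ℤ.-1ℤ · ((e ⊖ l) · (k ⊖ l) ⊖ f · h)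
      identity = solveℤ

    cancel-⊖ : ∀ x u v → x ⊖ u ≡ x ⊖ v → u ≡ v
    cancel-⊖ x u v e = trans (sym (subtract x u)) (trans (cong (x ⊖_) e) (subtract x v))

    cancel-γ : ∀ γ n b b′ → ¬ Z γ → ∣ b ∣ ≤ S → ∣ b′ ∣ ≤ S → Z (n ⊖ γ · b) → Z (n ⊖ γ · b′) → b ≡ b′
    cancel-γ γ n b b′ ¬zγ b≤ b′≤ z z′ = entries-equal S 4S<q b≤ b′≤ (Z-cancelˡ γ (b ⊖ b′) ¬zγ (Z₂ ℤ.-1ℤ (+ 1) z z′ (identity γ b b′ n)))
      where
      identity : ∀ γ b b′ n → γ · (b ⊖ b′) ≡ ℤ.-1ℤ · (n ⊖ γ · b) ⊕ + 1 · (n ⊖ γ · b′)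
      identity = solveℤ

    code-injective : ∀ a c e f k l b d g h b′ d′ g′ h′ →
      let A  = (a , b , c) , (d , e , f) , (g , h , k)
          A′ = (a , b′ , c) , (d′ , e , f) , (g′ , h′ , k) in
      Reflection (A , l) → Nondegenerate A → Reflection (A′ , l) → Nondegenerate A′ →
      e · k ⊖ f · h ≡ e · k ⊖ f · h′ → k · a ⊖ g · c ≡ k · a ⊖ g′ · c → A ≡ A′
    code-injective a c e f k l b d g h b′ d′ g′ h′ ((≤S , _) , _ , rank1) (c≢0 , f≢0 , _ , h≢0) ((≤S′ , _) , _ , rank1′) _ fh gc =
      assemble b≡ d≡ g≡ h≡
      where
      h≡ : h ≡ h′
      h≡ = ℤₚ.*-cancelˡ-≡ f h h′ {{ℤ.≢-nonZero f≢0}} (cancel-⊖ (e · k) (f · h) (f · h′) fh)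
      g≡ : g ≡ g′
      g≡ = ℤₚ.*-cancelʳ-≡ g g′ c {{ℤ.≢-nonZero c≢0}} (cancel-⊖ (k · a) (g · c) (g′ · c) gc)
      γ : ℤ
      γ = k ⊖ + l
      ¬zγ : ¬ Z γ
      ¬zγ = ¬Z-corner e f h k (+ l) f≢0 h≢0 (≤S i1 i2) (≤S i2 i1) (rank1 i0 i0)
      -- The minor at (1, 0) is h c - (k - l) b and the one at (0, 1) is f g - d (k - l); the
      -- invertible k - l yields b and d modulo q, and their size does the rest.
      b≡ : b ≡ b′
      b≡ = cancel-γ γ (h · c) b b′ ¬zγ (≤S i0 i1) (≤S′ i0 i1) (rank1 i1 i0) (subst (λ h → Z (h · c ⊖ γ · b′)) (sym h≡) (rank1′ i1 i0))
      d≡ : d ≡ d′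
      d≡ = cancel-γ γ (f · g) d d′ ¬zγ (≤S i1 i0) (≤S′ i1 i0) (subst (λ m → Z (f · g ⊖ m)) (ℤₚ.*-comm d γ) (rank1 i0 i1))
        (subst (λ m → Z (f · g ⊖ m)) (ℤₚ.*-comm d′ γ) (subst (λ g → Z (f · g ⊖ d′ · γ)) (sym g≡) (rank1′ i0 i1)))
      assemble : b ≡ b′ → d ≡ d′ → g ≡ g′ → h ≡ h′ → ((a , b , c) , (d , e , f) , (g , h , k)) ≡ ((a , b′ , c) , (d′ , e , f) , (g′ , h′ , k))
      assemble refl refl refl refl = refl

    NondegenerateReflection : Mat × ℕ → Set
    NondegenerateReflection (A , l) = Reflection (A , l) × Nondegenerate A

    bound-Nondegenerate : Bound NondegenerateReflection codeBound
    bound-Nondegenerate = bound-injective code (λ { {A , l} (r , n) → code-valid A l r n })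
      (λ { {((a , b , c) , (d , e , f) , (g , h , k)) , l} {((a′ , b′ , c′) , (d′ , e′ , f′) , (g′ , h′ , k′)) , l′} (r , n) (r′ , n′) eq →
        match a a′ b b′ c c′ d d′ e e′ f f′ g g′ h h′ k k′ l l′ r n r′ n′
          (cong (λ (a , _) → a) eq) (cong (λ (_ , _ , l , _) → l) eq) (cong (λ (_ , _ , _ , e , _) → e) eq)
          (cong (λ (_ , _ , _ , _ , _ , k , _) → k) eq) (cong (λ (_ , _ , _ , _ , _ , _ , f , _) → f) eq) (cong (λ (_ , _ , _ , _ , _ , _ , _ , c) → c) eq)
          (cong (λ (_ , b₁ , _) → b₁) eq) (cong (λ (_ , _ , _ , _ , b₂ , _) → b₂) eq) }) bound-Code
      where
      match : ∀ a a′ b b′ c c′ d d′ e e′ f f′ g g′ h h′ k k′ l l′ →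
        let A  = (a , b , c) , (d , e , f) , (g , h , k)
            A′ = (a′ , b′ , c′) , (d′ , e′ , f′) , (g′ , h′ , k′) in
        Reflection (A , l) → Nondegenerate A → Reflection (A′ , l′) → Nondegenerate A′ →
        a ≡ a′ → l ≡ l′ → e ≡ e′ → k ≡ k′ → f ≡ f′ → c ≡ c′ → e · k ⊖ f · h ≡ e′ · k′ ⊖ f′ · h′ → k · a ⊖ g · c ≡ k′ · a′ ⊖ g′ · c′ →
        (A , l) ≡ (A′ , l′)
      match a _ b b′ c _ d d′ e _ f _ g g′ h h′ k _ l _ r n r′ n′ refl refl refl refl refl refl fh gc =
        cong (_, l) (code-injective a c e f k l b d g h b′ d′ g′ h′ r n r′ n′ fh gc)

    RowDegenerate ColumnDegenerate : Mat × ℕ → Set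
    RowDegenerate    (A , l) = ∃ λ i → ⊤ × ZeroRow S 4S<q i ⟦ A ⟧ l
    ColumnDegenerate (A , l) = ∃ λ i → ⊤ × ZeroRow S 4S<q i (⟦ A ⟧ ᵀ) l

    classify : ∀ p → Reflection p → NondegenerateReflection p ⊎ RowDegenerate p ⊎ ColumnDegenerate p
    classify (A@((_ , _ , c) , (_ , _ , f) , (g , h , _)) , l) r@((≤S , _ , det≡1) , l<q , rank1) =
      go (c ℤ.≟ 0ℤ) (f ℤ.≟ 0ℤ) (g ℤ.≟ 0ℤ) (h ℤ.≟ 0ℤ)
      where
      N : Mat3
      N = shift ⟦ A ⟧ (+ l)
      degenerate : ∀ i j → Z (N i j) → RowDegenerate (A , l) ⊎ ColumnDegenerate (A , l)
      degenerate i j z = choose (zero-row-or-column N rank1 i j z)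
        where
        choose : (∀ m → Z (N i m)) ⊎ (∀ r → Z (N r j)) → RowDegenerate (A , l) ⊎ ColumnDegenerate (A , l)
        choose (inj₁ row)    = inj₁ (i , tt , ≤S , det≡1 , l<q , rank1 , row)
        choose (inj₂ column) = inj₂ (j , tt , (λ a b → ≤S b a) , trans (det-ᵀ ⟦ A ⟧) det≡1 , l<q ,
          (λ a b → subst Z (sym (trans (cof-cong (shift-ᵀ ⟦ A ⟧ (+ l)) a b) (cof-ᵀ N a b))) (rank1 b a)) ,
          (λ m → subst Z (sym (shift-ᵀ ⟦ A ⟧ (+ l) j m)) (column m)))
      Z-≡0 : ∀ {x} → x ≡ 0ℤ → Z x
      Z-≡0 refl = Z-0
      go : Dec (c ≡ 0ℤ) → Dec (f ≡ 0ℤ) → Dec (g ≡ 0ℤ) → Dec (h ≡ 0ℤ) → _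
      go (yes c≡0) _         _         _         = inj₂ (degenerate i0 i2 (Z-≡0 c≡0))
      go (no _)    (yes f≡0) _         _         = inj₂ (degenerate i1 i2 (Z-≡0 f≡0))
      go (no _)    (no _)    (yes g≡0) _         = inj₂ (degenerate i2 i0 (Z-≡0 g≡0))
      go (no _)    (no _)    (no _)    (yes h≡0) = inj₂ (degenerate i2 i1 (Z-≡0 h≡0))
      go (no c≢0)  (no f≢0)  (no g≢0)  (no h≢0)  = inj₁ (r , c≢0 , f≢0 , g≢0 , h≢0)

  bound-Reflection : Bound Reflection (codeBound + (3 * lineBound + 3 * lineBound))
  bound-Reflection = bound-⊆ (λ {p} → classify p) (bound-⊎ bound-Nondegenerate (bound-⊎
    (bound-∃ Finₚ._≟_ bound-Fin3 λ i _ → bound-ZeroRow S 4S<q i ⟦_⟧ ⟦⟧-injective)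
    (bound-∃ Finₚ._≟_ bound-Fin3 λ i _ → bound-ZeroRow S 4S<q i (λ A → ⟦ A ⟧ ᵀ) (λ e → ⟦⟧-injective (λ a b → e b a)))))

  Homothety : Mat → Set
  Homothety A = Small S R A × (∃ λ l → l < q × Scalar ⟦ A ⟧ (+ l))

  bound-Homothety : Bound Homothety 27
  bound-Homothety = bound-injective (λ A → ⟦ A ⟧ i0 i0 , ⟦ A ⟧ i1 i1 , ⟦ A ⟧ i2 i2) (λ {A} h → unit A h i0 , unit A h i1 , unit A h i2)
    (λ {A} {B} h h′ e → ⟦⟧-injective λ i → cyclic-cases (λ j → ⟦ A ⟧ i j ≡ ⟦ B ⟧ i j) i
      (cyclic-cases (λ i → ⟦ A ⟧ i i ≡ ⟦ B ⟧ i i) i0 (cong proj₁ e) (cong (proj₁ ∘ proj₂) e) (cong (proj₂ ∘ proj₂) e) i)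
      (trans (off-nx A h i) (sym (off-nx B h′ i))) (trans (off-ny A h i) (sym (off-ny B h′ i))))
    (bound-Σ ℤ._≟_ (bound-∣∣≤ 1) λ _ _ → bound-Σ ℤ._≟_ (bound-∣∣≤ 1) λ _ _ → bound-∣∣≤ 1)
    where
    off-nx : ∀ A → Homothety A → ∀ i → ⟦ A ⟧ i (nx i) ≡ 0ℤ
    off-nx A ((≤S , _) , l , _ , scalar) i = entry-zero S 4S<q (≤S i (nx i)) (subst Z (shift-nx ⟦ A ⟧ (+ l) i) (scalar i (nx i)))
    off-ny : ∀ A → Homothety A → ∀ i → ⟦ A ⟧ i (ny i) ≡ 0ℤ
    off-ny A ((≤S , _) , l , _ , scalar) i = entry-zero S 4S<q (≤S i (ny i)) (subst Z (shift-ny ⟦ A ⟧ (+ l) i) (scalar i (ny i)))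
    unit : ∀ A → Homothety A → ∀ i → ∣ ⟦ A ⟧ i i ∣ ≤ 1
    unit A h@((_ , _ , det≡1) , _) i = ℕₚ.≤-reflexive (ℕₚ.m*n≡1⇒m≡1 (∣ ⟦ A ⟧ i i ∣) (∣ cof ⟦ A ⟧ i i ∣)
      (trans (sym (ℤₚ.abs-* (⟦ A ⟧ i i) (cof ⟦ A ⟧ i i))) (cong ∣_∣ (trans (det-diagonal-row ⟦ A ⟧ i (off-nx A h i) (off-ny A h i)) det≡1))))

-- Constants and the total for one pair of sizes S, R

abstract
  -- The factors of `genericConstant` are those of `bound-Small` and 3 for the eigenvalues; 10692 =
  -- 3 (1620 + 1944) belongs to rank one and 81 = 3 · 27 to the scalar matrices. Opacity keeps the
  -- products from being evaluated.
  genericConstant classConstant : ℕ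
  genericConstant = 3 * 3 * 3 * 6 * 18 * 18 * 25 * 3
  classConstant = genericConstant + (10692 + 81)

  class-collect : ∀ u → genericConstant * u + (10692 * u + 81 * u) ≡ classConstant * u
  class-collect = collect genericConstant 10692 81
    where
    collect : ∀ a b c u → a * u + (b * u + c * u) ≡ (a + (b + c)) * u
    collect = solveℕ

  generic-collect : ∀ S R → 3 * (3 * (3 * (S * (6 * S * (18 * R * (18 * R)))) * 25)) * (3 * 1) ≡ genericConstant * (S * R * (S * R))
  generic-collect = collect 3 6 18 25
    where
    collect : ∀ a b c d S R → a * (a * (a * (S * (b * S * (c * R * (c * R)))) * d)) * (a * 1) ≡ a * a * a * b * c * c * d * a * (S * R * (S * R))
    collect = solveℕ

module ClassBound (q : ℕ) (q! : Prime q) (S R E : ℕ) (1≤S : 1 ≤ S) (1≤R : 1 ≤ R) (1≤E : 1 ≤ E) (S≤2R : S ≤ 2 * R)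
                  (4S<q : 4 * S < q) (SR≤q² : S * R ≤ q * q)
                  (divisors : ∀ n → 1 ≤ n → n ≤ S * S → Bound (_∣ⁿ n) E) where
  open FixedPoints q q! using (Fixed; Projective; Point; bound-FixedPair)
  open RankOneBound q q! S R E 4S<q divisors

  private
    instance
      q-nonZero : NonZero q
      q-nonZero = prime⇒nonZero q!

    D : ℕ
    D = 2 * R / q

    unit : ℕ
    unit = S * R * (q * q) * (E * E)

    odd≤ : ∀ {n} → 1 ≤ n → suc n + n ≤ 3 * n
    odd≤ {n} 1≤n = ℕₚ.≤-trans (ℕₚ.+-monoˡ-≤ n (ℕₚ.+-monoˡ-≤ n 1≤n)) (ℕₚ.≤-reflexive (triple n))
      where
      triple : ∀ n → n + n + n ≡ 3 * n
      triple = solveℕ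

    S≤q : S ≤ q
    S≤q = ℕₚ.≤-trans (ℕₚ.m≤m+n S (3 * S)) (ℕₚ.<⇒≤ 4S<q)

    1≤EE : 1 ≤ E * E
    1≤EE = ℕₚ.*-mono-≤ 1≤E 1≤E

    1≤SR : 1 ≤ S * R
    1≤SR = ℕₚ.*-mono-≤ 1≤S 1≤R

    m≤m*EE : ∀ m → m ≤ m * (E * E)
    m≤m*EE m = ℕₚ.m≤m*n m (E * E) {{ℕ.>-nonZero 1≤EE}}

    -- The residue count `D` is large when R exceeds q, but paired with a factor S it is controlled
    -- by S R ≤ q².
    SD≤2q : S * D ≤ 2 * q
    SD≤2q = ℕₚ.*-cancelʳ-≤ (S * D) (2 * q) q (begin
      S * D * q            ≡⟨ ℕₚ.*-assoc S D q ⟩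
      S * (D * q)          ≤⟨ ℕₚ.*-monoʳ-≤ S (m/n*n≤m (2 * R) q) ⟩
      S * (2 * R)          ≡⟨ double S R ⟩
      2 * (S * R)          ≤⟨ ℕₚ.*-monoʳ-≤ 2 SR≤q² ⟩
      2 * (q * q)          ≡⟨ ℕₚ.*-assoc 2 q q ⟨
      2 * q * q            ∎)
      where
      open ℕₚ.≤-Reasoning
      double : ∀ S R → S * (2 * R) ≡ 2 * (S * R)
      double = solveℕ

    generic≤ : 3 * (3 * (3 * (S * (6 * S * (18 * R * (18 * R)))) * 25)) * (3 * 1) ≤ genericConstant * unit
    generic≤ = subst (_≤ genericConstant * unit) (sym (generic-collect S R))
      (ℕₚ.*-monoʳ-≤ genericConstant (ℕₚ.≤-trans (ℕₚ.*-monoʳ-≤ (S * R) SR≤q²) (m≤m*EE (S * R * (q * q)))))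

    code≤ : codeBound ≤ 1620 * (S * R * q * (E * E))
    code≤ = begin
      codeBound                                                     ≡⟨ regroup (suc S + S) (suc R + R) (suc D + D) E ⟩
      12 * (suc S + S) * (suc R + R) * ((suc S + S) * (suc D + D)) * (E * E)
        ≤⟨ ℕₚ.*-monoˡ-≤ (E * E) (ℕₚ.*-mono-≤ (ℕₚ.*-mono-≤ (ℕₚ.*-monoʳ-≤ 12 (odd≤ 1≤S)) (odd≤ 1≤R)) (ℕₚ.*-monoˡ-≤ (suc D + D) (odd≤ 1≤S))) ⟩
      12 * (3 * S) * (3 * R) * (3 * S * (suc D + D)) * (E * E)      ≡⟨ expand S R D E ⟩
      108 * (S * R) * (3 * S + 6 * (S * D)) * (E * E)
        ≤⟨ ℕₚ.*-monoˡ-≤ (E * E) (ℕₚ.*-monoʳ-≤ (108 * (S * R)) (ℕₚ.+-mono-≤ (ℕₚ.*-monoʳ-≤ 3 S≤q) (ℕₚ.*-monoʳ-≤ 6 SD≤2q))) ⟩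
      108 * (S * R) * (3 * q + 6 * (2 * q)) * (E * E)               ≡⟨ collect (S * R) q E ⟩
      1620 * (S * R * q * (E * E))                                  ∎
      where
      open ℕₚ.≤-Reasoning
      regroup : ∀ s r d E → s * (r * (3 * (s * (d * 1 * (1 * (E * 2 * (E * 2))))))) ≡ 12 * s * r * (s * d) * (E * E)
      regroup = solveℕ
      expand : ∀ S R D E → 12 * (3 * S) * (3 * R) * (3 * S * (suc D + D)) * (E * E) ≡ 108 * (S * R) * (3 * S + 6 * (S * D)) * (E * E)
      expand = solveℕ
      collect : ∀ n q E → 108 * n * (3 * q + 6 * (2 * q)) * (E * E) ≡ 1620 * (n * q * (E * E))
      collect = solveℕ

    -- The S³ of the degenerate matrices fits into S R q since one factor S is at most 2R and
    -- another at most q.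
    line≤ : 3 * lineBound + 3 * lineBound ≤ 1944 * (S * R * q * (E * E))
    line≤ = begin
      3 * lineBound + 3 * lineBound                ≡⟨ regroup (suc S + S) ⟩
      36 * ((suc S + S) * ((suc S + S) * (suc S + S)))
        ≤⟨ ℕₚ.*-monoʳ-≤ 36 (ℕₚ.*-mono-≤ (odd≤ 1≤S) (ℕₚ.*-mono-≤ (odd≤ 1≤S) (odd≤ 1≤S))) ⟩
      36 * (3 * S * (3 * S * (3 * S)))             ≤⟨ ℕₚ.*-monoʳ-≤ 36 (ℕₚ.*-monoʳ-≤ (3 * S) (ℕₚ.*-mono-≤ (ℕₚ.*-monoʳ-≤ 3 S≤2R) (ℕₚ.*-monoʳ-≤ 3 S≤q))) ⟩
      36 * (3 * S * (3 * (2 * R) * (3 * q)))       ≡⟨ collect S R q ⟩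
      1944 * (S * R * q)                           ≤⟨ ℕₚ.*-monoʳ-≤ 1944 (m≤m*EE (S * R * q)) ⟩
      1944 * (S * R * q * (E * E))                 ∎
      where
      open ℕₚ.≤-Reasoning
      regroup : ∀ s → 3 * (2 * (s * (s * s)) + (2 * (s * (s * s)) + 2 * (s * (s * s)))) + 3 * (2 * (s * (s * s)) + (2 * (s * (s * s)) + 2 * (s * (s * s)))) ≡ 36 * (s * (s * s))
      regroup = solveℕ
      collect : ∀ S R q → 36 * (3 * S * (3 * (2 * R) * (3 * q))) ≡ 1944 * (S * R * q)
      collect = solveℕ

    reflection≤ : (codeBound + (3 * lineBound + 3 * lineBound)) * (3 * q) ≤ 10692 * unit
    reflection≤ = begin
      (codeBound + (3 * lineBound + 3 * lineBound)) * (3 * q)                            ≤⟨ ℕₚ.*-monoˡ-≤ (3 * q) (ℕₚ.+-mono-≤ code≤ line≤) ⟩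
      (1620 * (S * R * q * (E * E)) + 1944 * (S * R * q * (E * E))) * (3 * q)            ≡⟨ collect (S * R) q (E * E) ⟩
      10692 * unit                                                                       ∎
      where
      open ℕₚ.≤-Reasoning
      collect : ∀ n q e → (1620 * (n * q * e) + 1944 * (n * q * e)) * (3 * q) ≡ 10692 * (n * (q * q) * e)
      collect = solveℕ

    homothety≤ : 27 * (3 * (q * q)) ≤ 81 * unit
    homothety≤ = begin
      27 * (3 * (q * q))      ≡⟨ ℕₚ.*-assoc 27 3 (q * q) ⟨
      81 * (q * q)            ≤⟨ ℕₚ.*-monoʳ-≤ 81 (ℕₚ.≤-trans (ℕₚ.m≤n*m (q * q) (S * R) {{ℕ.>-nonZero 1≤SR}}) (m≤m*EE (S * R * (q * q)))) ⟩
      81 * unit               ∎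
      where open ℕₚ.≤-Reasoning

  bound-class : Bound (λ ((A , x) : Mat × Point) → Small S R A × (∃ λ l → l < q × Fixed ⟦ A ⟧ (+ l) x)) (classConstant * (S * R * (q * q) * (E * E)))
  bound-class = bound-≤ total (bound-FixedPair (Small S R) (bound-Small S R S≤2R) bound-Reflection bound-Homothety)
    where
    total : 3 * (3 * (3 * (S * (6 * S * (18 * R * (18 * R)))) * 25)) * (3 * 1) +
            ((codeBound + (3 * lineBound + 3 * lineBound)) * (3 * q) + 27 * (3 * (q * q))) ≤ classConstant * unit
    total = ℕₚ.≤-trans (ℕₚ.+-mono-≤ generic≤ (ℕₚ.+-mono-≤ reflection≤ homothety≤)) (ℕₚ.≤-reflexive (class-collect unit))

-- Inverses and dyadic scales

≤-max₃ : ∀ (f : Fin 3 → ℕ) i → f i ≤ f i0 ⊔ f i1 ⊔ f i2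
≤-max₃ f zero             = ℕₚ.≤-trans (ℕₚ.m≤m⊔n (f i0) (f i1)) (ℕₚ.m≤m⊔n (f i0 ⊔ f i1) (f i2))
≤-max₃ f (suc zero)       = ℕₚ.≤-trans (ℕₚ.m≤n⊔m (f i0) (f i1)) (ℕₚ.m≤m⊔n (f i0 ⊔ f i1) (f i2))
≤-max₃ f (suc (suc zero)) = ℕₚ.m≤n⊔m (f i0 ⊔ f i1) (f i2)

entry≤normInf : ∀ g i j → ∣ g i j ∣ ≤ normInf g
entry≤normInf g i j = ℕₚ.≤-trans (≤-max₃ (λ j → ∣ g i j ∣) j) (≤-max₃ (λ i → ∣ g i i0 ∣ ⊔ ∣ g i i1 ∣ ⊔ ∣ g i i2 ∣) i)

normInf-cong : ∀ {g h} → (∀ i j → g i j ≡ h i j) → normInf g ≡ normInf h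
normInf-cong {g} {h} e = cong₂ _⊔_ (cong₂ _⊔_ (row i0) (row i1)) (row i2)
  where
  row : ∀ i → ∣ g i i0 ∣ ⊔ ∣ g i i1 ∣ ⊔ ∣ g i i2 ∣ ≡ ∣ h i i0 ∣ ⊔ ∣ h i i1 ∣ ⊔ ∣ h i i2 ∣
  row i = cong₂ _⊔_ (cong₂ _⊔_ (cong ∣_∣ (e i i0)) (cong ∣_∣ (e i i1))) (cong ∣_∣ (e i i2))

dot-cong : ∀ u u′ v → (∀ j → u j ≡ u′ j) → dot u v ≡ dot u′ v
dot-cong u u′ v e = cong₂ _⊕_ (cong₂ _⊕_ (cong (_· v i0) (e i0)) (cong (_· v i1) (e i1))) (cong (_· v i2) (e i2))

1≤normInf : ∀ g → det g ≡ 1ℤ → 1 ≤ normInf g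
1≤normInf g det≡1 = ℕₚ.n≢0⇒n>0 λ norm≡0 → absurd (trans (sym det≡1) (trans (det-expand g i0) (dot-cong (g i0) (λ _ → 0ℤ) (cof g i0) λ j →
  ℤₚ.∣i∣≡0⇒i≡0 (ℕₚ.n≤0⇒n≡0 (subst (∣ g i0 j ∣ ≤_) norm≡0 (entry≤normInf g i0 j))))))
  where
  absurd : 1ℤ ≢ 0ℤ
  absurd ()

power-of-two : ∀ n → 1 ≤ n → ∃ λ k → 2 ^ k ≤ n × n < 2 * 2 ^ k
power-of-two (suc zero)      _ = 0 , s≤s z≤n , s≤s (s≤s z≤n)
power-of-two (suc n@(suc _)) _ = go (power-of-two n (s≤s z≤n))
  where
  go : (∃ λ k → 2 ^ k ≤ n × n < 2 * 2 ^ k) → ∃ λ k → 2 ^ k ≤ suc n × suc n < 2 * 2 ^ k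
  go (k , lo , hi) with suc n ℕₚ.<? 2 * 2 ^ k
  ... | yes hi′ = k , ℕₚ.m≤n⇒m≤1+n lo , hi′
  ... | no ¬hi′ = suc k , ℕₚ.≮⇒≥ ¬hi′ , subst (suc n <_) (ℕₚ.*-comm (2 * 2 ^ k) 2) (ℕₚ.≤-<-trans hi (ℕₚ.m<m*n (2 * 2 ^ k) 2 {{ℕ.>-nonZero (ℕₚ.≤-trans (s≤s z≤n) hi)}} (s≤s (s≤s z≤n))))

inverse : Mat → Mat
inverse A = fromMat3 (inv ⟦ A ⟧)

cof-inv : ∀ g → det g ≡ 1ℤ → ∀ i j → cof (inv g) j i ≡ g i j
cof-inv g det≡1 i j = trans (cof-ᵀ (cof g) j i) (trans (cof-cof g i j) (trans (cong (_· g i j) det≡1) (ℤₚ.*-identityˡ (g i j))))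

det-inv : ∀ g → det g ≡ 1ℤ → det (inv g) ≡ 1ℤ
det-inv g det≡1 = trans (det-ᵀ (cof g)) (det-cof g det≡1)

det-inverse : ∀ A → det ⟦ A ⟧ ≡ 1ℤ → det ⟦ inverse A ⟧ ≡ 1ℤ
det-inverse A det≡1 = trans (det-cong (⟦⟧-fromMat3 (inv ⟦ A ⟧))) (det-inv ⟦ A ⟧ det≡1)

inv-inverse : ∀ A → det ⟦ A ⟧ ≡ 1ℤ → ∀ i j → inv ⟦ inverse A ⟧ i j ≡ ⟦ A ⟧ i j
inv-inverse A det≡1 i j = trans (cof-cong (⟦⟧-fromMat3 (inv ⟦ A ⟧)) j i) (cof-inv ⟦ A ⟧ det≡1 i j)

inverse-injective : ∀ A B → det ⟦ A ⟧ ≡ 1ℤ → det ⟦ B ⟧ ≡ 1ℤ → inverse A ≡ inverse B → A ≡ B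
inverse-injective A B a b e = ⟦⟧-injective λ i j → trans (sym (inv-inverse A a i j)) (trans (cong (λ C → inv ⟦ C ⟧ i j) e) (inv-inverse B b i j))

dot-shift : ∀ g l x i → dot (shift g l i) x ≡ dot (g i) x ⊖ l · x i
dot-shift g l x = λ
  { zero             → identity₀ (g i0 i0) (g i0 i1) (g i0 i2) l (x i0) (x i1) (x i2)
  ; (suc zero)       → identity₁ (g i1 i0) (g i1 i1) (g i1 i2) l (x i0) (x i1) (x i2)
  ; (suc (suc zero)) → identity₂ (g i2 i0) (g i2 i1) (g i2 i2) l (x i0) (x i1) (x i2) }
  where
  identity₀ : ∀ a b c l x y z → (a ⊖ l) · x ⊕ b · y ⊕ c · z ≡ a · x ⊕ b · y ⊕ c · z ⊖ l · x
  identity₀ = solveℤ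
  identity₁ : ∀ a b c l x y z → a · x ⊕ (b ⊖ l) · y ⊕ c · z ≡ a · x ⊕ b · y ⊕ c · z ⊖ l · y
  identity₁ = solveℤ
  identity₂ : ∀ a b c l x y z → a · x ⊕ b · y ⊕ (c ⊖ l) · z ≡ a · x ⊕ b · y ⊕ c · z ⊖ l · z
  identity₂ = solveℤ

module FixedInverse (q : ℕ) (q! : Prime q) where
  open FixedPoints q q! public

  private instance
    q-nonZero : NonZero q
    q-nonZero = prime⇒nonZero q!

  -- The characteristic equation l (l² - tr(g) l + tr(g⁻¹)) ≡ 1 exhibits the eigenvalue of the inverse.
  eigenvalue-inverse : ∀ g l → det g ≡ 1ℤ → Z (det (shift g (+ l))) → ∃ λ l′ → l′ < q × Z (+ l · + l′ ⊖ 1ℤ)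
  eigenvalue-inverse g l det≡1 z = e %ℕ q , n%ℕd<d e q ,
    Z₂ (+ 1) (⊝ (+ l · (e /ℕ q))) (subst (λ d → Z (+ l · + l · + l ⊕ (⊝ tr g) · + l · + l ⊕ tr (cof g) · + l ⊕ (⊝ d))) det≡1 (Z₁ ℤ.-1ℤ z (det-shift g (+ l))))
      (∣ᵤ⇒∣ ℕ∣.∣-refl)
      (trans (cong (λ r → + l · r ⊖ 1ℤ) (subtract _ _ _ (a≡a%ℕn+[a/ℕn]*n e q))) (identity (+ l) (tr g) (tr (cof g)) (e /ℕ q) (+ q)))
    where
    e : ℤ
    e = + l · + l ⊕ (⊝ tr g) · + l ⊕ tr (cof g)
    subtract : ∀ x r s → x ≡ r ⊕ s → r ≡ x ⊖ s
    subtract _ r s refl = cancel r s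
      where
      cancel : ∀ r s → r ≡ r ⊕ s ⊖ s
      cancel = solveℤ
    identity : ∀ l t s m q → l · (l · l ⊕ (⊝ t) · l ⊕ s ⊖ m · q) ⊖ 1ℤ ≡
               + 1 · (l · l · l ⊕ (⊝ t) · l · l ⊕ s · l ⊕ (⊝ 1ℤ)) ⊕ (⊝ (l · m)) · q
    identity = solveℤ

  unit⇒¬Z : ∀ {l l′} → Z (l · l′ ⊖ 1ℤ) → ¬ Z l
  unit⇒¬Z {l} {l′} z zl = ¬Z-1 (Z₂ l′ ℤ.-1ℤ zl z (identity l l′))
    where
    identity : ∀ l l′ → 1ℤ ≡ l′ · l ⊕ ℤ.-1ℤ · (l · l′ ⊖ 1ℤ)
    identity = solveℤ

  -- For determinant 1, x = adj(γ) γ x, so γ x ≡ l x gives x ≡ l γ⁻¹ x; cancelling l by means of l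
  -- l′ ≡ 1 leaves γ⁻¹ x ≡ l′ x.
  fixed-inverse : ∀ A l x → det ⟦ A ⟧ ≡ 1ℤ → Fixed ⟦ A ⟧ (+ l) x → ∃ λ l′ → l′ < q × Fixed ⟦ inverse A ⟧ (+ l′) x
  fixed-inverse A l x det≡1 fixed@(px , killed) = go (eigenvalue-inverse g l det≡1 (fixed⇒eigenvalue g (+ l) x fixed))
    where
    g : Mat3
    g = ⟦ A ⟧
    go : (∃ λ l′ → l′ < q × Z (+ l · + l′ ⊖ 1ℤ)) → ∃ λ l′ → l′ < q × Fixed ⟦ inverse A ⟧ (+ l′) x
    go (l′ , l′<q , z) = l′ , l′<q , px , λ k → subst Z (sym (dot-cong (shift ⟦ inverse A ⟧ (+ l′) k) (shift (inv g) (+ l′) k) (coords x) (shift-cong (+ l′) (⟦⟧-fromMat3 (inv g)) k)))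
      (subst Z (sym (dot-shift (inv g) (+ l′) (coords x) k)) (Z-cancelˡ (+ l) _ (unit⇒¬Z {+ l} {+ l′} z)
        (Z₂ ℤ.-1ℤ (⊝ coords x k) (solved k) z (identity (+ l) (+ l′) (coords x k) (dot (inv g k) (coords x))))))
      where
      identity : ∀ l l′ x y → l · (y ⊖ l′ · x) ≡ ℤ.-1ℤ · (x ⊖ l · y) ⊕ (⊝ x) · (l · l′ ⊖ 1ℤ)
      identity = solveℤ
      regroup : ∀ d l c₀ c₁ c₂ x₀ x₁ x₂ y₀ y₁ y₂ → d ≡ c₀ · y₀ ⊕ c₁ · y₁ ⊕ c₂ · y₂ →
                d ⊖ l · (c₀ · x₀ ⊕ c₁ · x₁ ⊕ c₂ · x₂) ≡ c₀ · (y₀ ⊖ l · x₀) ⊕ c₁ · (y₁ ⊖ l · x₁) ⊕ c₂ · (y₂ ⊖ l · x₂)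
      regroup _ l c₀ c₁ c₂ x₀ x₁ x₂ y₀ y₁ y₂ refl = expand l c₀ c₁ c₂ x₀ x₁ x₂ y₀ y₁ y₂
        where
        expand : ∀ l c₀ c₁ c₂ x₀ x₁ x₂ y₀ y₁ y₂ → (c₀ · y₀ ⊕ c₁ · y₁ ⊕ c₂ · y₂) ⊖ l · (c₀ · x₀ ⊕ c₁ · x₁ ⊕ c₂ · x₂) ≡
                 c₀ · (y₀ ⊖ l · x₀) ⊕ c₁ · (y₁ ⊖ l · x₁) ⊕ c₂ · (y₂ ⊖ l · x₂)
        expand = solveℤ
      killed′ : ∀ i → Z (dot (g i) (coords x) ⊖ + l · coords x i)
      killed′ i = subst Z (dot-shift g (+ l) (coords x) i) (killed i)
      solved : ∀ k → Z (coords x k ⊖ + l · dot (inv g k) (coords x))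
      solved k = subst (λ y → Z (y ⊖ + l · dot (inv g k) (coords x))) (trans (cong (coords x k ·_) det≡1) (ℤₚ.*-identityʳ (coords x k)))
        (Z₃ (cof g i0 k) (cof g i1 k) (cof g i2 k) (killed′ i0) (killed′ i1) (killed′ i2)
          (regroup (coords x k · det g) (+ l) (cof g i0 k) (cof g i1 k) (cof g i2 k) (coords x i0) (coords x i1) (coords x i2)
            (dot (g i0) (coords x)) (dot (g i1) (coords x)) (dot (g i2) (coords x)) (det-solve g (coords x) k)))

-- Summation over dyadic scales

module BoundFixedPairs (q : ℕ) (q! : Prime q) (T L E : ℕ) (65T≤q² : 65 * T ≤ q * q) (T<2^ : T < 2 * 2 ^ L) (1≤E : 1 ≤ E)
                       (divisors : ∀ n → 1 ≤ n → n ≤ q * q → Bound (_∣ⁿ n) E) where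
  open FixedInverse q q!

  FixedPair : Mat × Point → Set
  FixedPair (A , x) = det ⟦ A ⟧ ≡ 1ℤ × normInf ⟦ A ⟧ * normInf (inv ⟦ A ⟧) ≤ T × (∃ λ l → l < q × Fixed ⟦ A ⟧ (+ l) x)

  -- At scale k the sizes are S = 2 · 2^k and R = T / 2^k, so S R ≤ 2T independently of k.
  dyadicBound : ℕ
  dyadicBound = classConstant * (2 * T * (q * q) * (E * E))

  private
    Half : Mat × Point → Set
    Half (A , x) = FixedPair (A , x) × normInf ⟦ A ⟧ ≤ normInf (inv ⟦ A ⟧)

    Dyadic : ℕ → Mat × Point → Set
    Dyadic k (A , x) = Half (A , x) × 2 ^ k ≤ normInf ⟦ A ⟧ × normInf ⟦ A ⟧ < 2 * 2 ^ k

    module _ (k n m : ℕ) (lo : 2 ^ k ≤ n) (n≤m : n ≤ m) (nm≤T : n * m ≤ T) where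
      private
        P : ℕ
        P = 2 ^ k

        instance
          P-nonZero : NonZero P
          P-nonZero = ℕₚ.m^n≢0 2 k

        1≤P : 1 ≤ P
        1≤P = ℕₚ.m^n>0 2 k

        R : ℕ
        R = T / P

        Pm≤T : P * m ≤ T
        Pm≤T = ℕₚ.≤-trans (ℕₚ.*-monoˡ-≤ m lo) nm≤T

        m≤R : m ≤ R
        m≤R = *≤⇒≤/ P Pm≤T

        P≤R : P ≤ R
        P≤R = ℕₚ.≤-trans lo (ℕₚ.≤-trans n≤m m≤R)

        PP≤T : P * P ≤ T
        PP≤T = ℕₚ.≤-trans (ℕₚ.*-monoʳ-≤ P (ℕₚ.≤-trans lo n≤m)) Pm≤T

        -- The origin of 65: q ≤ 8P would give q² ≤ 64 P² ≤ 64 T < 65 T, where strictness needs T ≥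
        -- P² ≥ 1.
        8P<q : 4 * (2 * P) < q
        8P<q = ℕₚ.≰⇒> λ q≤8P → ℕₚ.<-irrefl refl (begin-strict
          64 * T                          <⟨ ℕₚ.m<n+m (64 * T) (ℕₚ.≤-trans 1≤P (ℕₚ.≤-trans (ℕₚ.m≤m*n P P) PP≤T)) ⟩
          65 * T                          ≤⟨ 65T≤q² ⟩
          q * q                           ≤⟨ ℕₚ.*-mono-≤ q≤8P q≤8P ⟩
          4 * (2 * P) * (4 * (2 * P))     ≡⟨ square P ⟩
          64 * (P * P)                    ≤⟨ ℕₚ.*-monoʳ-≤ 64 PP≤T ⟩
          64 * T                          ∎)
          where
          open ℕₚ.≤-Reasoning
          square : ∀ P → 4 * (2 * P) * (4 * (2 * P)) ≡ 64 * (P * P)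
          square = solveℕ

        SR≤2T : 2 * P * R ≤ 2 * T
        SR≤2T = ℕₚ.≤-trans (ℕₚ.≤-reflexive (reassociate P R)) (ℕₚ.*-monoʳ-≤ 2 (m/n*n≤m T P))
          where
          reassociate : ∀ P R → 2 * P * R ≡ 2 * (R * P)
          reassociate = solveℕ

        SS≤q² : 2 * P * (2 * P) ≤ q * q
        SS≤q² = ℕₚ.*-mono-≤ S≤q S≤q
          where
          S≤q : 2 * P ≤ q
          S≤q = ℕₚ.≤-trans (ℕₚ.m≤n*m (2 * P) 4) (ℕₚ.<⇒≤ 8P<q)

        2T≤q² : 2 * T ≤ q * q
        2T≤q² = ℕₚ.≤-trans (ℕₚ.*-monoˡ-≤ T (s≤s (s≤s (z≤n {63})))) 65T≤q²

      bound-dyadic-class : Bound (λ ((A , x) : Mat × Point) → Small (2 * P) R A × (∃ λ l → l < q × Fixed ⟦ A ⟧ (+ l) x)) dyadicBound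
      bound-dyadic-class = bound-≤ (ℕₚ.*-monoʳ-≤ classConstant (ℕₚ.*-monoˡ-≤ (E * E) (ℕₚ.*-monoˡ-≤ (q * q) SR≤2T)))
        (ClassBound.bound-class q q! (2 * P) R E (ℕₚ.≤-trans 1≤P (ℕₚ.m≤n*m P 2)) (ℕₚ.≤-trans 1≤P P≤R) 1≤E (ℕₚ.*-monoʳ-≤ 2 P≤R)
          8P<q (ℕₚ.≤-trans SR≤2T 2T≤q²) (λ n 1≤n n≤ → divisors n 1≤n (ℕₚ.≤-trans n≤ SS≤q²)))

    bound-Dyadic : ∀ k → Bound (Dyadic k) dyadicBound
    -- A member of the class shows that 2^k is at most the smaller norm, whence 2^k ≤ T / 2^k and 8
    -- · 2^k < q; a scale without members may violate these.
    bound-Dyadic k = bound-inhabited λ { (A , _) (((_ , nm≤T , _) , n≤m) , lo , _) →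
      bound-⊆ (λ { {B , x} h → small A nm≤T n≤m lo B x h }) (bound-dyadic-class k (normInf ⟦ A ⟧) (normInf (inv ⟦ A ⟧)) lo n≤m nm≤T) }
      where
      instance
        P-nonZero : NonZero (2 ^ k)
        P-nonZero = ℕₚ.m^n≢0 2 k
      small : ∀ A → normInf ⟦ A ⟧ * normInf (inv ⟦ A ⟧) ≤ T → normInf ⟦ A ⟧ ≤ normInf (inv ⟦ A ⟧) → 2 ^ k ≤ normInf ⟦ A ⟧ →
              ∀ B x → Dyadic k (B , x) → Small (2 * 2 ^ k) (T / 2 ^ k) B × (∃ λ l → l < q × Fixed ⟦ B ⟧ (+ l) x)
      small A nm≤T n≤m lo B x (((det≡1 , nm′≤T , fixed) , _) , lo′ , hi′) =
        ((λ i j → ℕₚ.≤-trans (entry≤normInf ⟦ B ⟧ i j) (ℕₚ.<⇒≤ hi′)) ,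
         (λ i j → ℕₚ.≤-trans (entry≤normInf (inv ⟦ B ⟧) j i) (*≤⇒≤/ (2 ^ k) (ℕₚ.≤-trans (ℕₚ.*-monoˡ-≤ (normInf (inv ⟦ B ⟧)) lo′) nm′≤T))) ,
         det≡1) , fixed

    bound-Half : Bound Half (suc L * dyadicBound)
    bound-Half = bound-⊆ (λ { {A , x} h → dyadic A x h }) (bound-∃ ℕₚ._≟_ (bound-< (suc L)) λ k _ → bound-Dyadic k)
      where
      dyadic : ∀ A x → Half (A , x) → ∃ λ k → k < suc L × Dyadic k (A , x)
      dyadic A x h@((det≡1 , nm≤T , _) , n≤m) = go (power-of-two (normInf ⟦ A ⟧) (1≤normInf ⟦ A ⟧ det≡1))
        where
        n≤T : normInf ⟦ A ⟧ ≤ T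
        n≤T = ℕₚ.≤-trans (ℕₚ.m≤m*n (normInf ⟦ A ⟧) (normInf (inv ⟦ A ⟧)) {{ℕ.>-nonZero (ℕₚ.≤-trans (1≤normInf ⟦ A ⟧ det≡1) n≤m)}}) nm≤T
        go : (∃ λ k → 2 ^ k ≤ normInf ⟦ A ⟧ × normInf ⟦ A ⟧ < 2 * 2 ^ k) → ∃ λ k → k < suc L × Dyadic k (A , x)
        go (k , lo , hi) = k , ℕₚ.≰⇒> (λ L<k → ℕₚ.<-irrefl refl (ℕₚ.<-≤-trans T<2^
          (ℕₚ.≤-trans (ℕₚ.^-monoʳ-≤ 2 L<k) (ℕₚ.≤-trans lo n≤T)))) , h , lo , hi

    swap : Mat × Point → Mat × Point
    swap (A , x) = inverse A , x

    swap-Half : ∀ A x → FixedPair (A , x) → normInf (inv ⟦ A ⟧) ≤ normInf ⟦ A ⟧ → Half (swap (A , x))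
    swap-Half A x (det≡1 , nm≤T , l , l<q , fixed) m≤n =
      (det-inverse A det≡1 , subst (_≤ T) (trans (ℕₚ.*-comm (normInf ⟦ A ⟧) (normInf (inv ⟦ A ⟧))) (cong (normInf (inv ⟦ A ⟧) *_) norm≡)) nm≤T ,
       fixed-inverse A l x det≡1 fixed) ,
      subst (normInf (inv ⟦ A ⟧) ≤_) norm≡ m≤n
      where
      norm≡ : normInf ⟦ A ⟧ ≡ normInf (inv ⟦ inverse A ⟧)
      norm≡ = normInf-cong λ i j → sym (inv-inverse A det≡1 i j)

    Swapped : Mat × Point → Set
    Swapped (A , x) = FixedPair (A , x) × normInf (inv ⟦ A ⟧) ≤ normInf ⟦ A ⟧

    bound-Swapped : Bound Swapped (suc L * dyadicBound)
    bound-Swapped = bound-injective swap (λ { {A , x} (pair , m≤n) → swap-Half A x pair m≤n })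
      (λ { {A , x} {B , y} ((a , _) , _) ((b , _) , _) e → cong₂ _,_ (inverse-injective A B a b (cong proj₁ e)) (cong proj₂ e) }) bound-Half

  bound-FixedPairs : Bound FixedPair (suc L * dyadicBound + suc L * dyadicBound)
  bound-FixedPairs = bound-⊆ (λ { {A , x} pair → order A x pair (ℕₚ.≤-total (normInf ⟦ A ⟧) (normInf (inv ⟦ A ⟧))) }) (bound-⊎ bound-Half bound-Swapped)
    where
    order : ∀ A x → FixedPair (A , x) → normInf ⟦ A ⟧ ≤ normInf (inv ⟦ A ⟧) ⊎ normInf (inv ⟦ A ⟧) ≤ normInf ⟦ A ⟧ → Half (A , x) ⊎ Swapped (A , x)
    order A x pair (inj₁ n≤m) = inj₁ (pair , n≤m)
    order A x pair (inj₂ m≤n) = inj₂ (pair , m≤n)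

-- From lists to cardinalities

module _ {G V X Y : Set} (f : G → Bool) (h : G → V → Bool) (c : G → X) (d : V → Y) (vs : List V) where

  private
    fibre : G → List V
    fibre g = filter (λ v → h g v Bool.≟ true) vs

    pairs : Bool → G → List (X × Y)
    pairs b g = if b then map (λ v → c g , d v) (fibre g) else []

    length-pairs : ∀ b g → length (pairs b g) ≡ (if b then length (fibre g) else 0)
    length-pairs false g = refl
    length-pairs true  g = Listₚ.length-map (λ v → c g , d v) (fibre g)

    length-all : ∀ gs → length (concatMap (λ g → pairs (f g) g) gs) ≡ sum (map (λ g → if f g then length (fibre g) else 0) gs)
    length-all []       = refl
    length-all (g ∷ gs) = trans (Listₚ.length-++ (pairs (f g) g)) (cong₂ _+_ (length-pairs (f g) g) (length-all gs))

    first : ∀ b g → All (λ p → proj₁ p ≡ c g) (pairs b g)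
    first false g = []
    first true  g = Allₚ.map⁺ (All.universal (λ _ → refl) (fibre g))

    unique-pairs : AllPairs (λ v w → d v ≢ d w) vs → ∀ b g → Unique (pairs b g)
    unique-pairs vs! false g = []
    unique-pairs vs! true  g = AllPairsₚ.map⁺ (AllPairs.map (λ d≢ e → d≢ (cong proj₂ e)) (AllPairsₚ.filter⁺ (λ v → h g v Bool.≟ true) vs!))

    disjoint : ∀ {g g′} → c g ≢ c g′ → All (λ p → All (p ≢_) (pairs (f g′) g′)) (pairs (f g) g)
    disjoint {g} {g′} c≢ = All.map (λ p≡ → All.map (λ p′≡ e → c≢ (trans (sym p≡) (trans (cong proj₁ e) p′≡))) (first (f g′) g′)) (first (f g) g)

  -- The sum of lengths is the length of one repetition-free list of pairs, to which a `Bound`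
  -- applies. Matrices and points are functions here, so distinctness is asked of their images under
  -- c and d.
  count-pairs : {Φ : X × Y → Set} {Ψ : V → Set} {N : ℕ} → All Ψ vs → (∀ g v → f g ≡ true → h g v ≡ true → Ψ v → Φ (c g , d v)) →
                AllPairs (λ v w → d v ≢ d w) vs → Bound Φ N → ∀ gs → AllPairs (λ g g′ → c g ≢ c g′) gs →
                sum (map (λ g → if f g then length (fibre g) else 0) gs) ≤ N
  count-pairs {Φ} {Ψ} ψs valid vs! bound gs gs! = subst (_≤ _) (length-all gs)
    (bound (concatMap (λ g → pairs (f g) g) gs)
      (AllPairsₚ.concat⁺ (Allₚ.map⁺ (All.universal (λ g → unique-pairs vs! (f g) g) gs)) (AllPairsₚ.map⁺ (AllPairs.map disjoint gs!)))
      (Allₚ.concat⁺ (Allₚ.map⁺ (All.universal (λ g → valid-pairs (f g) g refl) gs))))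
    where
    valid-pairs : ∀ b g → f g ≡ b → All Φ (pairs b g)
    valid-pairs false g _   = []
    valid-pairs true  g fg  = Allₚ.map⁺ (All.zipWith (λ (hgv , ψ) → valid g _ fg hgv ψ)
      (Allₚ.all-filter (λ v → h g v Bool.≟ true) vs , Allₚ.filter⁺ (λ v → h g v Bool.≟ true) ψs))

-- Distinctness is witnessed by an index where the entries are related by D. In this form it can be
-- iterated, and two applications separate matrices at an entry (i, j).
cube-apart : {A : Set} {D : A → A → Set} (xs : List A) → AllPairs D xs → AllPairs (λ f g → ∃ λ i → D (f i) (g i)) (cube xs)
cube-apart {A} {D} xs xs! =
  AllPairsₚ.concat⁺
    (Allₚ.map⁺ (All.universal (λ a → AllPairsₚ.concat⁺
      (Allₚ.map⁺ (All.universal (λ b → AllPairsₚ.map⁺ (AllPairs.map (λ δ → i2 , δ) xs!)) xs))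
      (AllPairsₚ.map⁺ (AllPairs.map (λ δ → Allₚ.map⁺ (All.universal (λ _ → Allₚ.map⁺ (All.universal (λ _ → i1 , δ) xs)) xs)) xs!))) xs))
    (AllPairsₚ.map⁺ (AllPairs.map (λ δ →
      Allₚ.concat⁺ (Allₚ.map⁺ (All.universal (λ _ → Allₚ.map⁺ (All.universal (λ _ →
        Allₚ.concat⁺ (Allₚ.map⁺ (All.universal (λ _ → Allₚ.map⁺ (All.universal (λ _ → i0 , δ) xs)) xs))) xs)) xs))) xs!))

range-unique : ∀ n → Unique (range n)
range-unique n = AllPairsₚ.++⁺
  (AllPairsₚ.map⁺ (AllPairs.map (λ i≢j e → i≢j (ℤₚ.+-injective e)) (Uniqueₚ.upTo⁺ (suc n))))
  (AllPairsₚ.map⁺ (AllPairs.map (λ i≢j e → i≢j (ℤₚ.-[1+-injective e)) (Uniqueₚ.upTo⁺ n)))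
  (Allₚ.map⁺ (All.universal (λ _ → Allₚ.map⁺ (All.universal (λ _ ()) (upTo n))) (upTo (suc n))))

box-apart : ∀ n → AllPairs (λ g h → fromMat3 g ≢ fromMat3 h) (box n)
box-apart n = AllPairs.map (λ { {g} {h} (i , j , gij≢hij) e → gij≢hij
    (trans (sym (⟦⟧-fromMat3 g i j)) (trans (cong (λ A → ⟦ A ⟧ i j) e) (⟦⟧-fromMat3 h i j))) })
  (cube-apart (cube (range n)) (cube-apart (range n) (range-unique n)))

P2-apart : ∀ q → AllPairs (λ v w → tuple v ≢ tuple w) (P2 q)
P2-apart q = AllPairsₚ.++⁺
  (AllPairsₚ.concat⁺
    (Allₚ.map⁺ (All.universal (λ a → AllPairsₚ.map⁺ (AllPairs.map (λ b≢ e → b≢ (cong (proj₂ ∘ proj₂) e)) (Uniqueₚ.upTo⁺ q))) (upTo q)))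
    (AllPairsₚ.map⁺ (AllPairs.map (λ a≢ → Allₚ.map⁺ (All.universal (λ _ → Allₚ.map⁺ (All.universal (λ _ e → a≢ (cong (proj₁ ∘ proj₂) e)) (upTo q))) (upTo q))) (Uniqueₚ.upTo⁺ q))))
  (AllPairsₚ.++⁺ (AllPairsₚ.map⁺ (AllPairs.map (λ b≢ e → b≢ (cong (proj₂ ∘ proj₂) e)) (Uniqueₚ.upTo⁺ q))) ([] ∷ [])
    (Allₚ.map⁺ (All.universal (λ _ → (λ ()) ∷ []) (upTo q))))
  (Allₚ.concat⁺ (Allₚ.map⁺ (All.universal (λ _ → Allₚ.map⁺ (All.universal (λ _ →
    Allₚ.++⁺ (Allₚ.map⁺ (All.universal (λ _ ()) (upTo q))) ((λ ()) ∷ [])) (upTo q))) (upTo q))))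

module CountBound (q : ℕ) (q! : Prime q) where
  open FixedInverse q q! public

  P2-projective : All (Projective ∘ tuple) (P2 q)
  P2-projective = Allₚ.++⁺
    (Allₚ.concat⁺ (Allₚ.map⁺ (All.tabulate λ a∈ → Allₚ.map⁺ (All.tabulate λ b∈ →
      inj₁ (_ , _ , ∈ₚ.∈-upTo⁻ a∈ , ∈ₚ.∈-upTo⁻ b∈ , refl)))))
    (Allₚ.++⁺ (Allₚ.map⁺ (All.tabulate λ b∈ → inj₂ (inj₁ (_ , ∈ₚ.∈-upTo⁻ b∈ , refl)))) (inj₂ (inj₂ refl) ∷ []))

  congB⇒Z : ∀ x y → T (congB q x y) → Z (x ⊖ y)
  congB⇒Z x y t = ∣ᵤ⇒∣ (toWitness t)

  private
    Congruent : Mat3 → Vec3 ℕ → ℕ → Bool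
    Congruent g v l = congB q (act g v i0) (+ (l * v i0)) ∧ congB q (act g v i1) (+ (l * v i1)) ∧ congB q (act g v i2) (+ (l * v i2))

  fixedB⇒Fixed : ∀ g v → fixedB q g v ≡ true → Projective (tuple v) → ∃ λ l → l < q × Fixed ⟦ fromMat3 g ⟧ (+ l) (tuple v)
  fixedB⇒Fixed g v e pv = go (find (Anyₚ.map⁻ (Anyₚ.any⁻ (Congruent g v) (map suc (upTo (q ∸ 1))) (subst T (sym e) tt))))
    where
    go : (∃ λ m → m ∈ upTo (q ∸ 1) × T (Congruent g v (suc m))) → ∃ λ l → l < q × Fixed ⟦ fromMat3 g ⟧ (+ l) (tuple v)
    go (m , m∈ , t) = l , l<q , pv , cyclic-cases _ i0
        (killed i0 (proj₁ t₀)) (killed i1 (proj₁ t₁)) (killed i2 (proj₂ t₁))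
      where
      l : ℕ
      l = suc m
      l<q : l < q
      l<q = subst (suc l ≤_) (ℕₚ.m+[n∸m]≡n (ℕₚ.<⇒≤ 1<q)) (s≤s (∈ₚ.∈-upTo⁻ m∈))
      t₀ = Equivalence.to (T-∧ {congB q (act g v i0) (+ (l * v i0))}) t
      t₁ = Equivalence.to (T-∧ {congB q (act g v i1) (+ (l * v i1))}) (proj₂ t₀)
      killed : ∀ i → T (congB q (act g v i) (+ (l * v i))) → Killed (shift ⟦ fromMat3 g ⟧ (+ l) i) (tuple v)
      killed i t = subst Z (sym (trans (dot-shift ⟦ fromMat3 g ⟧ (+ l) (coords (tuple v)) i)
          (cong₂ _⊖_ (dot-cong (⟦ fromMat3 g ⟧ i) (g i) (coords (tuple v)) (⟦⟧-fromMat3 g i))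
            (trans (cong (λ x → + l · + x) (at-tuple v i)) (sym (ℤₚ.pos-* l (v i)))))))
        (congB⇒Z (act g v i) (+ (l * v i)) t)

  module _ (T₀ L E : ℕ) (65T≤q² : 65 * T₀ ≤ q * q) (T<2^ : T₀ < 2 * 2 ^ L) (1≤E : 1 ≤ E)
           (divisors : ∀ n → 1 ≤ n → n ≤ q * q → Bound (_∣ⁿ n) E) where
    open BoundFixedPairs q q! T₀ L E 65T≤q² T<2^ 1≤E divisors

    private
      goodB⇒ : ∀ g → goodB T₀ g ≡ true → det ⟦ fromMat3 g ⟧ ≡ 1ℤ × normInf ⟦ fromMat3 g ⟧ * normInf (inv ⟦ fromMat3 g ⟧) ≤ T₀
      goodB⇒ g e = toWitness (proj₁ t) , ℕₚ.≤ᵇ⇒≤ _ T₀ (proj₂ t)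
        where
        t = Equivalence.to (T-∧ {⌊ det g ℤ.≟ 1ℤ ⌋}) (subst T (sym e) tt)

    count≤ : count q T₀ ≤ suc L * dyadicBound + suc L * dyadicBound
    count≤ = count-pairs (goodB T₀) (fixedB q) fromMat3 tuple (P2 q) P2-projective
      (λ g v good fixed pv → proj₁ (goodB⇒ g good) , proj₂ (goodB⇒ g good) , fixedB⇒Fixed g v fixed pv)
      (P2-apart q) bound-FixedPairs (box T₀) (box-apart T₀)

-- Absorbing the number of scales and the divisor bound into q^ε

^-cancelˡ-≤ : ∀ k .{{_ : NonZero k}} {x y} → x ^ k ≤ y ^ k → x ≤ y
^-cancelˡ-≤ k x^≤y^ = ℕₚ.≮⇒≥ λ y<x → ℕₚ.<⇒≱ (ℕₚ.^-monoˡ-< k y<x) x^≤y^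

n≤n^k : ∀ n k → 1 ≤ n → 1 ≤ k → n ≤ n ^ k
n≤n^k n (suc k) 1≤n _ = ℕₚ.m≤m*n n (n ^ k) {{ℕₚ.m^n≢0 n k {{ℕ.>-nonZero 1≤n}}}}

-- The factor (L + 1) E² from the dyadic scales and the divisor function: bounding its 4b-th power by M q⁴ costs only q after taking roots.
module Subpolynomial (b : ℕ) .{{_ : NonZero b}} where

  private
    instance
      4b-nonZero : NonZero (4 * b)
      4b-nonZero = ℕₚ.m*n≢0 4 b
      8b-nonZero : NonZero (2 * (4 * b))
      8b-nonZero = ℕₚ.m*n≢0 2 (4 * b)

    A : ℕ
    -- The successor makes `A` positive, which pays for replacing E by 1 if the divisor bound
    -- returns 0.
    A = suc (proj₁ (divisor-bound (2 * (4 * b))))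

  M : ℕ
  M = (4 * b) ^ (4 * b) * 2 * A

  1≤M : 1 ≤ M
  1≤M = ℕₚ.*-mono-≤ (ℕₚ.*-mono-≤ (ℕₚ.m^n>0 (4 * b) (4 * b)) (s≤s (z≤n {1}))) (s≤s (z≤n {proj₁ (divisor-bound (2 * (4 * b)))}))

  divisors : ∀ q → 1 ≤ q → Σ ℕ λ E → 1 ≤ E × (∀ n → 1 ≤ n → n ≤ q * q → Bound (_∣ⁿ n) E) × E ^ (2 * (4 * b)) ≤ A * (q * q)
  divisors q 1≤q = go (proj₂ (divisor-bound (2 * (4 * b))) (q * q))
    where
    go : (Σ ℕ λ E → (∀ n → 1 ≤ n → n ≤ q * q → Bound (_∣ⁿ n) E) × E ^ (2 * (4 * b)) ≤ ℕ.pred A * (q * q)) →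
         Σ ℕ λ E → 1 ≤ E × (∀ n → 1 ≤ n → n ≤ q * q → Bound (_∣ⁿ n) E) × E ^ (2 * (4 * b)) ≤ A * (q * q)
    go (zero , bound , _)   = 1 , s≤s z≤n , (λ n 1≤n n≤ → bound-≤ z≤n (bound n 1≤n n≤)) ,
      subst (_≤ A * (q * q)) (sym (ℕₚ.^-zeroˡ (2 * (4 * b)))) (ℕₚ.*-mono-≤ (s≤s (z≤n {ℕ.pred A})) (ℕₚ.*-mono-≤ 1≤q 1≤q))
    go (suc E , bound , E≤) = suc E , s≤s z≤n , bound , ℕₚ.≤-trans E≤ (ℕₚ.*-monoˡ-≤ (q * q) (ℕₚ.n≤1+n (ℕ.pred A)))

  subpolynomial : ∀ q L E → 1 ≤ q → 2 ^ L ≤ 2 * (q * q) → E ^ (2 * (4 * b)) ≤ A * (q * q) → (suc L * (E * E)) ^ b ≤ M * q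
  subpolynomial q L E 1≤q 2^L≤ E≤ = ^-cancelˡ-≤ 4 (begin
    (X ^ b) ^ 4                                                       ≡⟨ ℕₚ.^-*-assoc X b 4 ⟩
    X ^ (b * 4)                                                       ≡⟨ cong (X ^_) (ℕₚ.*-comm b 4) ⟩
    X ^ (4 * b)                                                       ≡⟨ ^-distribʳ-* (suc L) (E * E) (4 * b) ⟩
    suc L ^ (4 * b) * (E * E) ^ (4 * b)                               ≡⟨ cong (λ e → suc L ^ (4 * b) * e ^ (4 * b)) (cong (E *_) (sym (ℕₚ.*-identityʳ E))) ⟩
    suc L ^ (4 * b) * (E ^ 2) ^ (4 * b)                               ≡⟨ cong (suc L ^ (4 * b) *_) (ℕₚ.^-*-assoc E 2 (4 * b)) ⟩
    -- (L + 1)^(4b) is at most a constant times 2^L ≤ 2q², and E^(8b) ≤ A q² is the divisor bound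
    -- with exponent 8b for numbers up to q²; together they give q⁴.
    suc L ^ (4 * b) * E ^ (2 * (4 * b))                               ≤⟨ ℕₚ.*-mono-≤ (ℕₚ.≤-trans (suc^≤ (4 * b) L) (ℕₚ.*-monoʳ-≤ ((4 * b) ^ (4 * b)) 2^L≤)) E≤ ⟩
    (4 * b) ^ (4 * b) * (2 * (q * q)) * (A * (q * q))                 ≡⟨ regroup ((4 * b) ^ (4 * b)) A q ⟩
    M * q ^ 4                                                         ≤⟨ ℕₚ.*-monoˡ-≤ (q ^ 4) (n≤n^k M 4 1≤M (s≤s z≤n)) ⟩
    M ^ 4 * q ^ 4                                                     ≡⟨ ^-distribʳ-* M q 4 ⟨
    (M * q) ^ 4                                                       ∎)
    where
    open ℕₚ.≤-Reasoning
    X : ℕ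
    X = suc L * (E * E)
    regroup : ∀ c A q → c * (2 * (q * q)) * (A * (q * q)) ≡ c * 2 * A * (q * (q * (q * (q * 1))))
    regroup = solveℕ

private
  C : ℕ
  C = 4 * classConstant

  count-subpolynomial : ∀ q → Prime q → ∀ T L E → 65 * T ≤ q * q → T < 2 * 2 ^ L → 1 ≤ E →
                        (∀ n → 1 ≤ n → n ≤ q * q → Bound (_∣ⁿ n) E) → count q T ≤ C * (suc L * (E * E)) * (q * q) * T
  count-subpolynomial q q! T L E 65T≤ T<2^ 1≤E divisors = ℕₚ.≤-trans (CountBound.count≤ q q! T L E 65T≤ T<2^ 1≤E divisors)
    (ℕₚ.≤-reflexive (collect classConstant (suc L) T q E))
    where
    collect : ∀ c s T q E → s * (c * (2 * T * (q * q) * (E * E))) + s * (c * (2 * T * (q * q) * (E * E))) ≡ 4 * c * (s * (E * E)) * (q * q) * T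
    collect = solveℕ

-- With C = 1/65, a matrix with ‖γ‖ ≤ ‖γ⁻¹‖ has entries at most S = 2·2^k ≤ 2 ‖γ‖ where 4 S < q, so residues determine entries.
theorem1p4 : Σ ℕ λ cn → Σ ℕ λ cd → 1 ≤ cn × 1 ≤ cd ×
    ((a b : ℕ) → 1 ≤ a → 1 ≤ b →
    Σ ℕ λ A → (q : ℕ) → Prime q → (T : ℕ) → T * cd ≤ cn * q ^ 2 →
    count q T ^ b ≤ A ^ b * q ^ (2 * b + a) * T ^ b)
theorem1p4 = 1 , 65 , s≤s z≤n , s≤s z≤n , λ a b 1≤a 1≤b → C * M b 1≤b , λ q q! T T*65≤ → bound a b 1≤a 1≤b q q! T T*65≤
  where
  M : ∀ b → 1 ≤ b → ℕ
  M b 1≤b = Subpolynomial.M b {{ℕ.>-nonZero 1≤b}}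

  bound : ∀ a b (1≤a : 1 ≤ a) (1≤b : 1 ≤ b) q → Prime q → ∀ T → T * 65 ≤ 1 * q ^ 2 → count q T ^ b ≤ (C * M b 1≤b) ^ b * q ^ (2 * b + a) * T ^ b
  -- L is taken from T + 1 because T may be 0.
  bound a b 1≤a 1≤b q q! T T*65≤ = go (power-of-two (suc T) (s≤s z≤n)) (divisors q 1≤q)
    where
    open Subpolynomial b {{ℕ.>-nonZero 1≤b}} using (divisors; subpolynomial; 1≤M)
    open ℕₚ.≤-Reasoning
    1≤q : 1 ≤ q
    1≤q = ℕ.>-nonZero⁻¹ q {{prime⇒nonZero q!}}
    65T≤ : 65 * T ≤ q * q
    65T≤ = subst₂ _≤_ (ℕₚ.*-comm T 65) (trans (ℕₚ.*-identityˡ (q ^ 2)) (cong (q *_) (ℕₚ.*-identityʳ q))) T*65≤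
    1+T≤ : suc T ≤ 2 * (q * q)
    1+T≤ = ℕₚ.≤-trans (ℕₚ.+-mono-≤ (ℕₚ.*-mono-≤ 1≤q 1≤q) (ℕₚ.≤-trans (ℕₚ.m≤n*m T 65) 65T≤)) (ℕₚ.≤-reflexive (cong (λ z → q * q + z) (sym (ℕₚ.+-identityʳ (q * q)))))
    regroup : ∀ C X Q T → (C * X * Q * T) ^ b ≡ C ^ b * X ^ b * Q ^ b * T ^ b
    regroup C X Q T = trans (^-distribʳ-* (C * X * Q) T b) (cong (_* T ^ b) (trans (^-distribʳ-* (C * X) Q b) (cong (_* Q ^ b) (^-distribʳ-* C X b))))
    -- The loss (L + 1) E² has b-th power at most M q, which amounts to ε = 1/b; as a ≥ 1, this
    -- single q fits into q^a.
    q-power : q * (q * q) ^ b ≤ q ^ (2 * b + a)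
    q-power = begin
      q * (q * q) ^ b          ≡⟨ ℕₚ.*-comm q ((q * q) ^ b) ⟩
      (q * q) ^ b * q          ≤⟨ ℕₚ.*-monoʳ-≤ ((q * q) ^ b) (n≤n^k q a 1≤q 1≤a) ⟩
      (q * q) ^ b * q ^ a      ≡⟨ cong (λ s → s ^ b * q ^ a) (cong (q *_) (sym (ℕₚ.*-identityʳ q))) ⟩
      (q ^ 2) ^ b * q ^ a      ≡⟨ cong (_* q ^ a) (ℕₚ.^-*-assoc q 2 b) ⟩
      q ^ (2 * b) * q ^ a      ≡⟨ ℕₚ.^-distribˡ-+-* q (2 * b) a ⟨
      q ^ (2 * b + a)          ∎
    go : _ → _ → count q T ^ b ≤ (C * M b 1≤b) ^ b * q ^ (2 * b + a) * T ^ b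
    go (L , 2^L≤ , T<2^) (E , 1≤E , divs , E≤) = begin
      count q T ^ b
        ≤⟨ ℕₚ.^-monoˡ-≤ b (count-subpolynomial q q! T L E 65T≤ (ℕₚ.<-trans (ℕₚ.n<1+n T) T<2^) 1≤E divs) ⟩
      (C * (suc L * (E * E)) * (q * q) * T) ^ b
        ≡⟨ regroup C (suc L * (E * E)) (q * q) T ⟩
      C ^ b * (suc L * (E * E)) ^ b * (q * q) ^ b * T ^ b
        ≤⟨ ℕₚ.*-monoˡ-≤ (T ^ b) (ℕₚ.*-monoˡ-≤ ((q * q) ^ b) (ℕₚ.*-monoʳ-≤ (C ^ b) (subpolynomial q L E 1≤q (ℕₚ.≤-trans 2^L≤ 1+T≤) E≤))) ⟩
      C ^ b * (M b 1≤b * q) * (q * q) ^ b * T ^ b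
        ≤⟨ ℕₚ.*-monoˡ-≤ (T ^ b) (ℕₚ.*-monoˡ-≤ ((q * q) ^ b) (ℕₚ.*-monoʳ-≤ (C ^ b) (ℕₚ.*-monoˡ-≤ q (n≤n^k (M b 1≤b) b 1≤M 1≤b)))) ⟩
      C ^ b * (M b 1≤b ^ b * q) * (q * q) ^ b * T ^ b
        ≡⟨ cong (_* T ^ b) (shuffle (C ^ b) (M b 1≤b ^ b) q ((q * q) ^ b)) ⟩
      C ^ b * M b 1≤b ^ b * (q * (q * q) ^ b) * T ^ b
        ≤⟨ ℕₚ.*-monoˡ-≤ (T ^ b) (ℕₚ.*-monoʳ-≤ (C ^ b * M b 1≤b ^ b) q-power) ⟩
      C ^ b * M b 1≤b ^ b * q ^ (2 * b + a) * T ^ b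
        ≡⟨ cong (λ A → A * q ^ (2 * b + a) * T ^ b) (^-distribʳ-* C (M b 1≤b) b) ⟨
      (C * M b 1≤b) ^ b * q ^ (2 * b + a) * T ^ b ∎
      where
      shuffle : ∀ c m q s → c * (m * q) * s ≡ c * m * (q * s)
      shuffle = solveℕ
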